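{- Consider the following dynamic problem: given a set of $(1/\varepsilon)$-spread weight classes $[\ell_1,r_1),\dots,[\ell_k,r_k)\subseteq\mathbb{R}$ and a set of $k$ matchings $M_1,\dots,M_k\subseteq G$ undergoing adversarial edge deletions/insertions and satisfying $M_i\subseteq G_{[\ell_i,r_i)}$ for all $i\in\{1,\dots,k\}$, dynamically maintain a matching $M$ satisfying $$w(M)\ge(1-O(\varepsilon))\sum_{i=1}^k w(M_i).$$ The algorithm with the procedures Initialize, Insert and Delete described in the context initializes in $O(m)$ time and solves this problem by dynamically maintaining a locally greedy census matching of $M_1,\dots,M_k$ with $\min\{O(\log k),O(k/\log n)\}$ worst-case update time and $O(1)$ worst-case recourse.
   Context: $G$ is an undirected $n$-vertex $m$-edge graph with positive edge weights $w$. A matching is a set of vertex-disjoint edges, and $w(M)=\sum_{e\in M}w(e)$. For $I\subseteq\mathbb{R}$, $G_I$ is the subgraph of $G$ restricted to the edges $e$ with $w(e)\in I$. Disjoint intervals $[\ell_1,r_1),\dots,[\ell_k,r_k)$ are $\delta$-spread if $\ell_{i+1}\ge\delta\cdot r_i$ for all $1\le i\le k-1$. Locally greedy census matching: given $k$ matchings $M_1,\dots,M_k\subseteq G$, a matching $M$ is a locally greedy census matching of $M_1,\dots,M_k$ if for every edge $e\in M_i\setminus M$ there exists an edge $f\in M_j$ for some $j>i$ with $e\cap f\ne\emptyset$ (i.e. $e$ and $f$ share an endpoint). The algorithm. It keeps, for each vertex $u$, a set $N_u$ of edges incident to $u$, and a current output matching ("the matching"). An edge of $M_i$ is in the $i$-th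 weight class, and a class with larger index is higher. Initialize: set $N_u\gets\emptyset$ for every vertex $u$. For $j=k,k-1,\dots,1$ and each $uv\in M_j$: if $N_u=\emptyset$ and $N_v=\emptyset$, add $uv$ to the matching; then add $uv$ to $N_u$ and $N_v$. Insert$(j,uv)$ (edge $uv$ is inserted into $M_j$): add $uv$ to $N_u$ and $N_v$. If $u$ is matched to some $u'$ with $uu'\in M_i$, $i<j$, delete $uu'$ from the matching. If $v$ is matched to some $v'$ with $vv'\in M_i$, $i<j$, delete $vv'$ from the matching. If $uv$ is in the highest weight class among $N_u$ and $N_v$, add $uv$ to the matching. Delete$(j,uv)$ (edge $uv$ is deleted from $M_j$): delete $uv$ from $N_u$ and $N_v$ (and from the matching, if present). If $N_u\neq\emptyset$, let $uu'$ be the edge in the highest weight class among $N_u$; if $uu'$ is in the highest weight class among $N_{u'}$, add $uu'$ to the matching. If $N_v\ne\emptyset$, let $vv'$ be the edge in the highest weight class among $N_v$; if $vv'$ is in the highest weight class among $N_{v'}$, add $vv'$ to the matching. The worst-case recourse is the maximum over updates of the size of the symmetric difference of the output matchings before and after the update. Computation is in the Word-RAM model, in which arithmetic operations on $\Theta(\log n)$-bit words take constant time. -}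

module Defs where

open import Level using (Level; _⊔_) renaming (suc to lsuc)
open import Data.Bool using (Bool; true; false; if_then_else_; _∧_; _∨_; _xor_)
open import Data.Fin using (Fin; toℕ; _≟_) renaming (_<_ to _<ᶠ_; _≥_ to _≥ᶠ_)
open import Data.Fin.Properties using (any?; all?; _<?_)
open import Data.Fin.Subset
  using (Subset; _∈_; _∉_; _∪_; _─_; _-_; ⁅_⁆) renaming (⊥ to ∅)
open import Data.Fin.Subset.Properties using (_∈?_; nonempty?)
open import Data.List using (List; []; _∷_; _++_; foldl; length; replicate; concatMap)
open import Data.List.Membership.Propositional using () renaming (_∈_ to _∈ˡ_)
open import Data.List.Relation.Unary.AllPairs using (AllPairs)
open import Data.List.Relation.Unary.Unique.Propositional using (Unique)
import Data.Nat as ℕ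
open import Data.Nat using (ℕ; zero; suc; _^_; _%_; _/_)
open import Data.Nat.Logarithm using (⌊log₂_⌋)
open import Data.Nat.Properties using (m^n≢0)
open import Data.Product using (_×_; _,_; ∃-syntax; proj₁; proj₂)
open import Data.Sum using (_⊎_)
open import Data.Vec using (lookup)
open import Data.Vec.Functional using (updateAt)
open import Function using (_⇔_)
open import Relation.Binary using (Rel)
open import Relation.Binary.PropositionalEquality using (_≡_; _≢_)
open import Relation.Nullary using (¬_; Dec; yes; no; does; ¬?; _×-dec_; _⊎-dec_; _→-dec_)
open import Relation.Unary using (Pred)
open import Algebra.Bundles using (CommutativeRing)
import Algebra.Definitions.RawMonoid as RawMonoidOps
open import Relation.Binary.Structures using (IsTotalOrder)

----------------------------------------------------------------------
-- Scalars

-- Weights, interval ends and ε range over an arbitrary (classical) ordered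
-- field; ℝ is the intended instance.

record OrderedField c ℓ₁ ℓ₂ : Set (lsuc (c ⊔ ℓ₁ ⊔ ℓ₂)) where
  infix  4 _≤_ _<_
  infix  8 _⁻¹
  field
    commutativeRing : CommutativeRing c ℓ₁
  open CommutativeRing commutativeRing public
  field
    _≤_          : Rel Carrier ℓ₂
    isTotalOrder : IsTotalOrder _≈_ _≤_
    +-monoˡ-≤    : ∀ {x y} z → x ≤ y → (x + z) ≤ (y + z)
    *-nonneg     : ∀ {x y} → 0# ≤ x → 0# ≤ y → 0# ≤ (x * y)
    0≉1          : ¬ (0# ≈ 1#)
    _⁻¹          : Carrier → Carrier
    -- the value 0# ⁻¹ is unconstrained
    ⁻¹-inverse   : ∀ {x} → ¬ (x ≈ 0#) → (x * x ⁻¹) ≈ 1#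

  _<_ : Rel Carrier (ℓ₁ ⊔ ℓ₂)
  x < y = x ≤ y × ¬ (x ≈ y)

  open RawMonoidOps +-rawMonoid public using (sum) renaming (_×_ to _·_)

----------------------------------------------------------------------
-- Graphs, matchings, weight classes

-- Vertices are Fin n and edges are Fin m.  The order of the two end points of
-- an edge carries no information; by `simple` an edge is determined by the
-- set of its end points.

record Graph (n m : ℕ) : Set where
  field
    ends : Fin m → Fin n × Fin n

  infix 4 _∈ₑ_
  _∈ₑ_ : Fin n → Fin m → Set
  u ∈ₑ e = u ≡ proj₁ (ends e) ⊎ u ≡ proj₂ (ends e)

  field
    loopless : ∀ e → proj₁ (ends e) ≢ proj₂ (ends e)
    simple   : ∀ e f → (∀ u → u ∈ₑ e ⇔ u ∈ₑ f) → e ≡ f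

  infix 4 _∈ₑ?_
  _∈ₑ?_ : ∀ u e → Dec (u ∈ₑ e)
  u ∈ₑ? e = (u ≟ proj₁ (ends e)) ⊎-dec (u ≟ proj₂ (ends e))

  -- the end point of e other than u, for u ∈ₑ e
  opposite : Fin m → Fin n → Fin n
  opposite e u = if does (u ≟ proj₁ (ends e)) then proj₂ (ends e) else proj₁ (ends e)

  Meet : Fin m → Fin m → Set
  Meet e f = ∃[ u ] (u ∈ₑ e × u ∈ₑ f)

  IsMatching : Subset m → Set
  IsMatching S = ∀ {e f} → e ∈ S → f ∈ S → Meet e f → e ≡ f

-- The input M₁,…,M_k; class i of the text has index i - 1 here.
Matchings : ℕ → ℕ → Set
Matchings k m = Fin k → Subset m

module _ {n m : ℕ} (G : Graph n m) where
  open Graph G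

  record LocallyGreedyCensus {k} (M : Matchings k m) (S : Subset m) : Set where
    field
      isMatching : IsMatching S
      census     : ∀ i e → e ∈ M i → e ∉ S → ∃[ j ] ∃[ f ] (i <ᶠ j × f ∈ M j × Meet e f)

infix 6 _△_
_△_ : ∀ {m} → Subset m → Subset m → Subset m
S △ T = (S ─ T) ∪ (T ─ S)

module _ {c ℓ₁ ℓ₂ : Level} (F : OrderedField c ℓ₁ ℓ₂) where
  open OrderedField F

  record WeightedGraph (n m : ℕ) : Set (c ⊔ ℓ₁ ⊔ ℓ₂) where
    field
      graph    : Graph n m
      w        : Fin m → Carrier
      positive : ∀ e → 0# < w e
    open Graph graph public

    weight : Subset m → Carrier
    weight S = sum (λ e → if lookup S e then w e else 0#)

    -- the edge set of the subgraph G_I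
    Restrict : ∀ {a} → Pred Carrier a → Pred (Fin m) a
    Restrict I e = I (w e)

  [_,_⟩ : Carrier → Carrier → Pred Carrier (ℓ₁ ⊔ ℓ₂)
  [ l , r ⟩ x = l ≤ x × x < r

  record IsSpread {k} (δ : Carrier) (l r : Fin k → Carrier) : Set (c ⊔ ℓ₁ ⊔ ℓ₂) where
    field
      proper   : ∀ i → l i < r i
      disjoint : ∀ i j → i ≢ j → ∀ x → [ l i , r i ⟩ x → ¬ [ l j , r j ⟩ x
      spread   : ∀ i j → toℕ j ≡ suc (toℕ i) → (δ * r i) ≤ l j

  record Admissible {n m k} (G : WeightedGraph n m) (l r : Fin k → Carrier)
                    (M : Matchings k m) : Set (ℓ₁ ⊔ ℓ₂) where
    open WeightedGraph G
    field
      matchings : ∀ i → IsMatching (M i)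
      inClass   : ∀ i e → e ∈ M i → Restrict [ l i , r i ⟩ e

----------------------------------------------------------------------
-- Updates of the input

data Update (k m : ℕ) : Set where
  insert delete : (j : Fin k) (e : Fin m) → Update k m

module _ {k m : ℕ} where

  Applicable : Matchings k m → Update k m → Set
  Applicable M (insert j e) = e ∉ M j
  Applicable M (delete j e) = e ∈ M j

  change : Update k m → Matchings k m → Matchings k m
  change (insert j e) M = updateAt M j (_∪ ⁅ e ⁆)
  change (delete j e) M = updateAt M j (_- e)

  -- L lists M_k, …, M₁ in this order, each M_j in an arbitrary order.
  record Enumerates (M : Matchings k m) (L : List (Fin k × Fin m)) : Set where
    field
      descending : AllPairs (λ p q → proj₁ p ≥ᶠ proj₁ q) L
      unique     : Unique L
      complete   : ∀ j e → (j , e) ∈ˡ L ⇔ e ∈ M j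

----------------------------------------------------------------------
-- The algorithm

record AlgState (n m : ℕ) : Set where
  constructor ⟨_,_⟩
  field
    N   : Fin n → Subset m
    out : Subset m

module Algorithm {n m : ℕ} (G : Graph n m) {k : ℕ} where
  open Graph G

  addN : Fin m → (Fin n → Subset m) → (Fin n → Subset m)
  addN e N u = if does (u ∈ₑ? e) then N u ∪ ⁅ e ⁆ else N u

  removeN : Fin m → (Fin n → Subset m) → (Fin n → Subset m)
  removeN e N u = if does (u ∈ₑ? e) then N u - e else N u

  initStep : AlgState n m → Fin k × Fin m → AlgState n m
  initStep ⟨ N , out ⟩ (_ , e) =
    ⟨ addN e N
    , (if does (¬? (nonempty? (N (proj₁ (ends e)))) ×-dec ¬? (nonempty? (N (proj₂ (ends e)))))
       then out ∪ ⁅ e ⁆ else out)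
    ⟩

  initialize : List (Fin k × Fin m) → AlgState n m
  initialize = foldl initStep ⟨ (λ _ → ∅) , ∅ ⟩

  -- In the rest of this module M is the input after the update; it is used
  -- only to look up the weight classes of edges.
  module _ (M : Matchings k m) where

    -- e is in a strictly lower weight class than f
    Lower : Fin m → Fin m → Set
    Lower e f = ∃[ i ] ∃[ j ] (e ∈ M i × f ∈ M j × i <ᶠ j)

    lower? : ∀ e f → Dec (Lower e f)
    lower? e f = any? λ i → any? λ j → (e ∈? M i) ×-dec (f ∈? M j) ×-dec (i <? j)

    -- e is in the highest weight class among S
    Highest : Subset m → Fin m → Set
    Highest S e = e ∈ S × (∀ f → f ∈ S → ¬ Lower e f)

    highest? : ∀ S e → Dec (Highest S e)
    highest? S e = (e ∈? S) ×-dec all? λ f → (f ∈? S) →-dec ¬? (lower? e f)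

    unmatchBelow : Fin k → Fin n → Subset m → Subset m
    unmatchBelow j u out
      with any? (λ f → (f ∈? out) ×-dec (u ∈ₑ? f) ×-dec any? (λ i → (f ∈? M i) ×-dec (i <? j)))
    ... | yes (f , _) = out - f
    ... | no  _       = out

    insertStep : Fin k → Fin m → AlgState n m → AlgState n m
    insertStep j e ⟨ N , out ⟩ = ⟨ N′ , out″ ⟩
      where
      u v : Fin n
      u = proj₁ (ends e)
      v = proj₂ (ends e)
      N′ : Fin n → Subset m
      N′ = addN e N
      out′ out″ : Subset m
      out′ = unmatchBelow j v (unmatchBelow j u out)
      out″ = if does (highest? (N′ u) e ×-dec highest? (N′ v) e) then out′ ∪ ⁅ e ⁆ else out′

    -- The highest edge f of N u, if there is one, is unique, because M j has
    -- at most one edge at u for every j.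
    rematch : (Fin n → Subset m) → Fin n → Subset m → Subset m
    rematch N u out with any? (λ f → highest? (N u) f)
    ... | yes (f , _) = if does (highest? (N (opposite f u)) f) then out ∪ ⁅ f ⁆ else out
    ... | no  _       = out

    deleteStep : Fin m → AlgState n m → AlgState n m
    deleteStep e ⟨ N , out ⟩ = ⟨ N′ , rematch N′ v (rematch N′ u (out - e)) ⟩
      where
      u v : Fin n
      u = proj₁ (ends e)
      v = proj₂ (ends e)
      N′ : Fin n → Subset m
      N′ = removeN e N

  perform : Update k m → Matchings k m → AlgState n m → AlgState n m
  perform (insert j e) M = insertStep M j e
  perform (delete j e) M = deleteStep M e

----------------------------------------------------------------------
-- Word-RAM with words of W bits, programmed in a structured language

data Op : Set where
  add sub mul div mod and or xor shl shr eq lt : Op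

data Expr : Set where
  lit : ℕ → Expr
  reg : ℕ → Expr
  mem : Expr → Expr
  bin : Op → Expr → Expr → Expr

infixr 5 _⨟_
infix  6 _≔_ ⟦_⟧≔_

data Cmd : Set where
  skip  : Cmd
  _≔_   : ℕ → Expr → Cmd        -- register assignment
  ⟦_⟧≔_ : Expr → Expr → Cmd     -- memory store
  _⨟_   : Cmd → Cmd → Cmd
  cond  : Expr → Cmd → Cmd → Cmd
  while : Expr → Cmd → Cmd

record Store : Set where
  constructor store
  field
    regs   : ℕ → ℕ
    memory : ℕ → ℕ
open Store public

infixl 9 _[_↦_]
_[_↦_] : (ℕ → ℕ) → ℕ → ℕ → (ℕ → ℕ)
(f [ a ↦ x ]) b = if a ℕ.≡ᵇ b then x else f b

module _ (W : ℕ) where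

  truncate : ℕ → ℕ
  truncate x = _%_ x (2 ^ W) {{m^n≢0 2 W}}

  bit : Bool → ℕ
  bit b = if b then 1 else 0

  odd : ℕ → Bool
  odd x = x % 2 ℕ.≡ᵇ 1

  bitwise : (Bool → Bool → Bool) → ℕ → ℕ → ℕ → ℕ
  bitwise f zero    x y = 0
  bitwise f (suc b) x y = bit (f (odd x) (odd y)) ℕ.+ 2 ℕ.* bitwise f b (x / 2) (y / 2)

  -- division and remainder by 0 give 0
  applyOp : Op → ℕ → ℕ → ℕ
  applyOp add x y       = truncate (x ℕ.+ y)
  applyOp sub x y       = truncate (x ℕ.+ (2 ^ W ℕ.∸ y))
  applyOp mul x y       = truncate (x ℕ.* y)
  applyOp div x zero    = 0
  applyOp div x (suc y) = x / suc y
  applyOp mod x zero    = 0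
  applyOp mod x (suc y) = x % suc y
  applyOp and x y       = bitwise _∧_ W x y
  applyOp or  x y       = bitwise _∨_ W x y
  applyOp xor x y       = bitwise _xor_ W x y
  applyOp shl x y       = truncate (x ℕ.* 2 ^ y)
  applyOp shr x y       = _/_ x (2 ^ y) {{m^n≢0 2 y}}
  applyOp eq  x y       = bit (x ℕ.≡ᵇ y)
  applyOp lt  x y       = bit (x ℕ.<ᵇ y)

  eval : Store → Expr → ℕ
  eval s (lit x)     = truncate x
  eval s (reg a)     = regs s a
  eval s (mem x)     = memory s (eval s x)
  eval s (bin o x y) = applyOp o (eval s x) (eval s y)

  size : Expr → ℕ
  size (lit _)     = 1
  size (reg _)     = 1
  size (mem x)     = suc (size x)
  size (bin _ x y) = suc (size x ℕ.+ size y)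

  -- ⟪ p , s ⟫⇓⟪ s′ , t ⟫: from store s, program p halts in store s′ after t
  -- unit-cost operations.
  infix 4 ⟪_,_⟫⇓⟪_,_⟫
  data ⟪_,_⟫⇓⟪_,_⟫ : Cmd → Store → Store → ℕ → Set where
    ⇓skip   : ∀ {s} → ⟪ skip , s ⟫⇓⟪ s , 1 ⟫
    ⇓assign : ∀ {s a x} →
      ⟪ a ≔ x , s ⟫⇓⟪ store (regs s [ a ↦ eval s x ]) (memory s) , suc (size x) ⟫
    ⇓store  : ∀ {s x y} →
      ⟪ ⟦ x ⟧≔ y , s ⟫⇓⟪ store (regs s) (memory s [ eval s x ↦ eval s y ])
                       , suc (size x ℕ.+ size y) ⟫
    ⇓seq    : ∀ {p q s s′ s″ t t′} → ⟪ p , s ⟫⇓⟪ s′ , t ⟫ → ⟪ q , s′ ⟫⇓⟪ s″ , t′ ⟫ →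
      ⟪ p ⨟ q , s ⟫⇓⟪ s″ , t ℕ.+ t′ ⟫
    ⇓then   : ∀ {x p q s s′ t} → eval s x ≢ 0 → ⟪ p , s ⟫⇓⟪ s′ , t ⟫ →
      ⟪ cond x p q , s ⟫⇓⟪ s′ , suc (size x ℕ.+ t) ⟫
    ⇓else   : ∀ {x p q s s′ t} → eval s x ≡ 0 → ⟪ q , s ⟫⇓⟪ s′ , t ⟫ →
      ⟪ cond x p q , s ⟫⇓⟪ s′ , suc (size x ℕ.+ t) ⟫
    ⇓done   : ∀ {x p s} → eval s x ≡ 0 → ⟪ while x p , s ⟫⇓⟪ s , suc (size x) ⟫
    ⇓loop   : ∀ {x p s s′ s″ t t′} → eval s x ≢ 0 →
      ⟪ p , s ⟫⇓⟪ s′ , t ⟫ → ⟪ while x p , s′ ⟫⇓⟪ s″ , t′ ⟫ →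
      ⟪ while x p , s ⟫⇓⟪ s″ , suc (size x ℕ.+ (t ℕ.+ t′)) ⟫

----------------------------------------------------------------------
-- Implementations

record Implementation : Set where
  field
    initCode insertCode deleteCode : Cmd

-- the words of a list from address 0 on, followed by zeros
words : List ℕ → ℕ → ℕ
words []       _       = 0
words (x ∷ _)  zero    = x
words (_ ∷ xs) (suc a) = words xs a

module _ {n m : ℕ} (G : Graph n m) where
  open Graph G

  -- The output is an array of mates: cell u holds 0 if u is unmatched and
  -- v + 1 if u is matched to v.
  record Displays (s : Store) (S : Subset m) : Set where
    field
      unmatched : ∀ u → (∀ e → e ∈ S → ¬ (u ∈ₑ e)) → memory s (toℕ u) ≡ 0
      matched   : ∀ u e → e ∈ S → u ∈ₑ e → memory s (toℕ u) ≡ suc (toℕ (opposite e u))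

module _ {n m : ℕ} (G : Graph n m) {k : ℕ} where
  open Graph G

  triple : Fin k × Fin m → List ℕ
  triple (j , e) = toℕ j ∷ toℕ (proj₁ (ends e)) ∷ toℕ (proj₂ (ends e)) ∷ []

  -- Registers 0–3 hold W, n, k and the number of listed edges.  Memory cells
  -- 0,…,n-1 are reserved for the output and the listed edges follow from cell
  -- n on.  All other registers and cells are 0.
  initialStore : (W : ℕ) → List (Fin k × Fin m) → Store
  initialStore W L = store (words (W ∷ n ∷ k ∷ length L ∷ []))
                           (words (replicate n 0 ++ concatMap triple L))

  -- An update is passed in registers 0–2; everything else is kept.
  withArguments : Fin k → Fin m → Store → Store
  withArguments j e (store ρ μ) =
    store (ρ [ 0 ↦ toℕ j ] [ 1 ↦ toℕ (proj₁ (ends e)) ] [ 2 ↦ toℕ (proj₂ (ends e)) ]) μ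

  RunsUpdate : Implementation → (W : ℕ) → Update k m → Store → Store → ℕ → Set
  RunsUpdate P W (insert j e) s s′ t =
    ⟪_,_⟫⇓⟪_,_⟫ W (Implementation.insertCode P) (withArguments j e s) s′ t
  RunsUpdate P W (delete j e) s s′ t =
    ⟪_,_⟫⇓⟪_,_⟫ W (Implementation.deleteCode P) (withArguments j e s) s′ t

-- O(log k) and O(k / log n) are read as O(1 + log k) and O(1 + k / log n), and
-- 1 + ⌊log₂ n⌋ stands for log n so that it never vanishes.
updateTime : ℕ → ℕ → ℕ
updateTime n k = suc ⌊log₂ k ⌋ ℕ.⊓ suc (k / suc ⌊log₂ n ⌋)

module _ {c ℓ₁ ℓ₂ : Level} {F : OrderedField c ℓ₁ ℓ₂} {n m k : ℕ} (G : WeightedGraph F n m)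
         (l r : Fin k → OrderedField.Carrier F) (P : Implementation) (W : ℕ) where
  open WeightedGraph G
  open Algorithm graph {k}

  -- Run M A s: after some admissible initial input and some finite sequence of
  -- updates with admissible results, the input is M, the algorithm is in
  -- state A and the machine running P is in store s.
  data Run : Matchings k m → AlgState n m → Store → Set (ℓ₁ ⊔ ℓ₂) where
    start : ∀ {M L s t} → Admissible F G l r M → Enumerates M L →
      ⟪_,_⟫⇓⟪_,_⟫ W (Implementation.initCode P) (initialStore graph W L) s t →
      Run M (initialize L) s
    step  : ∀ {M A s s′ t} → Run M A s →
      (x : Update k m) → Applicable M x → Admissible F G l r (change x M) →
      RunsUpdate graph P W x s s′ t →
      Run (change x M) (perform x (change x M) A) s′

{-# OPTIONS --safe #-}

-- The output is at all times the set of edges that are in the highest class at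
-- both of their ends; this determines the effect of every update and makes the
-- output a locally greedy census matching.  For the weight, consider the edges
-- at one vertex: by spreadness those below the top class weigh at most
-- ε + ε ^ 2 + … ≤ 2 ε times as much as the top one (if 2 ε ≤ 1; otherwise the
-- claim is void), and an edge outside the output is not in the top class at
-- one of its ends, so that the edges outside weigh at most 4 ε times the total.
--
-- The Word-RAM needs the highest class at a vertex.  Building a search tree
-- for every vertex would exceed linear initialization time, so the initial
-- edges at a vertex are kept in a doubly linked list, sorted because the input
-- is, from which edges are only ever removed, while edges inserted later go
-- into a bit vector of k / B + 1 words of B = W / 8 bits with a tournament tree
-- on top.  The tree has depth O(min (log k, k / log n)).  The highest class in
-- a word is its lowest set bit x - (x and (x - 1)), whose position is found in
-- a table indexed by powers of two that is filled in by the insertions, memory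
-- being large enough for sparse tables.

module Submission where

open import Defs
import Data.Bool as Bool
open import Data.Bool using (Bool; true; false; T; if_then_else_; _∧_)
open import Data.Empty using (⊥)
open import Data.Unit using (⊤; tt)
open import Data.Fin using (Fin; zero; suc; toℕ) renaming (_<_ to _<ᶠ_; _≥_ to _≥ᶠ_)
import Data.Fin as Fin
import Data.Fin.Properties as Finₚ
open import Data.Fin.Subset using (Subset; ∣_∣; _∈_; _∉_; _∪_; _─_; _-_; ⁅_⁆; _⊆_)
import Data.Fin.Subset as Sub
import Data.Fin.Subset.Properties as Subₚ
open import Data.List using (List; []; _∷_; _++_; foldl; length; replicate; concatMap)
import Data.List as List
import Data.List.Properties as Listₚ
open import Data.List.Membership.Propositional using () renaming (_∈_ to _∈ˡ_)
open import Data.List.Membership.Propositional.Properties using (∈-lookup)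
open import Data.List.Relation.Unary.All using (All; []; _∷_)
import Data.List.Relation.Unary.All as All
open import Data.List.Relation.Unary.Any using (here; there)
open import Data.List.Relation.Unary.AllPairs using (AllPairs; []; _∷_)
import Data.List.Relation.Unary.AllPairs.Properties as AllPairsₚ
import Data.List.Relation.Unary.Any.Properties as Anyₚ
open import Data.List.Relation.Unary.Unique.Propositional using (Unique)
import Data.Nat as ℕ
open import Data.Nat using (ℕ; zero; suc; _+_; _*_; _∸_; _^_; _%_; _/_; _≤_; _<_; _⊔_; z≤n; s≤s; _≡ᵇ_; _<ᵇ_; NonZero)
open import Data.Nat.Properties
open import Data.Nat.DivMod hiding (result; _div_; _mod_)
open import Data.Nat.Divisibility using (divides)
open import Data.Nat.Induction using (<-rec)
open import Data.Bool.Properties using (∧-idem)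
open import Data.Nat.Logarithm using (⌊log₂_⌋; ⌊log₂⌋-mono-≤; ⌊log₂[2*b]⌋≡1+⌊log₂b⌋; ⌊log₂[2^n]⌋≡n)
open import Data.Nat.Solver using (module +-*-Solver)
open import Data.Product using (_×_; _,_; proj₁; proj₂; ∃-syntax; Σ-syntax; map₁; map₂)
open import Data.Sum using (_⊎_; inj₁; inj₂; [_,_]′)
open import Data.Vec using (lookup; here; there) renaming ([] to []ᵥ; _∷_ to _∷ᵥ_)
open import Data.Vec.Properties using ([]=⇒lookup; lookup⇒[]=)
import Data.Vec.Functional.Properties as VFₚ
open import Function using (_∘_; id; _⇔_; module Equivalence; mk⇔; case_of_)
open import Relation.Binary.PropositionalEquality using (_≡_; _≢_; refl; sym; trans; cong; cong₂; subst; subst₂; module ≡-Reasoning)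
open import Relation.Nullary using (¬_; Dec; yes; no; does; ¬?; _×-dec_; contradiction)
open import Relation.Nullary.Decidable using (dec-true)
open import Relation.Binary.Definitions using (tri<; tri≈; tri>)
open import Relation.Binary.Structures using (IsTotalOrder)
open Equivalence using (to; from)

-- Weights

module OrderedFields {c ℓ₁ ℓ₂} (F : OrderedField c ℓ₁ ℓ₂) where
  private module F = OrderedField F
  open F using (Carrier; _≈_; 0#; 1#; isTotalOrder; sum)
  open IsTotalOrder isTotalOrder using (reflexive; total) renaming (refl to ≤ᶠ-refl; trans to ≤ᶠ-trans)
  open import Algebra.Properties.CommutativeMonoid.Sum F.+-commutativeMonoid
    using (sum-cong-≋; sum-replicate-zero; ∑-distrib-+; ∑-comm)

  infix  4 _≼_
  infixl 6 _⊕_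
  infixl 7 _⊛_
  _≼_ = F._≤_
  _⊕_ = F._+_
  _⊛_ = F._*_

  ≼-resp : ∀ {x x′ y y′} → x ≈ x′ → y ≈ y′ → x ≼ y → x′ ≼ y′
  ≼-resp x≈ y≈ x≼y = ≤ᶠ-trans (reflexive (F.sym x≈)) (≤ᶠ-trans x≼y (reflexive y≈))

  ⊕-mono : ∀ {x x′ y y′} → x ≼ x′ → y ≼ y′ → x ⊕ y ≼ x′ ⊕ y′
  ⊕-mono {x} {x′} {y} {y′} x≼ y≼ = ≤ᶠ-trans (F.+-monoˡ-≤ y x≼)
    (≼-resp (F.+-comm y x′) (F.+-comm y′ x′) (F.+-monoˡ-≤ x′ y≼))

  ⊕-cancelʳ : ∀ {x y} z → x ⊕ z ≼ y ⊕ z → x ≼ y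
  ⊕-cancelʳ z h = ≼-resp (undo _) (undo _) (F.+-monoˡ-≤ (F.- z) h)
    where
    undo : ∀ x → x ⊕ z ⊕ F.- z ≈ x
    undo x = F.trans (F.+-assoc x z (F.- z)) (F.trans (F.+-congˡ (F.-‿inverseʳ z)) (F.+-identityʳ x))

  ⊛-monoˡ : ∀ {z x y} → 0# ≼ z → x ≼ y → z ⊛ x ≼ z ⊛ y
  ⊛-monoˡ {z} {x} {y} 0≼z x≼y = ≼-resp (F.+-identityˡ _) (F.trans (F.sym (F.distribˡ z (y ⊕ F.- x) x)) (F.*-congˡ restore))
    (F.+-monoˡ-≤ (z ⊛ x) (F.*-nonneg 0≼z (≼-resp (F.-‿inverseʳ x) F.refl (F.+-monoˡ-≤ (F.- x) x≼y))))
    where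
    restore : y ⊕ F.- x ⊕ x ≈ y
    restore = F.trans (F.+-assoc y (F.- x) x) (F.trans (F.+-congˡ (F.-‿inverseˡ x)) (F.+-identityʳ y))

  ⊛-monoʳ : ∀ {z x y} → 0# ≼ z → x ≼ y → x ⊛ z ≼ y ⊛ z
  ⊛-monoʳ {z} 0≼z x≼y = ≼-resp (F.*-comm z _) (F.*-comm z _) (⊛-monoˡ 0≼z x≼y)

  ≼-⊕ʳ : ∀ {x y} → 0# ≼ y → x ≼ x ⊕ y
  ≼-⊕ʳ 0≼y = ≼-resp (F.+-identityʳ _) F.refl (⊕-mono ≤ᶠ-refl 0≼y)

  ≼-⊕ˡ : ∀ {x y} → 0# ≼ y → x ≼ y ⊕ x
  ≼-⊕ˡ 0≼y = ≼-resp (F.+-identityˡ _) F.refl (⊕-mono 0≼y ≤ᶠ-refl)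

  0≼⊕ : ∀ {x y} → 0# ≼ x → 0# ≼ y → 0# ≼ x ⊕ y
  0≼⊕ 0≼x 0≼y = ≤ᶠ-trans 0≼x (≼-⊕ʳ 0≼y)

  only : Bool → Carrier → Carrier
  only p x = if p then x else 0#

  0≼only : ∀ p {x} → 0# ≼ x → 0# ≼ only p x
  0≼only true  0≼x = 0≼x
  0≼only false 0≼x = ≤ᶠ-refl

  sum-mono : ∀ {n} {f g : Fin n → Carrier} → (∀ i → f i ≼ g i) → sum f ≼ sum g
  sum-mono {zero}  f≼g = ≤ᶠ-refl
  sum-mono {suc n} f≼g = ⊕-mono (f≼g zero) (sum-mono (f≼g ∘ suc))

  sum-zero : ∀ {n} {f : Fin n → Carrier} → (∀ i → f i ≈ 0#) → sum f ≈ 0#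
  sum-zero {n} f≈0 = F.trans (sum-cong-≋ f≈0) (sum-replicate-zero n)

  0≼sum : ∀ {n} {f : Fin n → Carrier} → (∀ i → 0# ≼ f i) → 0# ≼ sum f
  0≼sum {zero}  _   = ≤ᶠ-refl
  0≼sum {suc n} 0≼f = 0≼⊕ (0≼f zero) (0≼sum (0≼f ∘ suc))

  ≼sum : ∀ {n} {f : Fin n → Carrier} → (∀ i → 0# ≼ f i) → ∀ i → f i ≼ sum f
  ≼sum 0≼f zero    = ≼-⊕ʳ (0≼sum (0≼f ∘ suc))
  ≼sum 0≼f (suc i) = ≤ᶠ-trans (≼sum (0≼f ∘ suc) i) (≼-⊕ˡ (0≼f zero))

  sum-swap : ∀ {n m} (f : Fin n → Fin m → Carrier) → sum (λ i → sum (f i)) ≈ sum (λ j → sum (λ i → f i j))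
  sum-swap f = ∑-comm f

  only-one : ∀ {n} (p : Fin n → Bool) (f : Fin n → Carrier) i → 0# ≼ f i → (∀ j → p j ≡ true → j ≡ i) →
    sum (λ j → only (p j) (f j)) ≼ f i
  only-one p f zero 0≼f uniq = ≤ᶠ-trans
    (⊕-mono (head (p zero)) (reflexive (sum-zero (λ j → F.reflexive (tail j (p (suc j)) refl)))))
    (reflexive (F.+-identityʳ (f zero)))
    where
    head : ∀ b → only b (f zero) ≼ f zero
    head true  = ≤ᶠ-refl
    head false = 0≼f
    tail : ∀ j b → p (suc j) ≡ b → only b (f (suc j)) ≡ 0#
    tail j false _ = refl
    tail j true pj = case uniq (suc j) pj of λ ()
  only-one p f (suc i) 0≼f uniq with p zero in p≡
  ... | true  = case uniq zero p≡ of λ ()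
  ... | false = ≼-resp (F.sym (F.+-identityˡ _)) F.refl
                  (only-one (p ∘ suc) (f ∘ suc) i 0≼f (λ j pj → Finₚ.suc-injective (uniq (suc j) pj)))

  at-most-one : ∀ {n} (p : Fin n → Bool) {x} → 0# ≼ x → (∀ i j → p i ≡ true → p j ≡ true → i ≡ j) →
    sum (λ j → only (p j) x) ≼ x
  at-most-one p {x} 0≼x uniq with Finₚ.any? (λ i → p i Bool.≟ true)
  ... | yes (i , pi) = only-one p (λ _ → x) i 0≼x (λ j pj → uniq j i pj pi)
  ... | no none = ≼-resp (F.sym (sum-zero (λ i → F.reflexive (zeros i (p i) refl)))) F.refl 0≼x
    where
    zeros : ∀ i b → p i ≡ b → only b x ≡ 0#
    zeros i true  pi = contradiction (i , pi) none
    zeros i false _  = refl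

  -- A blocked class i loses at most r i, which is at most ε ^ (j - i) times
  -- the weight in any class j > i that is present; geometric b is the sum of
  -- the ε ^ (j + 1) b j, and the factor 2 makes the induction work.
  module _ {ε : Carrier} (0≼ε : 0# ≼ ε) (2ε≼1 : ε ⊕ ε ≼ 1#) where

    geometric : ∀ {k} → (Fin k → Carrier) → Carrier
    geometric {zero}  b = 0#
    geometric {suc k} b = ε ⊛ (b zero ⊕ geometric (b ∘ suc))

    0≼geometric : ∀ {k} {b : Fin k → Carrier} → (∀ i → 0# ≼ b i) → 0# ≼ geometric b
    0≼geometric {zero}  0≼b = ≤ᶠ-refl
    0≼geometric {suc k} 0≼b = F.*-nonneg 0≼ε (0≼⊕ (0≼b zero) (0≼geometric (0≼b ∘ suc)))

    Steep : ∀ {k} (l r : Fin k → Carrier) → Set _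
    Steep l r = (∀ i → l i ≼ r i) × (∀ i j → toℕ j ≡ suc (toℕ i) → r i ≼ ε ⊛ l j)

    steep-tail : ∀ {k} {l r : Fin (suc k) → Carrier} → Steep l r → Steep (l ∘ suc) (r ∘ suc)
    steep-tail (l≼r , climb) = l≼r ∘ suc , λ i j j≡ → climb (suc i) (suc j) (cong suc j≡)

    ≼geometric : ∀ {k} {l r b : Fin (suc k) → Carrier} {x} → Steep l r → (∀ i → 0# ≼ b i) →
      x ≼ ε ⊛ l zero → ∀ j → l j ≼ b j → x ≼ geometric b
    ≼geometric steep 0≼b x≼ zero lj≼ = ≤ᶠ-trans x≼ (⊛-monoˡ 0≼ε (≤ᶠ-trans lj≼ (≼-⊕ʳ (0≼geometric (0≼b ∘ suc)))))
    ≼geometric {suc k} steep@(l≼r , climb) 0≼b x≼ (suc j) lj≼ = ≤ᶠ-trans x≼ (⊛-monoˡ 0≼ε (≤ᶠ-trans (l≼r zero)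
      (≤ᶠ-trans (≼geometric (steep-tail steep) (0≼b ∘ suc) (climb zero (suc zero) refl) j lj≼) (≼-⊕ˡ (0≼b zero)))))

    blocked-sum : ∀ {k} {l r b b′ : Fin k → Carrier} → Steep l r → (∀ i → 0# ≼ b i) →
      (∀ i → b′ i ≼ 0# ⊎ (b′ i ≼ r i × ∃[ j ] (i <ᶠ j × l j ≼ b j))) →
      sum b′ ⊕ (geometric b ⊕ geometric b) ≼ (ε ⊕ ε) ⊛ sum b
    blocked-sum {zero} _ _ _ = reflexive (F.trans (F.+-identityˡ _) (F.trans (F.+-identityˡ _) (F.sym (F.zeroʳ _))))
    blocked-sum {suc k} {l} {r} {b} {b′} steep@(l≼r , climb) 0≼b lost = ≼-resp (F.sym expand) (F.sym (F.distribˡ (ε ⊕ ε) (b zero) _))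
      (≤ᶠ-trans (⊕-mono (⊕-mono head ≤ᶠ-refl) (⊕-mono ≤ᶠ-refl shrink)) (≤ᶠ-trans (reflexive regroup) (⊕-mono ≤ᶠ-refl rest)))
      where
      open import Algebra.Solver.Ring.NaturalCoefficients.Default F.commutativeSemiring
      g = geometric (b ∘ suc)
      0≼g = 0≼geometric (0≼b ∘ suc)
      head : b′ zero ≼ g
      head with lost zero
      ... | inj₁ ≼0 = ≤ᶠ-trans ≼0 0≼g
      ... | inj₂ (≼r , suc j , _ , lj≼) = ≤ᶠ-trans ≼r (next k refl j lj≼)
        where
        next : ∀ k′ → k′ ≡ k → (j : Fin k) → l (suc j) ≼ b (suc j) → r zero ≼ g
        next zero    refl () _
        next (suc _) refl j lj≼ = ≼geometric (steep-tail steep) (0≼b ∘ suc) (climb zero (suc zero) refl) j lj≼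
      rest : sum (b′ ∘ suc) ⊕ (g ⊕ g) ≼ (ε ⊕ ε) ⊛ sum (b ∘ suc)
      rest = blocked-sum (steep-tail steep) (0≼b ∘ suc) λ i → case lost (suc i) of λ
        { (inj₁ ≼0) → inj₁ ≼0 ; (inj₂ (≼r , suc j , s≤s i<j , lj≼)) → inj₂ (≼r , j , i<j , lj≼) }
      shrink : (ε ⊕ ε) ⊛ g ≼ g
      shrink = ≼-resp F.refl (F.*-identityˡ g) (⊛-monoʳ 0≼g 2ε≼1)
      expand : b′ zero ⊕ sum (b′ ∘ suc) ⊕ (ε ⊛ (b zero ⊕ g) ⊕ ε ⊛ (b zero ⊕ g)) ≈
               b′ zero ⊕ sum (b′ ∘ suc) ⊕ ((ε ⊕ ε) ⊛ b zero ⊕ (ε ⊕ ε) ⊛ g)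
      expand = solve 5 (λ x s e y g → x :+ s :+ (e :* (y :+ g) :+ e :* (y :+ g)) := x :+ s :+ ((e :+ e) :* y :+ (e :+ e) :* g))
                 F.refl (b′ zero) (sum (b′ ∘ suc)) ε (b zero) g
      regroup : g ⊕ sum (b′ ∘ suc) ⊕ ((ε ⊕ ε) ⊛ b zero ⊕ g) ≈ (ε ⊕ ε) ⊛ b zero ⊕ (sum (b′ ∘ suc) ⊕ (g ⊕ g))
      regroup = solve 3 (λ g s y → g :+ s :+ (y :+ g) := y :+ (s :+ (g :+ g))) F.refl g (sum (b′ ∘ suc)) ((ε ⊕ ε) ⊛ b zero)

-- Finite sets

∈-─⇒∉ : ∀ {n} {p q : Subset n} {x} → x ∈ p ─ q → x ∉ q
∈-─⇒∉ {p = _ ∷ᵥ _} {Sub.outside ∷ᵥ _} here      ()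
∈-─⇒∉ {p = _ ∷ᵥ _} {Sub.inside  ∷ᵥ _} ()        here
∈-─⇒∉ {p = _ ∷ᵥ _} {_ ∷ᵥ _}           (there x∈) (there x∈q) = ∈-─⇒∉ x∈ x∈q

∈-remove⇔ : ∀ {n} {p : Subset n} {x y} → x ∈ p - y ⇔ (x ∈ p × x ≢ y)
∈-remove⇔ {p = p} {x} {y} = mk⇔
  (λ x∈ → Subₚ.p─q⊆p p ⁅ y ⁆ x∈ , λ { refl → ∈-─⇒∉ {p = p} x∈ (Subₚ.x∈⁅x⁆ x) })
  (λ (x∈ , x≢y) → Subₚ.x∈p∧x≢y⇒x∈p-y x∈ x≢y)

∈-add⇔ : ∀ {n} {p : Subset n} {x y} → x ∈ p ∪ ⁅ y ⁆ ⇔ (x ∈ p ⊎ x ≡ y)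
∈-add⇔ {p = p} {x} {y} = mk⇔
  (λ x∈ → case Subₚ.x∈p∪q⁻ p ⁅ y ⁆ x∈ of λ { (inj₁ x∈p) → inj₁ x∈p ; (inj₂ x∈y) → inj₂ (Subₚ.x∈⁅y⁆⇒x≡y y x∈y) })
  (λ { (inj₁ x∈p) → Subₚ.x∈p∪q⁺ (inj₁ x∈p) ; (inj₂ refl) → Subₚ.x∈p∪q⁺ {p = p} (inj₂ (Subₚ.x∈⁅x⁆ x)) })

∣∪∣≤ : ∀ {n} (p q : Subset n) → ∣ p ∪ q ∣ ≤ ∣ p ∣ + ∣ q ∣
∣∪∣≤ []ᵥ []ᵥ = z≤n
∣∪∣≤ (Sub.outside ∷ᵥ p) (Sub.outside ∷ᵥ q) = ∣∪∣≤ p q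
∣∪∣≤ (Sub.outside ∷ᵥ p) (Sub.inside  ∷ᵥ q) = ≤-trans (s≤s (∣∪∣≤ p q)) (≤-reflexive (sym (+-suc ∣ p ∣ ∣ q ∣)))
∣∪∣≤ (Sub.inside  ∷ᵥ p) (Sub.outside ∷ᵥ q) = s≤s (∣∪∣≤ p q)
∣∪∣≤ (Sub.inside  ∷ᵥ p) (Sub.inside  ∷ᵥ q) = s≤s (≤-trans (∣∪∣≤ p q) (+-monoʳ-≤ ∣ p ∣ (n≤1+n ∣ q ∣)))

∈-△⁻ : ∀ {n} (p q : Subset n) {x} → x ∈ p △ q → (x ∈ p × x ∉ q) ⊎ (x ∈ q × x ∉ p)
∈-△⁻ p q x∈ = case Subₚ.x∈p∪q⁻ (p ─ q) (q ─ p) x∈ of λ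
  { (inj₁ x∈) → inj₁ (Subₚ.p─q⊆p p q x∈ , ∈-─⇒∉ {p = p} x∈)
  ; (inj₂ x∈) → inj₂ (Subₚ.p─q⊆p q p x∈ , ∈-─⇒∉ {p = q} x∈) }

∣△∣-triangle : ∀ {n} (p q s : Subset n) → ∣ p △ s ∣ ≤ ∣ p △ q ∣ + ∣ q △ s ∣
∣△∣-triangle p q s = ≤-trans (Subₚ.p⊆q⇒∣p∣≤∣q∣ ⊆-triangle) (∣∪∣≤ (p △ q) (q △ s))
  where
  ⊆-triangle : p △ s ⊆ (p △ q) ∪ (q △ s)
  ⊆-triangle {x} x∈ with x Subₚ.∈? q | ∈-△⁻ p s x∈
  ... | yes x∈q | inj₁ (_   , x∉s) = Subₚ.x∈p∪q⁺ {p = p △ q} (inj₂ (Subₚ.x∈p∪q⁺ (inj₁ (Subₚ.x∈p∧x∉q⇒x∈p─q x∈q x∉s))))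
  ... | yes x∈q | inj₂ (_   , x∉p) = Subₚ.x∈p∪q⁺ (inj₁ (Subₚ.x∈p∪q⁺ {p = p ─ q} (inj₂ (Subₚ.x∈p∧x∉q⇒x∈p─q x∈q x∉p))))
  ... | no x∉q  | inj₁ (x∈p , _)   = Subₚ.x∈p∪q⁺ (inj₁ (Subₚ.x∈p∪q⁺ (inj₁ (Subₚ.x∈p∧x∉q⇒x∈p─q x∈p x∉q))))
  ... | no x∉q  | inj₂ (x∈s , _)   = Subₚ.x∈p∪q⁺ {p = p △ q} (inj₂ (Subₚ.x∈p∪q⁺ {p = q ─ s} (inj₂ (Subₚ.x∈p∧x∉q⇒x∈p─q x∈s x∉q))))

∣△∣≤1 : ∀ {n} (p q : Subset n) f → (∀ {x} → x ≢ f → x ∈ p ⇔ x ∈ q) → ∣ p △ q ∣ ≤ 1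
∣△∣≤1 p q f same = ≤-trans (Subₚ.p⊆q⇒∣p∣≤∣q∣ only-f) (≤-reflexive (Subₚ.∣⁅x⁆∣≡1 f))
  where
  only-f : p △ q ⊆ ⁅ f ⁆
  only-f {x} x∈ with x Fin.≟ f | ∈-△⁻ p q x∈
  ... | yes refl | _ = Subₚ.x∈⁅x⁆ x
  ... | no x≢f | inj₁ (x∈p , x∉q) = contradiction (to (same x≢f) x∈p) x∉q
  ... | no x≢f | inj₂ (x∈q , x∉p) = contradiction (from (same x≢f) x∈q) x∉p

∣△∣-self : ∀ {n} (p : Subset n) → ∣ p △ p ∣ ≤ 1
∣△∣-self {zero}  []ᵥ = z≤n
∣△∣-self {suc _} p = ∣△∣≤1 p p zero (λ _ → mk⇔ id id)

∣△∣-remove : ∀ {n} (p : Subset n) f → ∣ p △ (p - f) ∣ ≤ 1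
∣△∣-remove p f = ∣△∣≤1 p (p - f) f (λ x≢ → mk⇔ (λ x∈ → from ∈-remove⇔ (x∈ , x≢)) (λ x∈ → proj₁ (to (∈-remove⇔ {p = p}) x∈)))

∣△∣-add : ∀ {n} (p : Subset n) f → ∣ p △ (p ∪ ⁅ f ⁆) ∣ ≤ 1
∣△∣-add p f = ∣△∣≤1 p (p ∪ ⁅ f ⁆) f (λ x≢ → mk⇔ (λ x∈ → from ∈-add⇔ (inj₁ x∈))
  (λ x∈ → case to (∈-add⇔ {p = p}) x∈ of λ { (inj₁ x∈) → x∈ ; (inj₂ x≡) → contradiction x≡ x≢ }))

if-cases : ∀ {a p} {A : Set a} {P : Set p} (d : Dec P) (x y : A) →
  (P × (if does d then x else y) ≡ x) ⊎ (¬ P × (if does d then x else y) ≡ y)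
if-cases (yes p) x y = inj₁ (p , refl)
if-cases (no ¬p) x y = inj₂ (¬p , refl)

-- The output of the algorithm

module Combinatorics {n m : ℕ} (G : Graph n m) {k : ℕ} where
  open Graph G
  open Algorithm G {k}

  Classes : Set₁
  Classes = Fin k → Fin m → Set

  edgesOf : Matchings k m → Classes
  edgesOf M i e = e ∈ M i

  module _ (R : Classes) where

    Present : Fin m → Set
    Present e = ∃[ i ] R i e

    Below : Fin m → Fin m → Set
    Below e f = ∃[ i ] ∃[ j ] (R i e × R j f × i <ᶠ j)

    Topmost : Fin n → Fin m → Set
    Topmost u e = ∀ f → u ∈ₑ f → Present f → ¬ Below e f

    Dominant : Fin m → Set
    Dominant e = Present e × (∀ u → u ∈ₑ e → Topmost u e)

    record Legal : Set where
      field
        matching : ∀ {i e f} → R i e → R i f → Meet e f → e ≡ f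
        unique   : ∀ {i j e} → R i e → R j e → i ≡ j

    record Invariant (A : AlgState n m) : Set where
      field
        N⇔   : ∀ {u e} → e ∈ AlgState.N A u ⇔ (u ∈ₑ e × Present e)
        out⇔ : ∀ {e} → e ∈ AlgState.out A ⇔ Dominant e

  module _ {R} (legal : Legal R) where
    open Legal legal

    topmost-unique : ∀ {u e f} → u ∈ₑ e → u ∈ₑ f → Present R e → Present R f → Topmost R u e → Topmost R u f → e ≡ f
    topmost-unique {u} {e} {f} u∈e u∈f (i , Re) (j , Rf) top-e top-f with Finₚ.<-cmp i j
    ... | tri< i<j _ _  = contradiction (i , j , Re , Rf , i<j) (top-e f u∈f (j , Rf))
    ... | tri≈ _ refl _ = matching Re Rf (u , u∈e , u∈f)
    ... | tri> _ _ j<i  = contradiction (j , i , Rf , Re , j<i) (top-f e u∈e (i , Re))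

    dominant-matching : ∀ {e f} → Dominant R e → Dominant R f → Meet e f → e ≡ f
    dominant-matching (pe , te) (pf , tf) (u , u∈e , u∈f) = topmost-unique u∈e u∈f pe pf (te u u∈e) (tf u u∈f)

    output-matching : ∀ {A} → Invariant R A → IsMatching (AlgState.out A)
    output-matching inv e∈ f∈ = dominant-matching (to out⇔ e∈) (to out⇔ f∈) where open Invariant inv

  module _ (M : Matchings k m) where

    LowerAt : Fin k → Fin n → Fin m → Set
    LowerAt j u f = u ∈ₑ f × ∃[ i ] (f ∈ M i × i <ᶠ j)

    unmatchBelow-cases : ∀ j u out →
      (∃[ f ] (f ∈ out × LowerAt j u f × unmatchBelow M j u out ≡ out - f)) ⊎
      ((∀ f → f ∈ out → ¬ LowerAt j u f) × unmatchBelow M j u out ≡ out)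
    unmatchBelow-cases j u out
      with Finₚ.any? (λ f → (f Subₚ.∈? out) ×-dec (u ∈ₑ? f) ×-dec Finₚ.any? (λ i → (f Subₚ.∈? M i) ×-dec (i Finₚ.<? j)))
    ... | yes (f , f∈ , u∈ , low) = inj₁ (f , f∈ , (u∈ , low) , refl)
    ... | no none = inj₂ ((λ f f∈ (u∈ , low) → none (f , f∈ , u∈ , low)) , refl)

    rematch-cases : ∀ N u out →
      (∃[ f ] (Highest M (N u) f ×
        ((Highest M (N (opposite f u)) f × rematch M N u out ≡ out ∪ ⁅ f ⁆) ⊎
         (¬ Highest M (N (opposite f u)) f × rematch M N u out ≡ out)))) ⊎
      ((∀ f → ¬ Highest M (N u) f) × rematch M N u out ≡ out)
    rematch-cases N u out with Finₚ.any? (λ f → highest? M (N u) f)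
    ... | yes (f , h) = inj₁ (f , h , if-cases (highest? M (N (opposite f u)) f) (out ∪ ⁅ f ⁆) out)
    ... | no none     = inj₂ ((λ f h → none (f , h)) , refl)

    ∈-unmatchBelow : ∀ {j u out} → IsMatching out → ∀ {f} → f ∈ unmatchBelow M j u out ⇔ (f ∈ out × ¬ LowerAt j u f)
    ∈-unmatchBelow {j} {u} {out} matching {f} with unmatchBelow-cases j u out
    ... | inj₁ (g , g∈ , (u∈g , low) , p≡) rewrite p≡ = mk⇔
            (λ f∈ → let f∈out , f≢g = to (∈-remove⇔ {p = out}) f∈
                    in f∈out , λ (u∈f , _) → f≢g (matching f∈out g∈ (u , u∈f , u∈g)))
            (λ (f∈ , ¬low) → from ∈-remove⇔ (f∈ , λ { refl → ¬low (u∈g , low) }))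
    ... | inj₂ (none , p≡) rewrite p≡ = mk⇔ (λ f∈ → f∈ , none f f∈) proj₁

    unmatchBelow-near : ∀ j u out → ∣ out △ unmatchBelow M j u out ∣ ≤ 1
    unmatchBelow-near j u out with unmatchBelow-cases j u out
    ... | inj₁ (g , _ , _ , p≡) rewrite p≡ = ∣△∣-remove out g
    ... | inj₂ (_ , p≡) rewrite p≡ = ∣△∣-self out

    rematch-near : ∀ N u out → ∣ out △ rematch M N u out ∣ ≤ 1
    rematch-near N u out with rematch-cases N u out
    ... | inj₁ (f , _ , inj₁ (_ , p≡)) rewrite p≡ = ∣△∣-add out f
    ... | inj₁ (f , _ , inj₂ (_ , p≡)) rewrite p≡ = ∣△∣-self out
    ... | inj₂ (_ , p≡) rewrite p≡ = ∣△∣-self out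

  if-add-near : ∀ {P : Set} (d : Dec P) (out : Subset m) e → ∣ out △ (if does d then out ∪ ⁅ e ⁆ else out) ∣ ≤ 1
  if-add-near d out e with if-cases d (out ∪ ⁅ e ⁆) out
  ... | inj₁ (_ , p≡) rewrite p≡ = ∣△∣-add out e
  ... | inj₂ (_ , p≡) rewrite p≡ = ∣△∣-self out

  three-steps : ∀ (S₀ S₁ S₂ S₃ : Subset m) → ∣ S₀ △ S₁ ∣ ≤ 1 → ∣ S₁ △ S₂ ∣ ≤ 1 → ∣ S₂ △ S₃ ∣ ≤ 1 → ∣ S₀ △ S₃ ∣ ≤ 3
  three-steps S₀ S₁ S₂ S₃ h₁ h₂ h₃ = ≤-trans (∣△∣-triangle S₀ S₁ S₃)
    (+-mono-≤ h₁ (≤-trans (∣△∣-triangle S₁ S₂ S₃) (+-mono-≤ h₂ h₃)))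

  recourse : ∀ x M A → ∣ AlgState.out A △ AlgState.out (perform x M A) ∣ ≤ 3
  recourse (insert j e) M ⟨ N , out ⟩ = three-steps out out₁ out₂ (AlgState.out (perform (insert j e) M ⟨ N , out ⟩))
    (unmatchBelow-near M j u out) (unmatchBelow-near M j v out₁)
    (if-add-near (highest? M (addN e N u) e ×-dec highest? M (addN e N v) e) out₂ e)
    where
    u = proj₁ (ends e)
    v = proj₂ (ends e)
    out₁ = unmatchBelow M j u out
    out₂ = unmatchBelow M j v out₁
  recourse (delete j e) M ⟨ N , out ⟩ = three-steps out (out - e) out₂ (AlgState.out (perform (delete j e) M ⟨ N , out ⟩))
    (∣△∣-remove out e) (rematch-near M (removeN e N) (proj₁ (ends e)) (out - e))
    (rematch-near M (removeN e N) (proj₂ (ends e)) out₂)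
    where
    out₂ = rematch M (removeN e N) (proj₁ (ends e)) (out - e)

  census : ∀ {M A} → Legal (edgesOf M) → Invariant (edgesOf M) A → LocallyGreedyCensus G M (AlgState.out A)
  census {M} {A} legal inv = record
    { isMatching = output-matching legal inv
    ; census = λ i e e∈ e∉ → blocked i e e∈ e∉
    }
    where
    open Invariant inv
    open Legal legal
    blocked : ∀ i e → e ∈ M i → e ∉ AlgState.out A → ∃[ j ] ∃[ f ] (i <ᶠ j × f ∈ M j × Meet e f)
    blocked i e e∈ e∉ with Finₚ.any? (λ u → (u ∈ₑ? e) ×-dec Finₚ.any? (λ f → (u ∈ₑ? f) ×-dec lower? M e f))
    ... | yes (u , u∈e , f , u∈f , i′ , j , e∈′ , f∈ , i′<j) =
      j , f , subst (_<ᶠ j) (unique e∈′ e∈) i′<j , f∈ , u , u∈e , u∈f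
    ... | no none = contradiction
      (from out⇔ ((i , e∈) , λ u u∈e f u∈f _ low → none (u , u∈e , f , u∈f , low))) e∉

does⇒ : ∀ {p} {P : Set p} (d : Dec P) → does d ≡ true → P
does⇒ (yes p) _ = p

module CensusWeight {c ℓ₁ ℓ₂} (F : OrderedField c ℓ₁ ℓ₂) {n m k : ℕ} (WG : WeightedGraph F n m) where
  private module F = OrderedField F
  open F using (Carrier; _≈_; 0#; 1#; sum)
  open OrderedFields F
  open IsTotalOrder F.isTotalOrder using (reflexive; total) renaming (refl to ≤ᶠ-refl; trans to ≤ᶠ-trans)
  open WeightedGraph WG
  open import Algebra.Properties.CommutativeMonoid.Sum F.+-commutativeMonoid using (sum-cong-≋; ∑-distrib-+)

  totalWeight : Matchings k m → Carrier
  totalWeight M = sum (λ i → weight (M i))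

  0≼w : ∀ e → 0# ≼ w e
  0≼w e = proj₁ (positive e)

  0≼weight : ∀ S → 0# ≼ weight S
  0≼weight S = 0≼sum (λ e → 0≼only (lookup S e) (0≼w e))

  spread⇒steep : ∀ {ε} {l r : Fin k → Carrier} → (0<ε : 0# F.< ε) → IsSpread F (ε F.⁻¹) l r →
    (∀ i → l i ≼ r i) × (∀ i j → toℕ j ≡ suc (toℕ i) → r i ≼ ε ⊛ l j)
  spread⇒steep {ε} {l} {r} (0≼ε , 0≉ε) spread = proj₁ ∘ proper , λ i j j≡ →
    ≼-resp (F.trans (F.sym (F.*-assoc ε (ε F.⁻¹) (r i))) (F.trans (F.*-congʳ (F.⁻¹-inverse (0≉ε ∘ F.sym))) (F.*-identityˡ (r i))))
           F.refl (⊛-monoˡ 0≼ε (IsSpread.spread spread i j j≡))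
    where open IsSpread spread using (proper)

  ∈⇒lookup : ∀ {S : Subset m} {e} → e ∈ S → lookup S e ≡ true
  ∈⇒lookup = []=⇒lookup

  lookup⇒∈ : ∀ {S : Subset m} {e} → lookup S e ≡ true → e ∈ S
  lookup⇒∈ = lookup⇒[]= _ _

  module _ {ε : Carrier} (0≼ε : 0# ≼ ε) (2ε≼1 : ε ⊕ ε ≼ 1#) {l r : Fin k → Carrier} (steep : Steep 0≼ε 2ε≼1 l r)
           {M : Matchings k m} (admissible : Admissible F WG l r M) (unique : ∀ {i j e} → e ∈ M i → e ∈ M j → i ≡ j)
           {S : Subset m} (census : LocallyGreedyCensus graph M S) where
    open Admissible admissible

    inM : Fin k → Fin m → Bool
    inM i e = lookup (M i) e

    isEnd : Fin n → Fin m → Bool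
    isEnd u e = does (u ∈ₑ? e)

    isEnd⇒ : ∀ {u e} → isEnd u e ≡ true → u ∈ₑ e
    isEnd⇒ {u} {e} = does⇒ (u ∈ₑ? e)

    ⇒isEnd : ∀ {u e} → u ∈ₑ e → isEnd u e ≡ true
    ⇒isEnd {u} {e} u∈ = dec-true (u ∈ₑ? e) u∈

    blocked? : ∀ u (i : Fin k) → Dec (∃[ j ] (i <ᶠ j × ∃[ f ] (f ∈ M j × u ∈ₑ f)))
    blocked? u i = Finₚ.any? (λ j → (i Finₚ.<? j) ×-dec Finₚ.any? (λ f → (f Subₚ.∈? M j) ×-dec (u ∈ₑ? f)))

    x : Fin k → Fin m → Carrier
    x i e = only (inM i e) (w e)

    share : Fin n → Fin k → Carrier
    share u i = sum (λ e → only (isEnd u e) (x i e))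

    loss : Fin n → Fin k → Carrier
    loss u i = only (does (blocked? u i)) (share u i)

    0≼x : ∀ i e → 0# ≼ x i e
    0≼x i e = 0≼only (inM i e) (0≼w e)

    0≼share : ∀ u i → 0# ≼ share u i
    0≼share u i = 0≼sum (λ e → 0≼only (isEnd u e) (0≼x i e))

    share-zero : ∀ u i → (∀ e → e ∈ M i → ¬ u ∈ₑ e) → share u i ≈ 0#
    share-zero u i none = sum-zero (λ e → F.reflexive (vanish e (isEnd u e) (inM i e) refl refl))
      where
      vanish : ∀ e b b′ → isEnd u e ≡ b → inM i e ≡ b′ → only b (only b′ (w e)) ≡ 0#
      vanish e true  true  u∈ e∈ = contradiction (isEnd⇒ u∈) (none e (lookup⇒∈ e∈))
      vanish e true  false _  _  = refl
      vanish e false _     _  _  = refl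

    share-≼ : ∀ u i {e} → e ∈ M i → u ∈ₑ e → share u i ≼ w e
    share-≼ u i {e} e∈ u∈ = ≤ᶠ-trans (reflexive (sum-cong-≋ (λ f → F.reflexive (merge (isEnd u f) (inM i f)))))
      (only-one (λ f → isEnd u f ∧ inM i f) w e (0≼w e) (λ f h →
        let u∈f , f∈ = split (isEnd u f) (inM i f) h
        in matchings i (lookup⇒∈ f∈) e∈ (u , isEnd⇒ u∈f , u∈)))
      where
      merge : ∀ b b′ {y} → only b (only b′ y) ≡ only (b ∧ b′) y
      merge true  b′ = refl
      merge false b′ = refl
      split : ∀ b b′ → b ∧ b′ ≡ true → b ≡ true × b′ ≡ true
      split true true _ = refl , refl

    ≼-share : ∀ u i {e} → e ∈ M i → u ∈ₑ e → w e ≼ share u i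
    ≼-share u i {e} e∈ u∈ = ≼-resp (F.reflexive (trans (cong (λ b → only b (x i e)) (⇒isEnd u∈)) (cong (λ b → only b (w e)) (∈⇒lookup e∈)))) F.refl
      (≼sum (λ f → 0≼only (isEnd u f) (0≼x i f)) e)

    loss-bound : ∀ u → sum (loss u) ≼ (ε ⊕ ε) ⊛ sum (share u)
    loss-bound u = ≤ᶠ-trans (≼-⊕ʳ (0≼⊕ (0≼geometric 0≼ε 2ε≼1 (0≼share u)) (0≼geometric 0≼ε 2ε≼1 (0≼share u))))
      (blocked-sum 0≼ε 2ε≼1 steep (0≼share u) charged)
      where
      charged : ∀ i → loss u i ≼ 0# ⊎ (loss u i ≼ r i × ∃[ j ] (i <ᶠ j × l j ≼ share u j))
      charged i with if-cases (blocked? u i) (share u i) 0#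
      ... | inj₂ (_ , loss≡) = inj₁ (reflexive (F.reflexive loss≡))
      ... | inj₁ ((j , i<j , f , f∈ , u∈f) , loss≡) with Finₚ.any? (λ e → (e Subₚ.∈? M i) ×-dec (u ∈ₑ? e))
      ...   | no none = inj₁ (reflexive (F.trans (F.reflexive loss≡) (share-zero u i (λ e e∈ u∈ → none (e , e∈ , u∈)))))
      ...   | yes (e , e∈ , u∈) = inj₂ ( ≤ᶠ-trans (≤ᶠ-trans (reflexive (F.reflexive loss≡)) (share-≼ u i e∈ u∈)) (proj₁ (proj₂ (inClass i e e∈)))
                                       , j , i<j , ≤ᶠ-trans (proj₁ (inClass j f f∈)) (≼-share u j f∈ u∈f))

    kept lost : Fin k → Fin m → Carrier
    kept i e = only (inM i e) (only (lookup S e) (w e))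
    lost i e = sum (λ u → only (does (blocked? u i)) (only (isEnd u e) (x i e)))

    edge-bound : ∀ i e → x i e ≼ kept i e ⊕ lost i e
    edge-bound i e with inM i e in e∈ | lookup S e in e∈S
    ... | false | _    = 0≼⊕ ≤ᶠ-refl (0≼sum (λ u → 0≼only (does (blocked? u i)) (0≼only (isEnd u e) ≤ᶠ-refl)))
    ... | true  | true = ≼-⊕ʳ (0≼sum (λ u → 0≼only (does (blocked? u i)) (0≼only (isEnd u e) (0≼w e))))
    ... | true  | false with LocallyGreedyCensus.census census i e (lookup⇒∈ e∈) (λ h → case trans (sym e∈S) (∈⇒lookup h) of λ ())
    ...   | j , f , i<j , f∈ , u , u∈e , u∈f = ≤ᶠ-trans
      (≼-resp (F.reflexive (trans (cong (λ b → only b (only (isEnd u e) (w e))) (dec-true (blocked? u i) (j , i<j , f , f∈ , u∈f)))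
                                  (cong (λ b → only b (w e)) (⇒isEnd u∈e)))) F.refl
        (≼sum (λ u → 0≼only (does (blocked? u i)) (0≼only (isEnd u e) (0≼w e))) u))
      (≼-⊕ˡ ≤ᶠ-refl)

    output-part : sum (λ i → sum (kept i)) ≼ weight S
    output-part = ≤ᶠ-trans (reflexive (sum-swap kept))
      (sum-mono (λ e → at-most-one (λ i → inM i e) (0≼only (lookup S e) (0≼w e))
        (λ i j ei ej → unique (lookup⇒∈ ei) (lookup⇒∈ ej))))

    lost-part : sum (λ i → sum (lost i)) ≈ sum (λ u → sum (loss u))
    lost-part = F.trans (sum-cong-≋ (λ i → F.trans (sum-swap (λ e u → only (does (blocked? u i)) (only (isEnd u e) (x i e))))
        (sum-cong-≋ (λ u → pull (does (blocked? u i)) (λ e → only (isEnd u e) (x i e))))))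
      (sum-swap (λ i u → loss u i))
      where
      pull : ∀ b (f : Fin m → Carrier) → sum (λ e → only b (f e)) ≈ only b (sum f)
      pull true  f = F.refl
      pull false f = sum-zero {m} {λ _ → 0#} (λ _ → F.refl)

    share-total : sum (λ u → sum (share u)) ≼ totalWeight M ⊕ totalWeight M
    share-total = ≤ᶠ-trans (reflexive (F.trans (sum-swap share) (sum-cong-≋ (λ i → sum-swap (λ u e → only (isEnd u e) (x i e))))))
      (≤ᶠ-trans (sum-mono (λ i → ≤ᶠ-trans (sum-mono (λ e → two-ends (0≼x i e))) (reflexive (∑-distrib-+ (x i) (x i)))))
        (reflexive (∑-distrib-+ (λ i → weight (M i)) (λ i → weight (M i)))))
      where
      two-ends : ∀ {e y} → 0# ≼ y → sum (λ u → only (isEnd u e) y) ≼ y ⊕ y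
      two-ends {e} {y} 0≼y = ≤ᶠ-trans (sum-mono (λ u → either (does (u Fin.≟ proj₁ (ends e))) (does (u Fin.≟ proj₂ (ends e)))))
        (≤ᶠ-trans (reflexive (∑-distrib-+ (λ u → only (does (u Fin.≟ proj₁ (ends e))) y) (λ u → only (does (u Fin.≟ proj₂ (ends e))) y)))
          (⊕-mono (one (proj₁ (ends e))) (one (proj₂ (ends e)))))
        where
        either : ∀ b b′ → only (b Bool.∨ b′) y ≼ only b y ⊕ only b′ y
        either true  b′ = ≼-⊕ʳ (0≼only b′ 0≼y)
        either false b′ = ≼-⊕ˡ ≤ᶠ-refl
        one : ∀ a → sum (λ u → only (does (u Fin.≟ a)) y) ≼ y
        one a = only-one (λ u → does (u Fin.≟ a)) (λ _ → y) a 0≼y (λ u h → does⇒ (u Fin.≟ a) h)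

    weight-bound : totalWeight M ≼ weight S ⊕ (ε ⊕ ε) ⊛ (totalWeight M ⊕ totalWeight M)
    weight-bound = ≤ᶠ-trans (sum-mono (λ i → ≤ᶠ-trans (sum-mono (edge-bound i)) (reflexive (∑-distrib-+ (kept i) (lost i)))))
      (≤ᶠ-trans (reflexive (∑-distrib-+ (λ i → sum (kept i)) (λ i → sum (lost i)))) (⊕-mono output-part (≤ᶠ-trans (reflexive lost-part)
        (≤ᶠ-trans (sum-mono loss-bound) (≤ᶠ-trans (reflexive (pull (λ u → sum (share u))))
          (⊛-monoˡ (0≼⊕ 0≼ε 0≼ε) share-total))))))
      where
      pull : ∀ {n} (f : Fin n → Carrier) → sum (λ u → (ε ⊕ ε) ⊛ f u) ≈ (ε ⊕ ε) ⊛ sum f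
      pull {zero}  f = F.sym (F.zeroʳ _)
      pull {suc _} f = F.trans (F.+-congˡ (pull (f ∘ suc))) (F.sym (F.distribˡ _ _ _))

  disjoint⇒unique : ∀ {δ l r M} → IsSpread F {k = k} δ l r → Admissible F WG l r M → ∀ {i j e} → e ∈ M i → e ∈ M j → i ≡ j
  disjoint⇒unique spread admissible {i} {j} {e} ei ej with i Fin.≟ j
  ... | yes i≡j = i≡j
  ... | no i≢j  = contradiction (inClass j e ej) (IsSpread.disjoint spread i j i≢j (w e) (inClass i e ei))
    where open Admissible admissible

  census-weight : ∀ {ε l r M S} C → 4 ≤ C → 0# F.< ε → IsSpread F (ε F.⁻¹) l r → Admissible F WG l r M →
    LocallyGreedyCensus graph M S → (1# F.- C F.· ε) ⊛ totalWeight M ≼ weight S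
  census-weight {ε} {l} {r} {M} {S} C 4≤C 0<ε spread admissible census =
    ⊕-cancelʳ (Cε ⊛ t) (≼-resp (F.sym expand) F.refl t≼)
    where
    open import Algebra.Solver.Ring.NaturalCoefficients.Default F.commutativeSemiring
    Cε = C F.· ε
    t = totalWeight M
    0≼ε = proj₁ 0<ε
    0≼t : 0# ≼ t
    0≼t = 0≼sum (λ i → 0≼weight (M i))
    expand : (1# F.- Cε) ⊛ t ⊕ Cε ⊛ t ≈ t
    expand = F.trans (F.sym (F.distribʳ t (1# F.- Cε) Cε)) (F.trans (F.*-congʳ (F.trans (F.+-assoc 1# (F.- Cε) Cε)
      (F.trans (F.+-congˡ (F.-‿inverseˡ Cε)) (F.+-identityʳ 1#)))) (F.*-identityˡ t))
    4ε≼ : ∀ {C} → 4 ≤ C → ε ⊕ (ε ⊕ (ε ⊕ ε)) ≼ C F.· ε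
    4ε≼ {suc (suc (suc (suc C)))} (s≤s (s≤s (s≤s (s≤s _)))) =
      ⊕-mono ≤ᶠ-refl (⊕-mono ≤ᶠ-refl (⊕-mono ≤ᶠ-refl (≼-⊕ʳ (multiple C))))
      where
      multiple : ∀ C → 0# ≼ C F.· ε
      multiple zero    = ≤ᶠ-refl
      multiple (suc C) = 0≼⊕ 0≼ε (multiple C)
    t≼ : t ≼ weight S ⊕ Cε ⊛ t
    t≼ with total (ε ⊕ ε) 1#
    ... | inj₁ 2ε≼1 = ≤ᶠ-trans (weight-bound 0≼ε 2ε≼1 (spread⇒steep 0<ε spread) admissible (disjoint⇒unique spread admissible) census)
      (⊕-mono ≤ᶠ-refl (≤ᶠ-trans (reflexive (solve 2 (λ e t → (e :+ e) :* (t :+ t) := (e :+ (e :+ (e :+ e))) :* t) F.refl ε t))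
        (⊛-monoʳ 0≼t (4ε≼ 4≤C))))
    ... | inj₂ 1≼2ε = ≤ᶠ-trans (≼-resp (F.*-identityˡ t) F.refl (⊛-monoʳ 0≼t (≤ᶠ-trans 1≼2ε (≤ᶠ-trans
      (≤ᶠ-trans (≼-⊕ʳ (0≼⊕ 0≼ε 0≼ε)) (reflexive (F.+-assoc ε ε (ε ⊕ ε)))) (4ε≼ 4≤C))))) (≼-⊕ˡ (0≼weight S))

module Preservation {n m : ℕ} (G : Graph n m) {k : ℕ} where
  open Graph G
  open Algorithm G {k}
  open Combinatorics G {k}

  ∈-addN : ∀ e N u {f} → f ∈ addN e N u ⇔ (f ∈ N u ⊎ (f ≡ e × u ∈ₑ e))
  ∈-addN e N u {f} with if-cases (u ∈ₑ? e) (N u ∪ ⁅ e ⁆) (N u)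
  ... | inj₁ (u∈ , p≡) rewrite p≡ = mk⇔ (λ f∈ → case to (∈-add⇔ {p = N u}) f∈ of λ { (inj₁ f∈) → inj₁ f∈ ; (inj₂ f≡) → inj₂ (f≡ , u∈) })
                     (λ { (inj₁ f∈) → from ∈-add⇔ (inj₁ f∈) ; (inj₂ (f≡ , _)) → from (∈-add⇔ {p = N u}) (inj₂ f≡) })
  ... | inj₂ (u∉ , p≡) rewrite p≡ = mk⇔ inj₁ (λ { (inj₁ f∈) → f∈ ; (inj₂ (_ , u∈)) → contradiction u∈ u∉ })

  ∈-removeN : ∀ e N u {f} → f ∈ removeN e N u ⇔ (f ∈ N u × ¬ (f ≡ e × u ∈ₑ e))
  ∈-removeN e N u {f} with if-cases (u ∈ₑ? e) (N u - e) (N u)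
  ... | inj₁ (u∈ , p≡) rewrite p≡ = mk⇔ (λ f∈ → let f∈N , f≢ = to (∈-remove⇔ {p = N u}) f∈ in f∈N , λ (f≡ , _) → f≢ f≡)
                     (λ (f∈ , f≢) → from ∈-remove⇔ (f∈ , λ f≡ → f≢ (f≡ , u∈)))
  ... | inj₂ (u∉ , p≡) rewrite p≡ = mk⇔ (λ f∈ → f∈ , λ (_ , u∈) → u∉ u∈) proj₁

  first∈ : ∀ e → proj₁ (ends e) ∈ₑ e
  first∈ e = inj₁ refl

  second∈ : ∀ e → proj₂ (ends e) ∈ₑ e
  second∈ e = inj₂ refl

  both-ends : ∀ {e} {P : Fin n → Set} → P (proj₁ (ends e)) → P (proj₂ (ends e)) → ∀ u → u ∈ₑ e → P u
  both-ends p q u (inj₁ refl) = p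
  both-ends p q u (inj₂ refl) = q

  opposite∈ : ∀ {e u} → u ∈ₑ e → opposite e u ∈ₑ e
  opposite∈ {e} {u} u∈ with u Fin.≟ proj₁ (ends e)
  ... | yes _ = inj₂ refl
  ... | no _  = inj₁ refl

  end-cases : ∀ {e u x} → u ∈ₑ e → x ∈ₑ e → x ≡ u ⊎ x ≡ opposite e u
  end-cases {e} {u} u∈ x∈ with u Fin.≟ proj₁ (ends e) | u∈ | x∈
  ... | yes u≡ | _       | inj₁ x≡ = inj₁ (trans x≡ (sym u≡))
  ... | yes u≡ | _       | inj₂ x≡ = inj₂ x≡
  ... | no u≢  | inj₁ u≡ | _       = contradiction u≡ u≢
  ... | no u≢  | inj₂ u≡ | inj₁ x≡ = inj₂ x≡
  ... | no u≢  | inj₂ u≡ | inj₂ x≡ = inj₁ (trans x≡ (sym u≡))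

  record Adds (R R′ : Classes) (j : Fin k) (e : Fin m) : Set where
    field
      ⇔R  : ∀ {i f} → R′ i f ⇔ (R i f ⊎ (i ≡ j × f ≡ e))
      new : ¬ Present R e

    old : ∀ {i f} → R i f → R′ i f
    old Rf = from ⇔R (inj₁ Rf)

    added : R′ j e
    added = from ⇔R (inj₂ (refl , refl))

    Present⇔ : ∀ {f} → Present R′ f ⇔ (Present R f ⊎ f ≡ e)
    Present⇔ = mk⇔
      (λ (i , R′f) → case to ⇔R R′f of λ { (inj₁ Rf) → inj₁ (i , Rf) ; (inj₂ (_ , f≡)) → inj₂ f≡ })
      [ (λ (i , Rf) → i , old Rf) , (λ { refl → j , added }) ]′

    shrink-topmost : ∀ {u f} → Present R f → Topmost R′ u f → Topmost R u f
    shrink-topmost pf top g u∈g (i , Rg) (a , b , Rf , Rg′ , a<b) =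
      top g u∈g (i , old Rg) (a , b , old Rf , old Rg′ , a<b)

    shrink-dominant : ∀ {f} → Present R f → Dominant R′ f → Dominant R f
    shrink-dominant pf (_ , top) = pf , λ u u∈f → shrink-topmost pf (top u u∈f)

    addN-ok : ∀ {N} → (∀ {u f} → f ∈ N u ⇔ (u ∈ₑ f × Present R f)) → ∀ {u f} → f ∈ addN e N u ⇔ (u ∈ₑ f × Present R′ f)
    addN-ok {N} N⇔ {u} {f} = mk⇔
      (λ f∈ → case to (∈-addN e N u) f∈ of λ
        { (inj₁ f∈) → map₂ (from Present⇔ ∘ inj₁) (to N⇔ f∈) ; (inj₂ (refl , u∈)) → u∈ , from Present⇔ (inj₂ refl) })
      (λ (u∈ , pf) → case to Present⇔ pf of λ
        { (inj₁ pf) → from (∈-addN e N u) (inj₁ (from N⇔ (u∈ , pf))) ; (inj₂ refl) → from (∈-addN e N u) (inj₂ (refl , u∈)) })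

  highest⇔ : ∀ {M N u e} → (∀ {f} → f ∈ N ⇔ (u ∈ₑ f × Present (edgesOf M) f)) →
    Highest M N e ⇔ (u ∈ₑ e × Present (edgesOf M) e × Topmost (edgesOf M) u e)
  highest⇔ N⇔ = mk⇔
    (λ (e∈ , top) → let u∈ , pe = to N⇔ e∈ in u∈ , pe , λ f u∈f pf → top f (from N⇔ (u∈f , pf)))
    (λ (u∈ , pe , top) → from N⇔ (u∈ , pe) , λ f f∈ → let u∈f , pf = to N⇔ f∈ in top f u∈f pf)

  initStep-invariant : ∀ {R R′ A j e} → Legal R′ → Adds R R′ j e → (∀ {i f} → R i f → j Fin.≤ i) →
    Invariant R A → Invariant R′ (initStep A (j , e))
  initStep-invariant {R} {R′} {⟨ N , out ⟩} {j} {e} legal adds j≤ inv = record { N⇔ = addN-ok {N} N⇔ ; out⇔ = out′⇔ _ }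
    where
    open Invariant inv
    open Legal legal
    open Adds adds
    u = proj₁ (ends e)
    v = proj₂ (ends e)
    grow : ∀ {f} → Dominant R f → Dominant R′ f
    grow {f} ((i₀ , Rf) , top) = (i₀ , old Rf) , λ x x∈f g x∈g _ (i , i′ , R′f , R′g , i<) → case to ⇔R R′g of λ
      { (inj₁ Rg) → top x x∈f g x∈g (i′ , Rg) (i₀ , i′ , Rf , Rg , subst (_<ᶠ i′) (unique R′f (old Rf)) i<)
      ; (inj₂ (refl , refl)) → <⇒≱ i< (subst (j Fin.≤_) (unique (old Rf) R′f) (j≤ Rf)) }
    empty⇒ : ∀ x → ¬ Sub.Nonempty (N x) → Topmost R′ x e
    empty⇒ x empty g x∈g pg (i , i′ , R′e , R′g , i<) = case to Present⇔ pg of λ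
      { (inj₁ pg) → empty (g , from N⇔ (x∈g , pg)) ; (inj₂ refl) → <⇒≢ i< (cong toℕ (unique R′e R′g)) }
    ⇒empty : ∀ x → x ∈ₑ e → Topmost R′ x e → ¬ Sub.Nonempty (N x)
    ⇒empty x x∈e top (g , g∈) with to N⇔ g∈
    ... | x∈g , i , Rg with Finₚ.<-cmp j i
    ...   | tri< j<i _ _  = top g x∈g (i , old Rg) (j , i , added , old Rg , j<i)
    ...   | tri≈ _ refl _ = new (i , subst (R i) (sym (matching added (old Rg) (x , x∈e , x∈g))) Rg)
    ...   | tri> _ _ i<j  = <⇒≱ i<j (j≤ Rg)
    dominant-old : ∀ {f} → f ≢ e → Dominant R′ f → f ∈ out
    dominant-old f≢e (pf , top) = case to Present⇔ pf of λ
      { (inj₁ pf′) → from out⇔ (shrink-dominant pf′ (pf , top)) ; (inj₂ f≡) → contradiction f≡ f≢e }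
    e? = ¬? (Subₚ.nonempty? (N u)) ×-dec ¬? (Subₚ.nonempty? (N v))
    out′⇔ : ∀ f → f ∈ (if does e? then out ∪ ⁅ e ⁆ else out) ⇔ Dominant R′ f
    out′⇔ f with if-cases e? (out ∪ ⁅ e ⁆) out
    ... | inj₁ ((eu , ev) , p≡) rewrite p≡ = mk⇔
      (λ f∈ → case to (∈-add⇔ {p = out}) f∈ of λ
        { (inj₁ f∈) → grow (to out⇔ f∈)
        ; (inj₂ refl) → (j , added) , both-ends (empty⇒ u eu) (empty⇒ v ev) })
      (λ dom → case f Fin.≟ e of λ { (yes f≡) → from (∈-add⇔ {p = out}) (inj₂ f≡) ; (no f≢) → from ∈-add⇔ (inj₁ (dominant-old f≢ dom)) })
    ... | inj₂ (¬empty , p≡) rewrite p≡ = mk⇔ (λ f∈ → grow (to out⇔ f∈))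
      (λ dom → dominant-old (λ { refl → ¬empty ( ⇒empty u (first∈ e) (proj₂ dom u (first∈ e))
                                               , ⇒empty v (second∈ e) (proj₂ dom v (second∈ e))) }) dom)

  insert-invariant : ∀ {M M′ A j e} → Legal (edgesOf M) → Legal (edgesOf M′) → Adds (edgesOf M) (edgesOf M′) j e →
    Invariant (edgesOf M) A → Invariant (edgesOf M′) (insertStep M′ j e A)
  insert-invariant {M} {M′} {⟨ N , out ⟩} {j} {e} legal legal′ adds inv = record { N⇔ = N′⇔ ; out⇔ = out₃⇔ _ }
    where
    open Invariant inv
    open Legal legal′
    open Adds adds
    R  = edgesOf M
    R′ = edgesOf M′
    u = proj₁ (ends e)
    v = proj₂ (ends e)
    N′⇔ : ∀ {x f} → f ∈ addN e N x ⇔ (x ∈ₑ f × Present R′ f)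
    N′⇔ = addN-ok {N} N⇔
    out₁ = unmatchBelow M′ j u out
    out₂ = unmatchBelow M′ j v out₁
    out₁⇔ : ∀ {f} → f ∈ out₁ ⇔ (f ∈ out × ¬ LowerAt M′ j u f)
    out₁⇔ = ∈-unmatchBelow M′ (output-matching legal inv)
    out₂⇔ : ∀ {f} → f ∈ out₂ ⇔ (f ∈ out₁ × ¬ LowerAt M′ j v f)
    out₂⇔ = ∈-unmatchBelow M′ (λ e∈ f∈ → output-matching legal inv (proj₁ (to out₁⇔ e∈)) (proj₁ (to out₁⇔ f∈)))
    kept⇔ : ∀ {f} → f ∈ out₂ ⇔ (Present R f × Dominant R′ f)
    kept⇔ {f} = mk⇔ kept⇒ (λ (pf , dom) → from out₂⇔ (from out₁⇔ (from out⇔ (shrink-dominant pf dom)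
                     , not-lower u (first∈ e) dom) , not-lower v (second∈ e) dom))
      where
      not-lower : ∀ x → x ∈ₑ e → Dominant R′ f → ¬ LowerAt M′ j x f
      not-lower x x∈e (_ , top) (x∈f , i , R′f , i<j) = top x x∈f e x∈e (j , added) (i , j , R′f , added , i<j)
      kept⇒ : f ∈ out₂ → Present R f × Dominant R′ f
      kept⇒ f∈ = proj₁ dom , (map₂ old (proj₁ dom)) , grow
        where
        f∈₁ = proj₁ (to out₂⇔ f∈)
        ¬v  = proj₂ (to out₂⇔ f∈)
        ¬u  = proj₂ (to out₁⇔ f∈₁)
        dom = to out⇔ (proj₁ (to out₁⇔ f∈₁))
        grow : ∀ x → x ∈ₑ f → Topmost R′ x f
        grow x x∈f g x∈g _ (i , i′ , R′f , R′g , i<) = case to ⇔R R′g of λ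
          { (inj₁ Rg) → proj₂ dom x x∈f g x∈g (i′ , Rg) (i , i′ , oldf R′f , Rg , i<)
          ; (inj₂ (refl , refl)) → case x∈g of λ
            { (inj₁ refl) → ¬u (x∈f , i , R′f , i<) ; (inj₂ refl) → ¬v (x∈f , i , R′f , i<) } }
          where
          oldf : ∀ {i} → R′ i f → R i f
          oldf R′f = case to ⇔R R′f of λ { (inj₁ Rf) → Rf ; (inj₂ (_ , refl)) → contradiction (proj₁ dom) new }
    split : ∀ {f} → Dominant R′ f → f ∈ out₂ ⊎ f ≡ e
    split dom = case to Present⇔ (proj₁ dom) of λ { (inj₁ pf) → inj₁ (from kept⇔ (pf , dom)) ; (inj₂ f≡) → inj₂ f≡ }
    e? = highest? M′ (addN e N u) e ×-dec highest? M′ (addN e N v) e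
    out₃⇔ : ∀ f → f ∈ (if does e? then out₂ ∪ ⁅ e ⁆ else out₂) ⇔ Dominant R′ f
    out₃⇔ f with if-cases e? (out₂ ∪ ⁅ e ⁆) out₂
    ... | inj₁ ((hu , hv) , p≡) rewrite p≡ = mk⇔
      (λ f∈ → case to (∈-add⇔ {p = out₂}) f∈ of λ
        { (inj₁ f∈) → proj₂ (to kept⇔ f∈)
        ; (inj₂ refl) → (j , added) , both-ends (proj₂ (proj₂ (to (highest⇔ {M′} {addN e N u} N′⇔) hu)))
                                                (proj₂ (proj₂ (to (highest⇔ {M′} {addN e N v} N′⇔) hv))) })
      (λ dom → case split dom of λ { (inj₁ f∈) → from ∈-add⇔ (inj₁ f∈) ; (inj₂ f≡) → from (∈-add⇔ {p = out₂}) (inj₂ f≡) })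
    ... | inj₂ (¬h , p≡) rewrite p≡ = mk⇔ (λ f∈ → proj₂ (to kept⇔ f∈)) (λ dom → case split dom of λ
      { (inj₁ f∈) → f∈
      ; (inj₂ refl) → contradiction ( from (highest⇔ {M′} {addN e N u} N′⇔) (first∈ e , proj₁ dom , proj₂ dom u (first∈ e))
                                    , from (highest⇔ {M′} {addN e N v} N′⇔) (second∈ e , proj₁ dom , proj₂ dom v (second∈ e))) ¬h })

  ∈-rematch : ∀ {M N u out} → Legal (edgesOf M) → (∀ {x f} → f ∈ N x ⇔ (x ∈ₑ f × Present (edgesOf M) f)) →
    ∀ f → f ∈ rematch M N u out ⇔ (f ∈ out ⊎ (u ∈ₑ f × Dominant (edgesOf M) f))
  ∈-rematch {M} {N} {u} {out} legal N⇔ f with rematch-cases M N u out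
  ... | inj₂ (none , p≡) rewrite p≡ = mk⇔ inj₁ (λ
    { (inj₁ f∈) → f∈
    ; (inj₂ (u∈f , pf , top)) → contradiction (from (highest⇔ {M} {N u} N⇔) (u∈f , pf , top u u∈f)) (none f) })
  ... | inj₁ (g , hg , rest) = cases rest
    where
    u∈g = proj₁ (to (highest⇔ {M} {N u} N⇔) hg)
    pg  = proj₁ (proj₂ (to (highest⇔ {M} {N u} N⇔) hg))
    top-g = proj₂ (proj₂ (to (highest⇔ {M} {N u} N⇔) hg))
    f≡g : u ∈ₑ f → Dominant (edgesOf M) f → f ≡ g
    f≡g u∈f (pf , top) = topmost-unique legal u∈f u∈g pf pg (top u u∈f) top-g
    cases : (Highest M (N (opposite g u)) g × rematch M N u out ≡ out ∪ ⁅ g ⁆) ⊎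
            (¬ Highest M (N (opposite g u)) g × rematch M N u out ≡ out) →
            f ∈ rematch M N u out ⇔ (f ∈ out ⊎ (u ∈ₑ f × Dominant (edgesOf M) f))
    cases (inj₁ (ho , p≡)) rewrite p≡ = mk⇔
      (λ f∈ → case to (∈-add⇔ {p = out}) f∈ of λ
        { (inj₁ f∈) → inj₁ f∈
        ; (inj₂ refl) → inj₂ (u∈g , pg , λ x x∈g → case end-cases u∈g x∈g of λ
            { (inj₁ refl) → top-g ; (inj₂ refl) → proj₂ (proj₂ (to (highest⇔ {M} {N (opposite g u)} N⇔) ho)) }) })
      (λ { (inj₁ f∈) → from ∈-add⇔ (inj₁ f∈) ; (inj₂ (u∈f , dom)) → from (∈-add⇔ {p = out}) (inj₂ (f≡g u∈f dom)) })
    cases (inj₂ (¬ho , p≡)) rewrite p≡ = mk⇔ inj₁ (λ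
      { (inj₁ f∈) → f∈
      ; (inj₂ (u∈f , dom)) → contradiction (from (highest⇔ {M} {N (opposite g u)} N⇔)
          (opposite∈ u∈g , pg , subst (Topmost (edgesOf M) (opposite g u)) (f≡g u∈f dom)
            (proj₂ dom (opposite g u) (subst (opposite g u ∈ₑ_) (sym (f≡g u∈f dom)) (opposite∈ u∈g))))) ¬ho })

  delete-invariant : ∀ {M M′ A j e} → Legal (edgesOf M) → Legal (edgesOf M′) → Adds (edgesOf M′) (edgesOf M) j e →
    Invariant (edgesOf M) A → Invariant (edgesOf M′) (deleteStep M′ e A)
  delete-invariant {M} {M′} {⟨ N , out ⟩} {j} {e} legal legal′ adds inv = record { N⇔ = N′⇔ ; out⇔ = out₂⇔ _ }
    where
    open Invariant inv
    open Adds adds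
    R  = edgesOf M
    R′ = edgesOf M′
    u = proj₁ (ends e)
    v = proj₂ (ends e)
    N′ = removeN e N
    N′⇔ : ∀ {x f} → f ∈ removeN e N x ⇔ (x ∈ₑ f × Present R′ f)
    N′⇔ {x} {f} = mk⇔
      (λ f∈ → let f∈N , f≢ = to (∈-removeN e N x) f∈ ; x∈f , pf = to N⇔ f∈N in x∈f , (case to Present⇔ pf of λ
        { (inj₁ pf) → pf ; (inj₂ refl) → contradiction (refl , x∈f) f≢ }))
      (λ (x∈f , pf) → from (∈-removeN e N x) (from N⇔ (x∈f , from Present⇔ (inj₁ pf)) , λ { (refl , _) → new pf }))
    out₁ = rematch M′ N′ u (out - e)
    out₂⇔ : ∀ f → f ∈ rematch M′ N′ v out₁ ⇔ Dominant R′ f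
    out₂⇔ f = mk⇔
      (λ f∈ → case to (∈-rematch {M′} {N′} legal′ N′⇔ f) f∈ of λ
        { (inj₂ (_ , dom)) → dom
        ; (inj₁ f∈) → case to (∈-rematch {M′} {N′} legal′ N′⇔ f) f∈ of λ
          { (inj₂ (_ , dom)) → dom ; (inj₁ f∈) → survive f∈ } })
      (λ dom → from (∈-rematch {M′} {N′} legal′ N′⇔ f) (case v ∈ₑ? f of λ
        { (yes v∈f) → inj₂ (v∈f , dom)
        ; (no v∉f) → inj₁ (from (∈-rematch {M′} {N′} legal′ N′⇔ f) (case u ∈ₑ? f of λ
          { (yes u∈f) → inj₂ (u∈f , dom)
          ; (no u∉f) → inj₁ (from ∈-remove⇔ (from out⇔ (unaffected u∉f v∉f dom) , λ { refl → new (proj₁ dom) })) })) }))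
      where
      survive : f ∈ out - e → Dominant R′ f
      survive f∈ with to (∈-remove⇔ {p = out}) f∈
      ... | f∈out , f≢e with to out⇔ f∈out
      ...   | pf , top with to Present⇔ pf
      ...     | inj₁ pf′ = shrink-dominant pf′ (pf , top)
      ...     | inj₂ f≡e = contradiction f≡e f≢e
      unaffected : ¬ u ∈ₑ f → ¬ v ∈ₑ f → Dominant R′ f → Dominant R f
      unaffected u∉ v∉ ((i₀ , R′f) , top) = (i₀ , old R′f) , λ x x∈f g x∈g _ (i , i′ , Rf , Rg , i<) → case to ⇔R Rg of λ
        { (inj₁ R′g) → top x x∈f g x∈g (i′ , R′g) (i₀ , i′ , R′f , R′g , subst (_<ᶠ i′) (Legal.unique legal Rf (old R′f)) i<)
        ; (inj₂ (_ , refl)) → case x∈g of λ { (inj₁ refl) → u∉ x∈f ; (inj₂ refl) → v∉ x∈f } }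

-- Programs over tables

⇓-deterministic : ∀ {W p s s₁ s₂ t₁ t₂} →
  ⟪_,_⟫⇓⟪_,_⟫ W p s s₁ t₁ → ⟪_,_⟫⇓⟪_,_⟫ W p s s₂ t₂ → s₁ ≡ s₂
⇓-deterministic ⇓skip ⇓skip = refl
⇓-deterministic ⇓assign ⇓assign = refl
⇓-deterministic ⇓store ⇓store = refl
⇓-deterministic (⇓seq p q) (⇓seq p′ q′)
  with refl ← ⇓-deterministic p p′ = ⇓-deterministic q q′
⇓-deterministic (⇓then _ p) (⇓then _ p′) = ⇓-deterministic p p′
⇓-deterministic (⇓then x _) (⇓else y _) = contradiction y x
⇓-deterministic (⇓else x _) (⇓then y _) = contradiction x y
⇓-deterministic (⇓else _ p) (⇓else _ p′) = ⇓-deterministic p p′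
⇓-deterministic (⇓done _) (⇓done _) = refl
⇓-deterministic (⇓done x) (⇓loop y _ _) = contradiction x y
⇓-deterministic (⇓loop y _ _) (⇓done x) = contradiction x y
⇓-deterministic (⇓loop _ p q) (⇓loop _ p′ q′)
  with refl ← ⇓-deterministic p p′ = ⇓-deterministic q q′

≡ᵇ-refl : ∀ n → (n ≡ᵇ n) ≡ true
≡ᵇ-refl zero    = refl
≡ᵇ-refl (suc n) = ≡ᵇ-refl n

≢⇒≡ᵇ-false : ∀ {m n} → m ≢ n → (m ≡ᵇ n) ≡ false
≢⇒≡ᵇ-false {m} {n} m≢n with m ≡ᵇ n in p≡
... | false = refl
... | true  = contradiction (≡ᵇ⇒≡ m n (subst T (sym p≡) tt)) m≢n

↦-same : ∀ (f : ℕ → ℕ) a x → (f [ a ↦ x ]) a ≡ x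
↦-same f a x rewrite ≡ᵇ-refl a = refl

↦-other : ∀ (f : ℕ → ℕ) {a b} x → a ≢ b → (f [ a ↦ x ]) b ≡ f b
↦-other f x a≢b rewrite ≢⇒≡ᵇ-false a≢b = refl

put : (ℕ → ℕ → ℕ) → ℕ → ℕ → ℕ → ℕ → ℕ → ℕ
put f u c x u′ = if u ≡ᵇ u′ then f u′ [ c ↦ x ] else f u′

upd : (ℕ → ℕ → ℕ → ℕ) → ℕ → ℕ → ℕ → ℕ → ℕ → ℕ → ℕ → ℕ
upd κ t u c x t′ = if t ≡ᵇ t′ then put (κ t′) u c x else κ t′

upd-same : ∀ κ t u c x → upd κ t u c x t u c ≡ x
upd-same κ t u c x rewrite ≡ᵇ-refl t | ≡ᵇ-refl u | ≡ᵇ-refl c = refl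

upd-other : ∀ κ {t u c t′ u′ c′} x → ¬ (t ≡ t′ × u ≡ u′ × c ≡ c′) → upd κ t u c x t′ u′ c′ ≡ κ t′ u′ c′
upd-other κ {t} {u} {c} {t′} {u′} {c′} x ne with t ℕ.≟ t′
... | no  t≢ rewrite ≢⇒≡ᵇ-false t≢ = refl
... | yes refl rewrite ≡ᵇ-refl t with u ℕ.≟ u′
...   | no  u≢ rewrite ≢⇒≡ᵇ-false u≢ = refl
...   | yes refl rewrite ≡ᵇ-refl u = ↦-other (κ t u) x (λ c≡ → ne (refl , refl , c≡))

upd-other-row : ∀ κ {t u c t′ u′ c′} x → u ≢ u′ → upd κ t u c x t′ u′ c′ ≡ κ t′ u′ c′
upd-other-row κ {t} {u} {c} x u≢ = upd-other κ {t} {u} {c} x (λ (_ , u≡ , _) → u≢ u≡)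

infix  6 _≔ᵣ_
infixr 5 _⍮_

data Ex : Set where
  #    : ℕ → Ex
  r    : ℕ → Ex
  cell : ℕ → Ex → Ex → Ex
  op   : Op → Ex → Ex → Ex
  max  : Ex → Ex → Ex

data Co : Set where
  nop       : Co
  _≔ᵣ_      : ℕ → Ex → Co
  write     : ℕ → Ex → Ex → Ex → Co
  _⍮_       : Co → Co → Co
  branch    : Ex → Co → Co → Co
  loop      : Ex → Co → Co

address : ℕ → Expr → Expr → Expr
address t x y = bin add (bin mul (bin add (bin mul (lit t) (reg 11)) x) (reg 11)) y

compileᵉ : Ex → Expr
compileᵉ (# n)        = lit n
compileᵉ (r a)        = reg a
compileᵉ (cell t x y) = mem (address t (compileᵉ x) (compileᵉ y))
compileᵉ (op o x y)   = bin o (compileᵉ x) (compileᵉ y)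
compileᵉ (max x y)    = bin add (bin mul b (bin lt a b)) (bin mul a (bin eq (bin lt a b) (lit 0)))
  where a = compileᵉ x; b = compileᵉ y

compile : Co → Cmd
compile nop                  = skip
compile (a ≔ᵣ e)             = a ≔ compileᵉ e
compile (write t x y e) = ⟦ address t (compileᵉ x) (compileᵉ y) ⟧≔ compileᵉ e
compile (p ⍮ q)              = compile p ⨟ compile q
compile (branch e p q)       = cond (compileᵉ e) (compile p) (compile q)
compile (loop e p)           = while (compileᵉ e) (compile p)

sizeᵉ : Ex → ℕ
sizeᵉ e = size 0 (compileᵉ e)

size-irrelevant : ∀ W e → size W e ≡ size 0 e
size-irrelevant W (lit x)     = refl
size-irrelevant W (reg x)     = refl
size-irrelevant W (mem e)     = cong suc (size-irrelevant W e)
size-irrelevant W (bin _ e f) = cong suc (cong₂ _+_ (size-irrelevant W e) (size-irrelevant W f))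

setAt : List ℕ → ℕ → ℕ → List ℕ
setAt []       _       x = []
setAt (_ ∷ xs) zero    x = x ∷ xs
setAt (y ∷ xs) (suc a) x = y ∷ setAt xs a x

words-setAt : ∀ xs {a} x b → a < length xs → words (setAt xs a x) b ≡ (words xs [ a ↦ x ]) b
words-setAt (y ∷ xs) {zero}  x zero    _        = refl
words-setAt (y ∷ xs) {zero}  x (suc b) _        = refl
words-setAt (y ∷ xs) {suc a} x zero    _        = refl
words-setAt (y ∷ xs) {suc a} x (suc b) (s≤s a<) = words-setAt xs x b a<

record AState : Set where
  constructor ⟪_∣_⟫
  field
    ρ : List ℕ
    κ : ℕ → ℕ → ℕ → ℕ
open AState

module Programs (W Z : ℕ) (8≤2^W : 8 ≤ 2 ^ W) (8ZZ≤2^W : 8 * (Z * Z) ≤ 2 ^ W) where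

  instance
    2^W≢0 : NonZero (2 ^ W)
    2^W≢0 = m^n≢0 2 W

  truncate-small : ∀ {x} → x < 2 ^ W → truncate W x ≡ x
  truncate-small {x} x< = m<n⇒m%n≡m x<

  addr : ℕ → ℕ → ℕ → ℕ
  addr t u c = (t * Z + u) * Z + c

  mixed<* : ∀ {a b c d} → a < b → c < d → a * d + c < b * d
  mixed<* {a} {b} {c} {d} a<b c<d = begin-strict
    a * d + c  <⟨ +-monoʳ-< (a * d) c<d ⟩
    a * d + d  ≡⟨ +-comm (a * d) d ⟩
    suc a * d  ≤⟨ *-monoˡ-≤ d a<b ⟩
    b * d      ∎ where open ≤-Reasoning

  mixed-injective : ∀ {a b c d e} → c < e → d < e → a * e + c ≡ b * e + d → a ≡ b × c ≡ d
  mixed-injective {a} {b} {c} {d} {zero} () _ _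
  mixed-injective {a} {b} {c} {d} {e@(suc _)} c< d< p≡ = *-cancelʳ-≡ a b e (+-cancelʳ-≡ c _ _ eq′) , c≡d
    where
    digit : ∀ x {y} → y < e → (x * e + y) % e ≡ y
    digit x {y} y< = begin
      (x * e + y) % e  ≡⟨ cong (_% e) (+-comm (x * e) y) ⟩
      (y + x * e) % e  ≡⟨ [m+kn]%n≡m%n y x e ⟩
      y % e            ≡⟨ m<n⇒m%n≡m y< ⟩
      y                ∎ where open ≡-Reasoning
    c≡d : c ≡ d
    c≡d = trans (sym (digit a c<)) (trans (cong (_% e) p≡) (digit b d<))
    eq′ : a * e + c ≡ b * e + c
    eq′ = trans p≡ (cong (b * e +_) (sym c≡d))

  addr-injective : ∀ {t u c t′ u′ c′} → u < Z → c < Z → u′ < Z → c′ < Z →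
    addr t u c ≡ addr t′ u′ c′ → t ≡ t′ × u ≡ u′ × c ≡ c′
  addr-injective u< c< u′< c′< p≡ =
    let tu≡ , c≡ = mixed-injective c< c′< p≡
        t≡ , u≡  = mixed-injective u< u′< tu≡
    in t≡ , u≡ , c≡

  addr<2^W : ∀ {t u c} → t < 8 → u < Z → c < Z → addr t u c < 2 ^ W
  addr<2^W {t} {u} {c} t< u< c< = begin-strict
    addr t u c   <⟨ mixed<* (mixed<* t< u<) c< ⟩
    8 * Z * Z    ≡⟨ *-assoc 8 Z Z ⟩
    8 * (Z * Z)  ≤⟨ 8ZZ≤2^W ⟩
    2 ^ W        ∎ where open ≤-Reasoning

  -- the results intended by a program, which OpOk keeps from wrapping around
  ideal : Op → ℕ → ℕ → ℕ
  ideal add x y = x + y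
  ideal sub x y = x ∸ y
  ideal mul x y = x * y
  ideal o   x y = applyOp W o x y

  OpOk : Op → ℕ → ℕ → Set
  OpOk add x y = x + y < 2 ^ W
  OpOk sub x y = y ≤ x × x < 2 ^ W
  OpOk mul x y = x * y < 2 ^ W
  OpOk _   _ _ = ⊤

  ⟦_⟧ : Ex → AState → ℕ
  ⟦ # n ⟧        σ = n
  ⟦ r a ⟧        σ = words (ρ σ) a
  ⟦ cell t x y ⟧ σ = κ σ t (⟦ x ⟧ σ) (⟦ y ⟧ σ)
  ⟦ op o x y ⟧   σ = ideal o (⟦ x ⟧ σ) (⟦ y ⟧ σ)
  ⟦ max x y ⟧    σ = ⟦ x ⟧ σ ⊔ ⟦ y ⟧ σ

  Ok : Ex → AState → Set
  Ok (# n)        σ = T (n <ᵇ 8)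
  Ok (r a)        σ = ⊤
  Ok (cell t x y) σ = T (t <ᵇ 8) × (Ok x σ × ⟦ x ⟧ σ < Z) × (Ok y σ × ⟦ y ⟧ σ < Z)
  Ok (op o x y)   σ = (Ok x σ × Ok y σ) × OpOk o (⟦ x ⟧ σ) (⟦ y ⟧ σ)
  Ok (max x y)    σ = (Ok x σ × ⟦ x ⟧ σ < Z) × (Ok y σ × ⟦ y ⟧ σ < Z)

  record Rep (s : Store) (σ : AState) : Set where
    field
      regs≡ : ∀ a → regs s a ≡ words (ρ σ) a
      mem≡  : ∀ {t u c} → t < 8 → u < Z → c < Z → memory s (addr t u c) ≡ κ σ t u c
      Z≡    : words (ρ σ) 11 ≡ Z

  applyOp-ideal : ∀ o {x y} → OpOk o x y → applyOp W o x y ≡ ideal o x y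
  applyOp-ideal add x<          = truncate-small x<
  applyOp-ideal sub {x} {y} (y≤x , x<) = begin
    (x + (2 ^ W ∸ y)) % 2 ^ W          ≡⟨ cong (λ z → (z + (2 ^ W ∸ y)) % 2 ^ W) (sym (m∸n+n≡m y≤x)) ⟩
    (x ∸ y + y + (2 ^ W ∸ y)) % 2 ^ W  ≡⟨ cong (_% 2 ^ W) (+-assoc (x ∸ y) y _) ⟩
    (x ∸ y + (y + (2 ^ W ∸ y))) % 2 ^ W ≡⟨ cong (λ z → (x ∸ y + z) % 2 ^ W) (m+[n∸m]≡n (<⇒≤ (≤-<-trans y≤x x<))) ⟩
    (x ∸ y + 2 ^ W) % 2 ^ W            ≡⟨ [m+n]%n≡m%n (x ∸ y) (2 ^ W) ⟩
    (x ∸ y) % 2 ^ W                    ≡⟨ truncate-small (≤-<-trans (m∸n≤m x y) x<) ⟩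
    x ∸ y                              ∎ where open ≡-Reasoning
  applyOp-ideal mul x< = truncate-small x<
  applyOp-ideal div _ = refl
  applyOp-ideal mod _ = refl
  applyOp-ideal and _ = refl
  applyOp-ideal or  _ = refl
  applyOp-ideal xor _ = refl
  applyOp-ideal shl _ = refl
  applyOp-ideal shr _ = refl
  applyOp-ideal eq  _ = refl
  applyOp-ideal lt  _ = refl

  eval-address : ∀ {s σ} → Rep s σ → ∀ {t x y u c} → t < 8 → eval W s x ≡ u → u < Z → eval W s y ≡ c → c < Z →
    eval W s (address t x y) ≡ addr t u c
  eval-address {s} R {t} {u = u} {c} t< refl u< refl c<
    rewrite trans (Rep.regs≡ R 11) (Rep.Z≡ R)
          | truncate-small {t} (≤-<-trans (≤-trans (m≤m*n t Z {{ℕ.>-nonZero (≤-<-trans z≤n u<)}})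
                               (≤-trans (m≤m+n (t * Z) u) (≤-trans (m≤m*n (t * Z + u) Z {{ℕ.>-nonZero (≤-<-trans z≤n u<)}})
                                (m≤m+n _ c)))) (addr<2^W t< u< c<))
          | truncate-small {t * Z} (≤-<-trans (≤-trans (m≤m+n (t * Z) u) (≤-trans (m≤m*n (t * Z + u) Z {{ℕ.>-nonZero (≤-<-trans z≤n u<)}})
                                (m≤m+n _ c))) (addr<2^W t< u< c<))
          | truncate-small {t * Z + u} (≤-<-trans (≤-trans (m≤m*n (t * Z + u) Z {{ℕ.>-nonZero (≤-<-trans z≤n u<)}})
                                (m≤m+n _ c)) (addr<2^W t< u< c<))
          | truncate-small {(t * Z + u) * Z} (≤-<-trans (m≤m+n _ c) (addr<2^W t< u< c<))
          = truncate-small (addr<2^W t< u< c<)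

  Z≤2^W : Z ≤ 2 ^ W
  Z≤2^W = lemma Z 8ZZ≤2^W
    where
    lemma : ∀ z → 8 * (z * z) ≤ 2 ^ W → z ≤ 2 ^ W
    lemma zero    _ = z≤n
    lemma z@(suc _) h = ≤-trans (≤-trans (m≤m*n z z) (m≤n*m (z * z) 8)) h

  eval-max : ∀ a b → a < Z → b < Z →
    truncate W (truncate W (b * bit W (a <ᵇ b)) + truncate W (a * bit W (bit W (a <ᵇ b) ≡ᵇ truncate W 0))) ≡ a ⊔ b
  eval-max a b a< b< rewrite truncate-small {0} (≤-<-trans z≤n (<-≤-trans a< Z≤2^W)) with a <ᵇ b in p≡
  ... | true rewrite *-identityʳ b | *-zeroʳ a | truncate-small (<-≤-trans b< Z≤2^W)
                   | truncate-small {0} (≤-<-trans z≤n (<-≤-trans a< Z≤2^W)) | +-identityʳ b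
                   = trans (truncate-small (<-≤-trans b< Z≤2^W)) (sym (m≤n⇒m⊔n≡n (<⇒≤ (<ᵇ⇒< a b (subst T (sym p≡) tt)))))
  ... | false rewrite *-identityʳ a | *-zeroʳ b | truncate-small (<-≤-trans a< Z≤2^W)
                   | truncate-small {0} (≤-<-trans z≤n (<-≤-trans a< Z≤2^W))
                   = trans (truncate-small (<-≤-trans a< Z≤2^W))
                       (sym (m≥n⇒m⊔n≡m (≮⇒≥ (λ a<b → subst T p≡ (<⇒<ᵇ a<b)))))

  eval-ok : ∀ {s σ} → Rep s σ → ∀ e → Ok e σ → eval W s (compileᵉ e) ≡ ⟦ e ⟧ σ
  eval-ok R (# n) n< = truncate-small (<-≤-trans (<ᵇ⇒< n 8 n<) 8≤2^W)
  eval-ok R (r a) _ = Rep.regs≡ R a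
  eval-ok {s} R (cell t x y) (t< , (okx , x<) , (oky , y<)) =
    trans (cong (memory s) (eval-address R {t} {compileᵉ x} {compileᵉ y} (<ᵇ⇒< t 8 t<) (eval-ok R x okx) x< (eval-ok R y oky) y<))
          (Rep.mem≡ R (<ᵇ⇒< t 8 t<) x< y<)
  eval-ok R (op o x y) ((okx , oky) , ok) =
    trans (cong₂ (applyOp W o) (eval-ok R x okx) (eval-ok R y oky)) (applyOp-ideal o ok)
  eval-ok R (max x y) ((okx , x<) , (oky , y<)) rewrite eval-ok R x okx | eval-ok R y oky = eval-max _ _ x< y<

  Rep-assign : ∀ {s σ a x y} → Rep s σ → x ≡ y → (a ≡ᵇ 11) ≡ false → T (a <ᵇ length (ρ σ)) →
    Rep (store (regs s [ a ↦ x ]) (memory s)) ⟪ setAt (ρ σ) a y ∣ κ σ ⟫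
  Rep-assign {s} {σ} {a} {x} R refl a≢11 a< = record
    { regs≡ = λ b → trans (helper b) (sym (words-setAt (ρ σ) x b a<′))
    ; mem≡  = Rep.mem≡ R
    ; Z≡    = trans (words-setAt (ρ σ) x 11 a<′)
                (trans (cong (λ z → if z then x else words (ρ σ) 11) a≢11) (Rep.Z≡ R))
    }
    where
    a<′ = <ᵇ⇒< a _ a<
    helper : ∀ b → (regs s [ a ↦ x ]) b ≡ (words (ρ σ) [ a ↦ x ]) b
    helper b with a ≡ᵇ b
    ... | true  = refl
    ... | false = Rep.regs≡ R b

  Rep-store : ∀ {s σ t u c x y a} → Rep s σ → t < 8 → u < Z → c < Z → a ≡ addr t u c → x ≡ y →
    Rep (store (regs s) (memory s [ a ↦ x ])) ⟪ ρ σ ∣ upd (κ σ) t u c y ⟫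
  Rep-store {s} {σ} {t} {u} {c} {x} R t< u< c< refl refl = record
    { regs≡ = Rep.regs≡ R ; mem≡ = helper ; Z≡ = Rep.Z≡ R }
    where
    helper : ∀ {t′ u′ c′} → t′ < 8 → u′ < Z → c′ < Z →
      (memory s [ addr t u c ↦ x ]) (addr t′ u′ c′) ≡ upd (κ σ) t u c x t′ u′ c′
    helper {t′} {u′} {c′} t′< u′< c′< with addr t u c ℕ.≟ addr t′ u′ c′
    ... | yes p≡ with refl , refl , refl ← addr-injective {t} {u} {c} {t′} {u′} {c′} u< c< u′< c′< p≡ =
      trans (↦-same (memory s) _ x) (sym (upd-same (κ σ) t u c x))
    ... | no ne = trans (↦-other (memory s) x ne) (trans (Rep.mem≡ R t′< u′< c′<)
      (sym (upd-other (κ σ) {t} {u} {c} x λ { (refl , refl , refl) → ne refl })))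

  infix 3 [_]_[_,_]
  [_]_[_,_] : AState → Co → ℕ → (AState → Set) → Set
  [ σ ] p [ t , Q ] = ∀ s → Rep s σ → ∃[ s′ ] ∃[ t′ ] (⟪_,_⟫⇓⟪_,_⟫ W (compile p) s s′ t′ × t′ ≤ t
                       × ∃[ σ′ ] (Rep s′ σ′ × Q σ′))

  cost : Co → ℕ
  cost nop                  = 1
  cost (a ≔ᵣ e)             = suc (sizeᵉ e)
  cost (write t x y e) = suc (size 0 (address t (compileᵉ x) (compileᵉ y)) + sizeᵉ e)
  cost (p ⍮ q)              = cost p + cost q
  cost (branch e p q)       = suc (sizeᵉ e + (cost p + cost q))
  cost (loop e p)           = 0

  wp : Co → (AState → Set) → AState → Set
  wp nop Q σ = Q σ
  wp (a ≔ᵣ e) Q σ = Ok e σ × ((a ≡ᵇ 11) ≡ false × T (a <ᵇ length (ρ σ))) × Q ⟪ setAt (ρ σ) a (⟦ e ⟧ σ) ∣ κ σ ⟫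
  wp (write t x y e) Q σ = Ok (cell t x y) σ × Ok e σ × Q ⟪ ρ σ ∣ upd (κ σ) t (⟦ x ⟧ σ) (⟦ y ⟧ σ) (⟦ e ⟧ σ) ⟫
  wp (p ⍮ q) Q σ = wp p (wp q Q) σ
  wp (branch e p q) Q σ = Ok e σ × (⟦ e ⟧ σ ≢ 0 → wp p Q σ) × (⟦ e ⟧ σ ≡ 0 → wp q Q σ)
  wp (loop e p) Q σ = ⊥

  seq-rule : ∀ {σ p q t₁ t₂ Q Q′} → [ σ ] p [ t₁ , Q ] → (∀ σ′ → Q σ′ → [ σ′ ] q [ t₂ , Q′ ]) →
    [ σ ] p ⍮ q [ t₁ + t₂ , Q′ ]
  seq-rule hp hq s R =
    let s₁ , t₁ , run₁ , t₁≤ , σ₁ , R₁ , q₁ = hp s R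
        s₂ , t₂ , run₂ , t₂≤ , σ₂ , R₂ , q₂ = hq σ₁ q₁ s₁ R₁
    in s₂ , t₁ + t₂ , ⇓seq run₁ run₂ , +-mono-≤ t₁≤ t₂≤ , σ₂ , R₂ , q₂

  weaken : ∀ {σ p t t′ Q Q′} → t ≤ t′ → (∀ σ′ → Q σ′ → Q′ σ′) → [ σ ] p [ t , Q ] → [ σ ] p [ t′ , Q′ ]
  weaken t≤ imp h s R =
    let s₁ , t₁ , run , t₁≤ , σ₁ , R₁ , q = h s R
    in s₁ , t₁ , run , ≤-trans t₁≤ t≤ , σ₁ , R₁ , imp σ₁ q

  branch-rule : ∀ {σ e p q t₁ t₂ Q} → Ok e σ → (⟦ e ⟧ σ ≢ 0 → [ σ ] p [ t₁ , Q ]) → (⟦ e ⟧ σ ≡ 0 → [ σ ] q [ t₂ , Q ]) →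
    [ σ ] branch e p q [ suc (sizeᵉ e + (t₁ + t₂)) , Q ]
  branch-rule {σ} {e} {t₁ = t₁} {t₂} ok hp hq s R with ⟦ e ⟧ σ in p≡
  ... | zero = let s₁ , t , run , t≤ , post = hq refl s R in
      s₁ , _ , ⇓else (trans (eval-ok R e ok) p≡) run
      , s≤s (+-mono-≤ (≤-reflexive (size-irrelevant W (compileᵉ e))) (≤-trans t≤ (m≤n+m t₂ t₁))) , post
  ... | suc _ = let s₁ , t , run , t≤ , post = hp (λ ()) s R in
      s₁ , _ , ⇓then (λ z → case trans (sym p≡) (trans (sym (eval-ok R e ok)) z) of λ ()) run
      , s≤s (+-mono-≤ (≤-reflexive (size-irrelevant W (compileᵉ e))) (≤-trans t≤ (m≤m+n t₁ t₂))) , post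

  wp-sound : ∀ p {Q σ} → wp p Q σ → [ σ ] p [ cost p , Q ]
  wp-sound nop q s R = _ , _ , ⇓skip , ≤-refl , _ , R , q
  wp-sound (a ≔ᵣ e) (ok , (a≢ , a<) , q) s R =
    _ , _ , ⇓assign , s≤s (≤-reflexive (size-irrelevant W (compileᵉ e))) , _ , Rep-assign {a = a} R (eval-ok R e ok) a≢ a< , q
  wp-sound (write t x y e) ((t< , (okx , x<) , (oky , y<)) , ok , q) s R =
    _ , _ , ⇓store
    , s≤s (≤-reflexive (cong₂ _+_ (size-irrelevant W (address t (compileᵉ x) (compileᵉ y))) (size-irrelevant W (compileᵉ e))))
    , _ , Rep-store R (<ᵇ⇒< t 8 t<) x< y<
            (eval-address R {t} {compileᵉ x} {compileᵉ y} (<ᵇ⇒< t 8 t<) (eval-ok R x okx) x< (eval-ok R y oky) y<) (eval-ok R e ok) , q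
  wp-sound (p ⍮ q) h = seq-rule {p = p} {q} (wp-sound p h) (λ _ → wp-sound q)
  wp-sound (branch e p q) (ok , hp , hq) =
    branch-rule {e = e} {p} {q} ok (λ nz → wp-sound p (hp nz)) (λ z → wp-sound q (hq z))

  loop-stop : ∀ {σ e p Q} → Ok e σ → ⟦ e ⟧ σ ≡ 0 → Q σ → [ σ ] loop e p [ suc (sizeᵉ e) , Q ]
  loop-stop {e = e} ok z q s R =
    s , _ , ⇓done (trans (eval-ok R e ok) z) , s≤s (≤-reflexive (size-irrelevant W (compileᵉ e))) , _ , R , q

  loop-step : ∀ {σ e p t₁ t₂ Q Q′} → Ok e σ → ⟦ e ⟧ σ ≢ 0 → [ σ ] p [ t₁ , Q ] →
    (∀ σ′ → Q σ′ → [ σ′ ] loop e p [ t₂ , Q′ ]) → [ σ ] loop e p [ suc (sizeᵉ e + (t₁ + t₂)) , Q′ ]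
  loop-step {e = e} ok nz hp hl s R =
    let s₁ , t₁ , run₁ , t₁≤ , σ₁ , R₁ , q₁ = hp s R
        s₂ , t₂ , run₂ , t₂≤ , post = hl σ₁ q₁ s₁ R₁
    in s₂ , _ , ⇓loop (λ z → nz (trans (sym (eval-ok R e ok)) z)) run₁ run₂
       , s≤s (+-mono-≤ (≤-reflexive (size-irrelevant W (compileᵉ e))) (+-mono-≤ t₁≤ t₂≤)) , post

-- Words as bit vectors

-- f 0 is the most significant of the b bits, so that the largest index in a
-- set corresponds to the lowest bit of the word that represents it.
word : (ℕ → Bool) → ℕ → ℕ
word f zero    = 0
word f (suc b) = (if f b then 1 else 0) + 2 * word f b

-- 1 + the largest index of a set, or 0 if it is empty
label : (ℕ → Bool) → ℕ → ℕ
label f zero    = 0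
label f (suc b) = if f b then suc b else label f b

label≤ : ∀ f b → label f b ≤ b
label≤ f zero = z≤n
label≤ f (suc b) with f b
... | true  = ≤-refl
... | false = m≤n⇒m≤1+n (label≤ f b)

label≢0⇒word>0 : ∀ f b → label f b ≢ 0 → 0 < word f b
label≢0⇒word>0 f zero l≢0 = contradiction refl l≢0
label≢0⇒word>0 f (suc b) l≢0 with f b
... | true  = s≤s z≤n
... | false = ≤-trans (label≢0⇒word>0 f b l≢0) (m≤m+n _ _)

label≡0⇒word≡0 : ∀ f b → label f b ≡ 0 → word f b ≡ 0
label≡0⇒word≡0 f zero    _   = refl
label≡0⇒word≡0 f (suc b) l≡0 with f b
... | false rewrite label≡0⇒word≡0 f b l≡0 = refl

label-sound : ∀ f b {i} → label f b ≡ suc i → f i ≡ true × i < b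
label-sound f (suc b) l≡ with f b in p≡
... | true  with refl ← l≡ = p≡ , ≤-refl
... | false = map₂ m≤n⇒m≤1+n (label-sound f b l≡)

label-complete : ∀ f b {i} → f i ≡ true → i < b → i < label f b
label-complete f (suc b) {i} fi i< with f b in p≡
... | true  = i<
... | false = label-complete f b fi (≤∧≢⇒< (≤-pred i<) λ { refl → case trans (sym fi) p≡ of λ () })

word<2^ : ∀ f b → word f b < 2 ^ b
word<2^ f zero    = s≤s z≤n
word<2^ f (suc b) = begin-strict
  (if f b then 1 else 0) + 2 * word f b  ≤⟨ +-monoˡ-≤ _ (bit≤1 (f b)) ⟩
  1 + 2 * word f b                       <⟨ ≤-refl ⟩
  2 + 2 * word f b                       ≡⟨ sym (*-suc 2 (word f b)) ⟩
  2 * suc (word f b)                     ≤⟨ *-monoʳ-≤ 2 (word<2^ f b) ⟩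
  2 * 2 ^ b                              ∎
  where
  open ≤-Reasoning
  bit≤1 : ∀ v → (if v then 1 else 0) ≤ 1
  bit≤1 true  = ≤-refl
  bit≤1 false = z≤n

word-cong : ∀ {f g} b → (∀ i → i < b → f i ≡ g i) → word f b ≡ word g b
word-cong zero    f≡g = refl
word-cong (suc b) f≡g =
  cong₂ (λ v x → (if v then 1 else 0) + 2 * x) (f≡g b ≤-refl) (word-cong b (λ i i< → f≡g i (m≤n⇒m≤1+n i<)))

label-cong : ∀ {f g} b → (∀ i → i < b → f i ≡ g i) → label f b ≡ label g b
label-cong zero    f≡g = refl
label-cong (suc b) f≡g =
  cong₂ (λ v x → if v then suc b else x) (f≡g b ≤-refl) (label-cong b (λ i i< → f≡g i (m≤n⇒m≤1+n i<)))

word-set : ∀ {f g} b {i} → i < b → f i ≡ false → g i ≡ true → (∀ j → j ≢ i → f j ≡ g j) →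
  word g b ≡ word f b + 2 ^ (b ∸ suc i)
word-set {f} {g} (suc b) {i} i< fi gi f≡g with i ℕ.≟ b
... | yes refl rewrite fi | gi | n∸n≡0 i | word-cong {f} {g} i (λ j j< → f≡g j (<⇒≢ j<)) = +-comm 1 _
... | no i≢b rewrite f≡g b (i≢b ∘ sym) | word-set {f} {g} b (≤∧≢⇒< (≤-pred i<) i≢b) fi gi f≡g
                   | *-distribˡ-+ 2 (word f b) (2 ^ (b ∸ suc i))
                   | +-∸-assoc 1 {b} {suc i} (≤∧≢⇒< (≤-pred i<) i≢b) = sym (+-assoc (if g b then 1 else 0) (2 * word f b) _)

module _ (W : ℕ) where

  halve : ∀ v y → (bit W v + 2 * y) / 2 ≡ y
  halve v y = begin
    (bit W v + 2 * y) / 2      ≡⟨ cong (λ z → (bit W v + z) / 2) (*-comm 2 y) ⟩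
    (bit W v + y * 2) / 2      ≡⟨ +-distrib-/-∣ʳ (bit W v) (divides y refl) ⟩
    bit W v / 2 + y * 2 / 2    ≡⟨ cong₂ _+_ (small v) (m*n/n≡m y 2) ⟩
    y                          ∎
    where
    open ≡-Reasoning
    small : ∀ v → bit W v / 2 ≡ 0
    small false = refl
    small true  = refl

  odd-bit : ∀ v y → odd W (bit W v + 2 * y) ≡ v
  odd-bit v y = trans (cong (_≡ᵇ 1) (trans (cong (λ z → (bit W v + z) % 2) (*-comm 2 y)) ([m+kn]%n≡m%n (bit W v) y 2))) (small v)
    where
    small : ∀ v → (bit W v % 2 ≡ᵇ 1) ≡ v
    small false = refl
    small true  = refl

  and-bits : ∀ b v w x y →
    bitwise W _∧_ (suc b) (bit W v + 2 * x) (bit W w + 2 * y) ≡ bit W (v ∧ w) + 2 * bitwise W _∧_ b x y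
  and-bits b v w x y rewrite halve v x | halve w y | odd-bit v x | odd-bit w y = refl

  parity : ∀ x → x ≡ bit W (odd W x) + 2 * (x / 2)
  parity x = trans (m≡m%n+[m/n]*n x 2) (cong₂ _+_ (low (x % 2) (m%n<n x 2)) (*-comm (x / 2) 2))
    where
    low : ∀ y → y < 2 → y ≡ bit W (y ≡ᵇ 1)
    low zero          _ = refl
    low (suc zero)    _ = refl
    low (suc (suc _)) (s≤s (s≤s ()))

  and-idem : ∀ b x → x < 2 ^ b → bitwise W _∧_ b x x ≡ x
  and-idem zero    zero    _ = refl
  and-idem zero    (suc _) (s≤s ())
  and-idem (suc b) x x< = begin
    bitwise W _∧_ (suc b) x x                          ≡⟨⟩
    bit W (odd W x ∧ odd W x) + 2 * bitwise W _∧_ b (x / 2) (x / 2)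
      ≡⟨ cong₂ (λ v y → bit W v + 2 * y) (∧-idem (odd W x)) (and-idem b (x / 2) (m<n*o⇒m/o<n (subst (x <_) (*-comm 2 (2 ^ b)) x<))) ⟩
    bit W (odd W x) + 2 * (x / 2)                      ≡⟨ sym (parity x) ⟩
    x                                                  ∎
    where open ≡-Reasoning

  lowest-bit : ∀ f b {b′} → label f b ≢ 0 → b ≤ b′ → word f b < 2 ^ b′ →
    bitwise W _∧_ b′ (word f b) (word f b ∸ 1) + 2 ^ (b ∸ label f b) ≡ word f b
  lowest-bit f zero    l≢0 _ _ = contradiction refl l≢0
  lowest-bit f (suc b) {suc b′} l≢0 (s≤s b≤) w< with f b
  ... | true  = begin
    bitwise W _∧_ (suc b′) (bit W true + 2 * x) (bit W false + 2 * x) + 2 ^ (b ∸ b)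
      ≡⟨ cong₂ _+_ (and-bits b′ true false x x) (cong (2 ^_) (n∸n≡0 b)) ⟩
    2 * bitwise W _∧_ b′ x x + 1   ≡⟨ cong (λ z → 2 * z + 1) (and-idem b′ x (*-cancelˡ-< 2 x (2 ^ b′) (≤-<-trans (n≤1+n _) w<))) ⟩
    2 * x + 1                      ≡⟨ +-comm (2 * x) 1 ⟩
    suc (2 * x)                    ∎
    where
    open ≡-Reasoning
    x = word f b
  ... | false = begin
    bitwise W _∧_ (suc b′) (2 * x) (2 * x ∸ 1) + 2 ^ (suc b ∸ l)
      ≡⟨ cong₂ (λ y z → bitwise W _∧_ (suc b′) (2 * x) y + 2 ^ z) (predecessor x (label≢0⇒word>0 f b l≢0)) (+-∸-assoc 1 (label≤ f b)) ⟩
    bitwise W _∧_ (suc b′) (bit W false + 2 * x) (bit W true + 2 * (x ∸ 1)) + 2 ^ suc (b ∸ l)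
      ≡⟨ cong (_+ 2 ^ suc (b ∸ l)) (and-bits b′ false true x (x ∸ 1)) ⟩
    2 * bitwise W _∧_ b′ x (x ∸ 1) + 2 * 2 ^ (b ∸ l)
      ≡⟨ sym (*-distribˡ-+ 2 (bitwise W _∧_ b′ x (x ∸ 1)) _) ⟩
    2 * (bitwise W _∧_ b′ x (x ∸ 1) + 2 ^ (b ∸ l))
      ≡⟨ cong (2 *_) (lowest-bit f b l≢0 b≤ (*-cancelˡ-< 2 x (2 ^ b′) w<)) ⟩
    2 * x ∎
    where
    open ≡-Reasoning
    x = word f b
    l = label f b
    predecessor : ∀ x → 0 < x → 2 * x ∸ 1 ≡ 1 + 2 * (x ∸ 1)
    predecessor (suc x) _ = +-suc x (x + 0)

-- Tournament trees

-- Node p has children 2p and 2p + 1; the leaves are Q, …, 2Q - 1.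
IsTournament : (ℕ → ℕ) → ℕ → Set
IsTournament v Q = ∀ p → 1 ≤ p → p < Q → v p ≡ v (2 * p) ⊔ v (2 * p + 1)

child : ∀ p → p ≡ 2 * (p / 2) ⊎ p ≡ 2 * (p / 2) + 1
child p with p % 2 | m≡m%n+[m/n]*n p 2 | m%n<n p 2
... | zero        | p≡ | _ = inj₁ (trans p≡ (*-comm (p / 2) 2))
... | suc zero    | p≡ | _ = inj₂ (trans p≡ (trans (+-comm 1 _) (cong (_+ 1) (*-comm (p / 2) 2))))
... | suc (suc _) | _  | s≤s (s≤s ())

2*≤⇒≤/2 : ∀ {a p} → 2 * a ≤ p → a ≤ p / 2
2*≤⇒≤/2 {a} {p} h = subst (_≤ p / 2) (m*n/n≡m a 2) (/-monoˡ-≤ 2 (subst (_≤ p) (*-comm 2 a) h))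

<2*⇒/2< : ∀ {p Q} → p < 2 * Q → p / 2 < Q
<2*⇒/2< {p} {Q} h = m<n*o⇒m/o<n (subst (p <_) (*-comm 2 Q) h)

module _ {v Q} (tournament : IsTournament v Q) where

  ≤root : ∀ p → 1 ≤ p → p < 2 * Q → v p ≤ v 1
  ≤root = <-rec _ climb
    where
    climb : ∀ p → (∀ {q} → q < p → 1 ≤ q → q < 2 * Q → v q ≤ v 1) → 1 ≤ p → p < 2 * Q → v p ≤ v 1
    climb p rec 1≤p p< with p ℕ.≟ 1
    ... | yes refl = ≤-refl
    ... | no p≢1 = ≤-trans up (rec (m/n<m p 2 {{ℕ.>-nonZero 1≤p}} ≤-refl) 1≤p/2 (≤-trans (<2*⇒/2< p<) (m≤m+n Q _)))
      where
      1≤p/2 : 1 ≤ p / 2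
      1≤p/2 = 2*≤⇒≤/2 (≤∧≢⇒< 1≤p (p≢1 ∘ sym))
      node = tournament (p / 2) 1≤p/2 (<2*⇒/2< p<)
      up : v p ≤ v (p / 2)
      up with child p
      ... | inj₁ p≡ = subst₂ _≤_ (cong v (sym p≡)) (sym node) (m≤m⊔n _ _)
      ... | inj₂ p≡ = subst₂ _≤_ (cong v (sym p≡)) (sym node) (m≤n⊔m (v (2 * (p / 2))) _)

  attained : ∀ p → 1 ≤ p → p < 2 * Q → ∃[ i ] (i < Q × v p ≡ v (Q + i))
  attained p 1≤p p< = go (2 * Q ∸ p) p 1≤p p< ≤-refl
    where
    go : ∀ d p → 1 ≤ p → p < 2 * Q → 2 * Q ∸ p ≤ d → ∃[ i ] (i < Q × v p ≡ v (Q + i))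
    go zero p 1≤p p< d≤ = contradiction (≤-trans (m<n⇒0<n∸m p<) d≤) (λ ())
    go (suc d) p 1≤p p< d≤ with p <? Q
    ... | no p≮Q = p ∸ Q , +-cancelˡ-< Q _ _ (subst₂ _<_ (sym (m+[n∸m]≡n (≮⇒≥ p≮Q))) (cong (Q +_) (+-identityʳ Q)) p<)
                 , cong v (sym (m+[n∸m]≡n (≮⇒≥ p≮Q)))
    ... | yes p<Q = [ left , right ]′ (⊔-sel (v (2 * p)) (v (2 * p + 1)))
      where
      node = tournament p 1≤p p<Q
      2p+1< : 2 * p + 1 < 2 * Q
      2p+1< = ≤-trans (≤-reflexive (trans (cong suc (+-comm (2 * p) 1)) (sym (*-suc 2 p)))) (*-monoʳ-≤ 2 p<Q)
      p<2p : p < 2 * p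
      p<2p = subst (p <_) (*-comm p 2) (m<m*n p 2 {{ℕ.>-nonZero 1≤p}} (s≤s (s≤s z≤n)))
      closer : ∀ {q} → p < q → 2 * Q ∸ q ≤ d
      closer {q} p<q = ≤-trans (∸-monoʳ-≤ (2 * Q) p<q)
        (≤-trans (≤-reflexive (sym (pred[m∸n]≡m∸[1+n] (2 * Q) p))) (≤-pred (≤-trans (≤-reflexive (suc-pred (2 * Q ∸ p) {{ℕ.>-nonZero (m<n⇒0<n∸m p<)}})) d≤)))
      left : v (2 * p) ⊔ v (2 * p + 1) ≡ v (2 * p) → _
      left m≡ = map₂ (map₂ (trans (trans node m≡)))
        (go d (2 * p) (≤-trans 1≤p (<⇒≤ p<2p)) (≤-<-trans (m≤m+n (2 * p) 1) 2p+1<) (closer p<2p))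
      right : v (2 * p) ⊔ v (2 * p + 1) ≡ v (2 * p + 1) → _
      right m≡ = map₂ (map₂ (trans (trans node m≡)))
        (go d (2 * p + 1) (≤-trans 1≤p (<⇒≤ (<-≤-trans p<2p (m≤m+n (2 * p) 1)))) 2p+1< (closer (<-≤-trans p<2p (m≤m+n (2 * p) 1))))

-- Doubly linked lists

-- The list hangs off the sentinel 0: a ∷ xs are successive along nx, and the
-- last of them points to 0.
data Chain (nx pv : ℕ → ℕ) : ℕ → List ℕ → Set where
  nil  : ∀ {a} → nx a ≡ 0 → pv 0 ≡ a → Chain nx pv a []
  cons : ∀ {a x xs} → nx a ≡ x → pv x ≡ a → Chain nx pv x xs → Chain nx pv a (x ∷ xs)

chain-cong : ∀ {nx pv nx′ pv′ a xs} → (∀ {b} → b ∈ˡ a ∷ xs → nx′ b ≡ nx b) → (∀ {b} → b ∈ˡ 0 ∷ xs → pv′ b ≡ pv b) →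
  Chain nx pv a xs → Chain nx′ pv′ a xs
chain-cong nx≡ pv≡ (nil h t)     = nil (trans (nx≡ (here refl)) h) (trans (pv≡ (here refl)) t)
chain-cong nx≡ pv≡ (cons h t ch) = cons (trans (nx≡ (here refl)) h) (trans (pv≡ (there (here refl))) t)
  (chain-cong (nx≡ ∘ there) (λ { (here p) → pv≡ (here p) ; (there p) → pv≡ (there (there p)) }) ch)

last∈ : ∀ {nx pv a xs} → Chain nx pv a xs → pv 0 ∈ˡ a ∷ xs
last∈ (nil _ t)     = here t
last∈ (cons _ _ ch) = there (last∈ ch)

next∈ : ∀ {nx pv a c xs} → Chain nx pv a xs → c ∈ˡ a ∷ xs → nx c ∈ˡ 0 ∷ xs
next∈ (nil h t)     (here refl) = here h
next∈ (cons h t ch) (here refl) = there (here h)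
next∈ (cons h t ch) (there c∈) with next∈ ch c∈
... | here p  = here p
... | there p = there (there p)

prev∈ : ∀ {nx pv a c xs} → Chain nx pv a xs → c ∈ˡ xs → pv c ∈ˡ a ∷ xs
prev∈ (cons h t ch) (here refl) = here t
prev∈ (cons h t ch) (there c∈)  = there (prev∈ ch c∈)

chain-append : ∀ {nx pv a c xs} → Chain nx pv a xs → Unique (a ∷ xs) → ¬ 0 ∈ˡ xs → ¬ c ∈ˡ a ∷ xs → c ≢ 0 →
  Chain (nx [ pv 0 ↦ c ] [ c ↦ 0 ]) (pv [ c ↦ pv 0 ] [ 0 ↦ c ]) a (xs ++ c ∷ [])
chain-append {nx} {pv} {a} {c} (nil h refl) _ _ c∉ c≢0 = cons
  (trans (↦-other (nx [ a ↦ c ]) 0 (λ c≡ → c∉ (here c≡))) (↦-same nx a c))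
  (trans (↦-other (pv [ c ↦ a ]) c (c≢0 ∘ sym)) (↦-same pv c a))
  (nil (↦-same (nx [ a ↦ c ]) c 0) (↦-same (pv [ c ↦ a ]) 0 c))
chain-append {nx} {pv} {a} {c} {x ∷ xs} (cons h t ch) (a∉ ∷ uniq) 0∉ c∉ c≢0 = cons
  (trans (↦-other (nx [ pv 0 ↦ c ]) 0 (λ c≡ → c∉ (here c≡)))
    (trans (↦-other nx c (λ p≡ → All.lookup a∉ (last∈ ch) (sym p≡))) h))
  (trans (↦-other (pv [ c ↦ pv 0 ]) c (λ 0≡x → 0∉ (here 0≡x))) (trans (↦-other pv (pv 0) (λ c≡ → c∉ (there (here c≡)))) t))
  (chain-append ch uniq (0∉ ∘ there) (c∉ ∘ there) c≢0)

remove : ℕ → List ℕ → List ℕ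
remove c []       = []
remove c (x ∷ xs) = if x ≡ᵇ c then xs else x ∷ remove c xs

remove-⊆ : ∀ {c} xs {b} → b ∈ˡ remove c xs → b ∈ˡ xs
remove-⊆ {c} (x ∷ xs) b∈ with x ≡ᵇ c
remove-⊆ {c} (x ∷ xs) b∈          | true  = there b∈
remove-⊆ {c} (x ∷ xs) (here b≡)   | false = here b≡
remove-⊆ {c} (x ∷ xs) (there b∈)  | false = there (remove-⊆ xs b∈)

∈-remove : ∀ {c xs b} → b ≢ c → b ∈ˡ xs → b ∈ˡ remove c xs
∈-remove {c} {x ∷ xs} b≢c b∈ with x ≡ᵇ c in p≡
∈-remove {c} {x ∷ xs} b≢c (here refl) | true  = contradiction (≡ᵇ⇒≡ x c (subst T (sym p≡) tt)) b≢c
∈-remove {c} {x ∷ xs} b≢c (there b∈)  | true  = b∈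
∈-remove {c} {x ∷ xs} b≢c (here b≡)   | false = here b≡
∈-remove {c} {x ∷ xs} b≢c (there b∈)  | false = there (∈-remove b≢c b∈)

remove-AllPairs : ∀ {c} {R : ℕ → ℕ → Set} {xs} → AllPairs R xs → AllPairs R (remove c xs)
remove-AllPairs [] = []
remove-AllPairs {c} (_∷_ {x} x∼ ps) with x ≡ᵇ c
... | true  = ps
... | false = All.tabulate (λ b∈ → All.lookup x∼ (remove-⊆ _ b∈)) ∷ remove-AllPairs ps

∉-remove : ∀ {xs c} → Unique xs → ¬ c ∈ˡ remove c xs
∉-remove {x ∷ xs} {c} (x∉ ∷ uniq) c∈ with x ≡ᵇ c in p≡
∉-remove {x ∷ xs} {c} (x∉ ∷ uniq) c∈          | true  = All.lookup x∉ c∈ (≡ᵇ⇒≡ x c (subst T (sym p≡) tt))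
∉-remove {x ∷ xs} {c} (x∉ ∷ uniq) (here refl) | false = subst T p≡ (≡⇒≡ᵇ x x refl)
∉-remove {x ∷ xs} {c} (x∉ ∷ uniq) (there c∈)  | false = ∉-remove uniq c∈

chain-remove : ∀ {nx pv a c xs} → Chain nx pv a xs → Unique (a ∷ xs) → ¬ 0 ∈ˡ xs → c ∈ˡ xs →
  Chain (nx [ pv c ↦ nx c ]) (pv [ nx c ↦ pv c ]) a (remove c xs)
chain-remove {nx} {pv} {a} {c} {x ∷ xs} (cons h t ch) (a∉ ∷ x∉ ∷ uniq) 0∉ c∈ with x ℕ.≟ c
chain-remove {nx} {pv} {a} {_} {x ∷ []} (cons h refl (nil h′ t′)) _ _ _ | yes refl rewrite ≡ᵇ-refl x =
  nil (trans (↦-same nx (pv x) (nx x)) h′) (trans (cong (pv [ nx x ↦ pv x ]) (sym h′)) (↦-same pv (nx x) (pv x)))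
chain-remove {nx} {pv} {a} {_} {x ∷ y ∷ xs} (cons h refl (cons refl t′ ch)) ((_ ∷ a∉) ∷ x∉ ∷ y∉ ∷ uniq) 0∉ c∈ | yes refl
  rewrite ≡ᵇ-refl x = cons (↦-same nx (pv x) (nx x)) (↦-same pv (nx x) (pv x))
    (chain-cong (λ b∈ → ↦-other nx (nx x) (All.lookup a∉ b∈))
                (λ { (here refl) → ↦-other pv (pv x) (λ y≡ → 0∉ (there (here (sym y≡))))
                   ; (there b∈)  → ↦-other pv (pv x) (All.lookup y∉ b∈) }) ch)
chain-remove {c = c} (cons h t ch) _ 0∉ (here refl) | no x≢c = contradiction refl x≢c
chain-remove {nx} {pv} {a} {c} {x ∷ xs} (cons h t ch) (a∉ ∷ x∉ ∷ uniq) 0∉ (there c∈) | no x≢c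
  rewrite ≢⇒≡ᵇ-false x≢c = cons
    (trans (↦-other nx (nx c) (λ p≡ → All.lookup a∉ (prev∈ ch c∈) (sym p≡))) h)
    (trans (↦-other pv (pv c) (λ p≡ → case next∈ ch (there c∈) of λ
      { (here n≡)  → 0∉ (here (trans (sym n≡) p≡))
      ; (there n∈) → All.lookup x∉ n∈ (sym p≡) })) t)
    (chain-remove ch (x∉ ∷ uniq) (0∉ ∘ there) c∈)

log₂-half : ∀ p → 2 ≤ p → suc ⌊log₂ (p / 2) ⌋ ≤ ⌊log₂ p ⌋
log₂-half p 2≤p = begin
  suc ⌊log₂ (p / 2) ⌋    ≡⟨ sym (⌊log₂[2*b]⌋≡1+⌊log₂b⌋ (p / 2) {{ℕ.>-nonZero (2*≤⇒≤/2 {1} 2≤p)}}) ⟩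
  ⌊log₂ (2 * (p / 2)) ⌋  ≤⟨ ⌊log₂⌋-mono-≤ (≤-trans (≤-reflexive (*-comm 2 (p / 2))) (m/n*n≤m p 2)) ⟩
  ⌊log₂ p ⌋              ∎ where open ≤-Reasoning

half≡ : ∀ {a q} → a ≡ 2 * q ⊎ a ≡ 2 * q + 1 → a / 2 ≡ q
half≡ {a} {q} (inj₁ refl) = trans (cong (_/ 2) (*-comm 2 q)) (m*n/n≡m q 2)
half≡ {a} {q} (inj₂ refl) = trans (cong (_/ 2) (trans (+-comm _ 1) (cong suc (*-comm 2 q))))
  (trans (+-distrib-/-∣ʳ 1 {q * 2} {2} (divides q refl)) (m*n/n≡m q 2))

upd-row : ∀ κ t u c x c′ → upd κ t u c x t u c′ ≡ (κ t u [ c ↦ x ]) c′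
upd-row κ t u c x c′ rewrite ≡ᵇ-refl t | ≡ᵇ-refl u = refl

-- Cells: tag 0 holds the output and the input list (in row 0); in row u of
-- the other tags, 1 and 2 are the links of the list of labels j + 1 of the
-- initial edges at u, 3 the neighbour along the edge of a given label, 4 the
-- words of the set of classes inserted later, 5 the tournament tree on these
-- words, 6 the position (plus 1) of a given power of two in a word, and 7
-- whether a label was ever inserted by an update.

walkBody walk refresh toggle locate insertClass unlink deleteClass append : Co

walkBody =
  9 ≔ᵣ op div (r 9) (# 2) ⍮
  write 5 (r 6) (r 9) (max (cell 5 (r 6) (op mul (# 2) (r 9))) (cell 5 (r 6) (op add (op mul (# 2) (r 9)) (# 1))))

walk = loop (op lt (# 1) (r 9)) walkBody

-- x ∸ (x and (x ∸ 1)) is the lowest set bit of x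
refresh =
  13 ≔ᵣ cell 4 (r 6) (r 7) ⍮
  9 ≔ᵣ op add (r 12) (r 7) ⍮
  branch (r 13)
    (write 5 (r 6) (r 9)
      (op add (op mul (r 7) (r 10)) (cell 6 (r 6) (op sub (r 13) (op and (r 13) (op sub (r 13) (# 1)))))))
    (write 5 (r 6) (r 9) (# 0))

toggle = refresh ⍮ walk

locate =
  7 ≔ᵣ op div (r 0) (r 10) ⍮
  8 ≔ᵣ op shl (# 1) (op sub (r 10) (op add (op mod (r 0) (r 10)) (# 1)))

insertClass =
  (locate ⍮
   write 6 (r 6) (r 8) (op add (op mod (r 0) (r 10)) (# 1)) ⍮
   write 7 (r 6) (r 3) (# 1) ⍮
   write 4 (r 6) (r 7) (op add (cell 4 (r 6) (r 7)) (r 8))) ⍮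
  toggle

unlink =
  4 ≔ᵣ cell 2 (r 6) (r 3) ⍮
  5 ≔ᵣ cell 1 (r 6) (r 3) ⍮
  write 1 (r 6) (r 4) (r 5) ⍮
  write 2 (r 6) (r 5) (r 4)

deleteClass =
  branch (cell 7 (r 6) (r 3))
    ((locate ⍮ write 4 (r 6) (r 7) (op sub (cell 4 (r 6) (r 7)) (r 8))) ⍮ toggle)
    unlink

append =
  7 ≔ᵣ cell 2 (r 6) (# 0) ⍮
  write 1 (r 6) (r 7) (r 3) ⍮
  write 1 (r 6) (r 3) (# 0) ⍮
  write 2 (r 6) (r 3) (r 7) ⍮
  write 2 (r 6) (# 0) (r 3)

record Sizes (W Z B Q k : ℕ) : Set where
  field
    8≤2^W    : 8 ≤ 2 ^ W
    8ZZ≤2^W  : 8 * (Z * Z) ≤ 2 ^ W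
    Z≡2^B    : Z ≡ 2 ^ B
    B≢0      : NonZero B
    B≤W      : B ≤ W
    1≤Q      : 1 ≤ Q
    2Q+2≤Z   : 2 * Q + 2 ≤ Z
    k+3≤Z    : k + 3 ≤ Z
    B+3≤Z    : B + 3 ≤ Z
    word<Q   : ∀ {j} → j < k → _/_ j B {{B≢0}} < Q

module Machine {W Z B Q k : ℕ} (sizes : Sizes W Z B Q k) where
  open Sizes sizes
  open Programs W Z 8≤2^W 8ZZ≤2^W
  instance
    B-nonZero : NonZero B
    B-nonZero = B≢0

  2Z≤2^W : Z + Z ≤ 2 ^ W
  2Z≤2^W = begin
    Z + Z        ≡⟨ cong (Z +_) (sym (+-identityʳ Z)) ⟩
    2 * Z        ≤⟨ *-monoˡ-≤ Z {2} {8} (s≤s (s≤s z≤n)) ⟩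
    8 * Z        ≤⟨ *-monoʳ-≤ 8 (m≤m*n Z Z {{ℕ.>-nonZero (≤-trans (s≤s z≤n) (≤-trans (m≤n+m 3 k) k+3≤Z))}}) ⟩
    8 * (Z * Z)  ≤⟨ 8ZZ≤2^W ⟩
    2 ^ W        ∎ where open ≤-Reasoning

  sum<2^W : ∀ {x y} → x < Z → y < Z → x + y < 2 ^ W
  sum<2^W x< y< = <-≤-trans (+-mono-< x< y<) 2Z≤2^W

  lift< : ∀ {x} → x < Z → x < 2 ^ W
  lift< x< = <-≤-trans x< Z≤2^W

  0<Z : 0 < Z
  0<Z = ≤-trans (s≤s z≤n) (≤-trans (m≤n+m 3 k) k+3≤Z)

  1<Z : 1 < Z
  1<Z = ≤-trans (s≤s (s≤s z≤n)) (≤-trans (m≤n+m 3 k) k+3≤Z)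

  ≤k⇒<Z : ∀ {x} → x ≤ k → x < Z
  ≤k⇒<Z x≤ = ≤-trans (s≤s x≤) (≤-trans (≤-trans (≤-reflexive (+-comm 1 k)) (+-monoʳ-≤ k (s≤s z≤n))) k+3≤Z)

  <2Q⇒<Z : ∀ {p} → p < 2 * Q → p < Z
  <2Q⇒<Z p< = <-≤-trans p< (≤-trans (m≤m+n (2 * Q) 2) 2Q+2≤Z)

  file : (j u v c y z x i b p w : ℕ) → List ℕ
  file j u v c y z x i b p w = j ∷ u ∷ v ∷ c ∷ y ∷ z ∷ x ∷ i ∷ b ∷ p ∷ B ∷ Z ∷ Q ∷ w ∷ []

  Cells : Set
  Cells = ℕ → ℕ → ℕ → ℕ

  record Walked (κ κ′ : Cells) (x : ℕ) : Set where
    field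
      leaves≡    : ∀ {p} → Q ≤ p → κ′ 5 x p ≡ κ 5 x p
      elsewhere≡ : ∀ {t x′ p} → ¬ (5 ≡ t × x ≡ x′) → κ′ t x′ p ≡ κ t x′ p
      tournament : IsTournament (κ′ 5 x) Q
      small      : ∀ p → κ′ 5 x p ≤ k

  walkTime : ℕ → ℕ
  walkTime d = d * suc (sizeᵉ (op lt (# 1) (r 9)) + cost walkBody) + suc (sizeᵉ (op lt (# 1) (r 9)))

  module _ {j u v c y z x i b w : ℕ} (x<Z : x < Z) where

    walk-rule : ∀ d {p κ} → ⌊log₂ p ⌋ ≤ d → 1 ≤ p → p < 2 * Q → (∀ p → κ 5 x p ≤ k) →
      (∀ q → 1 ≤ q → q < Q → q ≢ p / 2 → κ 5 x q ≡ κ 5 x (2 * q) ⊔ κ 5 x (2 * q + 1)) →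
      [ ⟪ file j u v c y z x i b p w ∣ κ ⟫ ] walk
        [ walkTime d , (λ σ → ∃[ p′ ] ∃[ κ′ ] (σ ≡ ⟪ file j u v c y z x i b p′ w ∣ κ′ ⟫ × Walked κ κ′ x)) ]
    walk-rule d {suc zero} {κ} _ _ p< small nodes =
      weaken {p = walk} (m≤n+m _ (d * _)) (λ _ q → q)
        (loop-stop {e = op lt (# 1) (r 9)} {walkBody} _ refl (1 , κ , refl , record
          { leaves≡ = λ _ → refl ; elsewhere≡ = λ _ → refl ; small = small
          ; tournament = λ q 1≤q q< → nodes q 1≤q q< (λ q≡0 → contradiction (subst (1 ≤_) q≡0 1≤q) λ ()) }))
    walk-rule zero {p@(suc (suc _))} log≤ = contradiction (≤-trans (log₂-half p (s≤s (s≤s z≤n))) log≤) (λ ())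
    walk-rule (suc d) {p@(suc (suc _))} {κ} log≤ 1≤p p< small nodes =
      weaken {p = walk} (≤-reflexive (cong suc (trans (+-assoc body (d * suc body) _) (+-assoc (sizeᵉ (op lt (# 1) (r 9))) (cost walkBody) _)))) (λ _ q → q)
        (loop-step {e = op lt (# 1) (r 9)} {walkBody} {Q = _≡ ⟪ file j u v c y z x i b a w ∣ κ₁ ⟫} _ (λ ())
          (wp-sound walkBody (_ , (refl , _) , (_ , (_ , x<Z) , (_ , <2Q⇒<Z (≤-<-trans (m≤m+n a _) 2a<)))
            , (((_ , (_ , x<Z) , (((_ , _) , lift< (<2Q⇒<Z 2a<)) , <2Q⇒<Z 2a<)) , ≤k⇒<Z (small (2 * a)))
            , ((_ , (_ , x<Z) , ((((_ , _) , lift< (<2Q⇒<Z 2a<)) , _) , lift< (<2Q⇒<Z 2a+1<)) , <2Q⇒<Z 2a+1<) , ≤k⇒<Z (small (2 * a + 1))))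
            , refl))
          λ { _ refl → weaken {p = walk} ≤-refl combine
                (walk-rule d {a} (≤-pred (≤-trans (log₂-half p 2≤p) log≤)) 1≤a
                  (≤-<-trans (m≤m+n a _) 2a<) small₁ nodes₁) })
      where
      body = sizeᵉ (op lt (# 1) (r 9)) + cost walkBody
      a = p / 2
      2≤p : 2 ≤ p
      2≤p = s≤s (s≤s z≤n)
      m = κ 5 x (2 * a) ⊔ κ 5 x (2 * a + 1)
      κ₁ = upd κ 5 x a m
      1≤a : 1 ≤ a
      1≤a = 2*≤⇒≤/2 {1} 2≤p
      a<Q : a < Q
      a<Q = <2*⇒/2< p<
      2a+1< : 2 * a + 1 < 2 * Q
      2a+1< = ≤-trans (≤-reflexive (trans (cong suc (+-comm (2 * a) 1)) (sym (*-suc 2 a)))) (*-monoʳ-≤ 2 a<Q)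
      2a< : 2 * a < 2 * Q
      2a< = *-monoʳ-< 2 a<Q
      row : ∀ q → κ₁ 5 x q ≡ (κ 5 x [ a ↦ m ]) q
      row = upd-row κ 5 x a m
      at : κ₁ 5 x a ≡ m
      at = trans (row a) (↦-same (κ 5 x) a m)
      off : ∀ {q} → a ≢ q → κ₁ 5 x q ≡ κ 5 x q
      off {q} a≢q = trans (row q) (↦-other (κ 5 x) m a≢q)
      small₁ : ∀ q → κ₁ 5 x q ≤ k
      small₁ q with a ℕ.≟ q
      ... | yes refl = subst (_≤ k) (sym at) (⊔-lub (small (2 * a)) (small (2 * a + 1)))
      ... | no a≢q   = subst (_≤ k) (sym (off a≢q)) (small q)
      a≢2a : a ≢ 2 * a
      a≢2a = <⇒≢ (subst (a <_) (*-comm a 2) (m<m*n a 2 {{ℕ.>-nonZero 1≤a}} (s≤s (s≤s z≤n))))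
      a≢2a+1 : a ≢ 2 * a + 1
      a≢2a+1 = <⇒≢ (subst (a <_) (+-comm 1 (2 * a)) (s≤s (m≤m+n a _)))
      nodes₁ : ∀ q → 1 ≤ q → q < Q → q ≢ a / 2 → κ₁ 5 x q ≡ κ₁ 5 x (2 * q) ⊔ κ₁ 5 x (2 * q + 1)
      nodes₁ q 1≤q q< q≢ with a ℕ.≟ q
      ... | yes refl = trans at (sym (cong₂ _⊔_ (off a≢2a) (off a≢2a+1)))
      ... | no a≢q   = trans (off a≢q) (trans (nodes q 1≤q q< (a≢q ∘ sym)) (sym (cong₂ _⊔_
        (off (λ a≡ → q≢ (sym (half≡ (inj₁ a≡))))) (off (λ a≡ → q≢ (sym (half≡ (inj₂ a≡))))))))
      combine : ∀ σ → ∃[ p′ ] ∃[ κ′ ] (σ ≡ ⟪ file j u v c y z x i b p′ w ∣ κ′ ⟫ × Walked κ₁ κ′ x) →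
                ∃[ p′ ] ∃[ κ′ ] (σ ≡ ⟪ file j u v c y z x i b p′ w ∣ κ′ ⟫ × Walked κ κ′ x)
      combine _ (p′ , κ′ , refl , walked) = p′ , κ′ , refl , record
        { leaves≡    = λ Q≤ → trans (Walked.leaves≡ walked Q≤) (off (<⇒≢ (<-≤-trans a<Q Q≤)))
        ; elsewhere≡ = λ ne → trans (Walked.elsewhere≡ walked ne) (upd-other κ {5} {x} {a} m λ (t≡ , x≡ , _) → ne (t≡ , x≡))
        ; tournament = Walked.tournament walked
        ; small      = Walked.small walked }

assign : (ℕ → Bool) → ℕ → Bool → ℕ → Bool
assign D j v m = if j ≡ᵇ m then v else D m

assign-same : ∀ D j v → assign D j v j ≡ v
assign-same D j v rewrite ≡ᵇ-refl j = refl

assign-other : ∀ D {j m} v → j ≢ m → assign D j v m ≡ D m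
assign-other D v j≢m rewrite ≢⇒≡ᵇ-false j≢m = refl

2^-injective : ∀ {a b} → 2 ^ a ≡ 2 ^ b → a ≡ b
2^-injective {a} {b} p≡ with <-cmp a b
... | tri< a<b _ _ = contradiction p≡ (<⇒≢ (^-monoʳ-< 2 ≤-refl a<b))
... | tri≈ _ a≡b _ = a≡b
... | tri> _ _ b<a = contradiction (sym p≡) (<⇒≢ (^-monoʳ-< 2 ≤-refl b<a))

module Vertex {W Z B Q k : ℕ} (sizes : Sizes W Z B Q k) where
  open Sizes sizes
  open Programs W Z 8≤2^W 8ZZ≤2^W
  open Machine sizes

  wordAt : (ℕ → Bool) → ℕ → ℕ
  wordAt D i = word (λ q → D (i * B + q)) B

  labelAt : (ℕ → Bool) → ℕ → ℕ
  labelAt D i = label (λ q → D (i * B + q)) B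

  leafAt : (ℕ → Bool) → ℕ → ℕ
  leafAt D i = if labelAt D i ≡ᵇ 0 then 0 else i * B + labelAt D i

  bitAt : ℕ → ℕ
  bitAt j = 2 ^ (B ∸ suc (j % B))

  position : ∀ j → j ≡ j / B * B + j % B
  position j = trans (m≡m%n+[m/n]*n j B) (+-comm (j % B) _)

  position-unique : ∀ {i q j} → q < B → i * B + q ≡ j → i ≡ j / B × q ≡ j % B
  position-unique {j = j} q< p≡ = mixed-injective q< (m%n<n j B) (trans p≡ (position j))

  module _ {D D′ : ℕ → Bool} {j : ℕ} (agree : ∀ m → m ≢ j → D m ≡ D′ m) where

    elsewhere : ∀ {i} → i ≢ j / B → ∀ q → q < B → D (i * B + q) ≡ D′ (i * B + q)
    elsewhere i≢ q q< = agree _ (λ p≡ → i≢ (proj₁ (position-unique q< p≡)))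

    wordAt-other : ∀ {i} → i ≢ j / B → wordAt D i ≡ wordAt D′ i
    wordAt-other i≢ = word-cong B (elsewhere i≢)

    leafAt-other : ∀ {i} → i ≢ j / B → leafAt D i ≡ leafAt D′ i
    leafAt-other {i} i≢ = cong (λ l → if l ≡ᵇ 0 then 0 else i * B + l) (label-cong B (elsewhere i≢))

    wordAt-set : D j ≡ false → D′ j ≡ true → wordAt D′ (j / B) ≡ wordAt D (j / B) + bitAt j
    wordAt-set Dj D′j = word-set B (m%n<n j B) (trans (cong D (sym (position j))) Dj) (trans (cong D′ (sym (position j))) D′j)
      (λ q q≢ → agree _ (λ p≡ → q≢ (+-cancelˡ-≡ (j / B * B) _ _ (trans p≡ (position j)))))

  record HoldsTree (κ : Cells) (x : ℕ) (D : ℕ → Bool) : Set where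
    field
      bounded    : ∀ {j} → D j ≡ true → j < k
      words≡     : ∀ i → κ 4 x i ≡ wordAt D i
      table      : ∀ {j} → D j ≡ true → κ 6 x (bitAt j) ≡ suc (j % B)
      leaves     : ∀ {i} → i < Q → κ 5 x (Q + i) ≡ leafAt D i
      tournament : IsTournament (κ 5 x) Q
      small      : ∀ p → κ 5 x p ≤ k

  module _ {D : ℕ → Bool} (bounded : ∀ {j : ℕ} → D j ≡ true → j < k) where

    leafAt-cases : ∀ i → (leafAt D i ≡ 0 × labelAt D i ≡ 0)
      ⊎ ∃[ j ] (leafAt D i ≡ suc j × D j ≡ true × i ≡ j / B × labelAt D i ≡ suc (j % B))
    leafAt-cases i with labelAt D i in p≡
    ... | zero  = inj₁ (refl , refl)
    ... | suc q = let Dj , q< = label-sound (λ q → D (i * B + q)) B p≡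
                      i≡ , q≡ = position-unique q< refl
                  in inj₂ (i * B + q , +-suc (i * B) q , Dj , i≡ , cong suc q≡)

    leafAt≤k : ∀ i → leafAt D i ≤ k
    leafAt≤k i with leafAt-cases i
    ... | inj₁ (l≡ , _)          = subst (_≤ k) (sym l≡) z≤n
    ... | inj₂ (j , l≡ , Dj , _) = subst (_≤ k) (sym l≡) (bounded Dj)

    ≤leafAt : ∀ {j} → D j ≡ true → suc j ≤ leafAt D (j / B)
    ≤leafAt {j} Dj with labelAt D (j / B) | label-complete (λ q → D (j / B * B + q)) B (trans (cong D (sym (position j))) Dj) (m%n<n j B)
    ... | suc l | q<l = ≤-trans (s≤s (≤-reflexive (position j)))
                          (≤-trans (≤-reflexive (sym (+-suc (j / B * B) (j % B)))) (+-monoʳ-≤ (j / B * B) q<l))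

    tree-root : ∀ {κ x} → HoldsTree κ x D → (κ 5 x 1 ≡ 0 ⊎ ∃[ j ] (κ 5 x 1 ≡ suc j × D j ≡ true))
    tree-root {κ} {x} h with attained (HoldsTree.tournament h) 1 ≤-refl (*-monoʳ-≤ 2 1≤Q)
    ... | i , i< , p≡ with leafAt-cases i
    ...   | inj₁ (l≡ , _) = inj₁ (trans p≡ (trans (HoldsTree.leaves h i<) l≡))
    ...   | inj₂ (j , l≡ , Dj , _) = inj₂ (j , trans p≡ (trans (HoldsTree.leaves h i<) l≡) , Dj)

    ≤tree-root : ∀ {κ x} → HoldsTree κ x D → ∀ {j} → D j ≡ true → suc j ≤ κ 5 x 1
    ≤tree-root {κ} {x} h {j} Dj = begin
      suc j               ≤⟨ ≤leafAt Dj ⟩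
      leafAt D (j / B)    ≡⟨ sym (HoldsTree.leaves h i<) ⟩
      κ 5 x (Q + j / B)   ≤⟨ ≤root (HoldsTree.tournament h) (Q + j / B) (≤-trans 1≤Q (m≤m+n Q _)) (<-≤-trans (+-monoʳ-< Q i<) (≤-reflexive (cong (Q +_) (sym (+-identityʳ Q))))) ⟩
      κ 5 x 1             ∎
      where
      open ≤-Reasoning
      i< = word<Q (bounded Dj)

  record Unfinished (κ : Cells) (x : ℕ) (D : ℕ → Bool) (i : ℕ) : Set where
    field
      bounded    : ∀ {j} → D j ≡ true → j < k
      words≡     : ∀ i → κ 4 x i ≡ wordAt D i
      table      : ∀ {j} → D j ≡ true → κ 6 x (bitAt j) ≡ suc (j % B)
      leaves     : ∀ {i′} → i′ < Q → i′ ≢ i → κ 5 x (Q + i′) ≡ leafAt D i′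
      tournament : IsTournament (κ 5 x) Q
      small      : ∀ p → κ 5 x p ≤ k

  i<Z : ∀ {i} → i < Q → i < Z
  i<Z i< = <2Q⇒<Z (<-≤-trans i< (m≤m+n Q _))

  Q+i<2Q : ∀ {i} → i < Q → Q + i < 2 * Q
  Q+i<2Q {i} i< = <-≤-trans (+-monoʳ-< Q i<) (≤-reflexive (cong (Q +_) (sym (+-identityʳ Q))))

  word<Z : ∀ D i → wordAt D i < Z
  word<Z D i = subst (wordAt D i <_) (sym Z≡2^B) (word<2^ (λ q → D (i * B + q)) B)

  lowest : ℕ → ℕ
  lowest w = w ∸ applyOp W and w (w ∸ 1)

  lowest-wordAt : ∀ D i → labelAt D i ≢ 0 →
    applyOp W and (wordAt D i) (wordAt D i ∸ 1) ≤ wordAt D i × lowest (wordAt D i) ≡ 2 ^ (B ∸ labelAt D i)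
  lowest-wordAt D i l≢0 = subst (bits ≤_) split (m≤m+n bits _)
                        , trans (cong (_∸ bits) (sym split)) (m+n∸m≡n bits _)
    where
    bits = applyOp W and (wordAt D i) (wordAt D i ∸ 1)
    split : bits + 2 ^ (B ∸ labelAt D i) ≡ wordAt D i
    split = lowest-bit W (λ q → D (i * B + q)) B l≢0 B≤W (lift< (word<Z D i))

  refresh-rule : ∀ {j u v c y z x i b p w κ D} → x < Z → i < Q → Unfinished κ x D i →
    [ ⟪ file j u v c y z x i b p w ∣ κ ⟫ ] refresh
      [ cost refresh , (λ σ → ∃[ l ] ∃[ w′ ] (σ ≡ ⟪ file j u v c y z x i b (Q + i) w′ ∣ upd κ 5 x (Q + i) l ⟫ × l ≡ leafAt D i)) ]
  refresh-rule {x = x} {i} {κ = κ} {D} x< i< h = wp-sound refresh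
    ( (_ , (_ , x<) , (_ , i<Z i<)) , (refl , _)
    , ((_ , _) , lift< (<2Q⇒<Z (Q+i<2Q i<))) , (refl , _)
    , _
    , (λ w≢0 → nonempty w≢0)
    , (λ w≡0 → (_ , (_ , x<) , (_ , <2Q⇒<Z (Q+i<2Q i<))) , _ , 0 , κ 4 x i , refl , empty w≡0) )
    where
    open Unfinished h
    w≡ : κ 4 x i ≡ wordAt D i
    w≡ = words≡ i
    empty : κ 4 x i ≡ 0 → 0 ≡ leafAt D i
    empty w≡0 with leafAt-cases bounded i
    ... | inj₁ (l≡ , _) = sym l≡
    ... | inj₂ (_ , _ , _ , _ , l≡) = contradiction (trans (sym w≡) w≡0)
      (λ w≡0 → <⇒≢ (label≢0⇒word>0 (λ q → D (i * B + q)) B (λ l≡0 → case trans (sym l≡) l≡0 of λ ())) (sym w≡0))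
    nonempty : κ 4 x i ≢ 0 → _
    nonempty w≢0 with leafAt-cases bounded i
    ... | inj₁ (_ , l≡0) = contradiction (trans w≡ (label≡0⇒word≡0 (λ q → D (i * B + q)) B l≡0)) w≢0
    ... | inj₂ (j , leaf≡ , Dj , i≡ , l≡) =
      (_ , (_ , x<) , (_ , <2Q⇒<Z (Q+i<2Q i<)))
      , ( ( ((_ , _) , lift< (≤-<-trans (subst (i * B ≤_) sum≡ (m≤m+n (i * B) _)) value<Z))
          , (_ , (_ , x<) , (((_ , ((_ , (((_ , _) , (n≢0⇒n>0 w≢0 , w<)))) , _)) , (bits≤ , w<)) , subst (_< Z) (sym low≡) bit<Z)))
        , lift< (subst (_< Z) (sym sum≡) value<Z))
      , _ , κ 4 x i , refl , sum≡
      where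
      l≢0 : labelAt D i ≢ 0
      l≢0 l≡0 = case trans (sym l≡) l≡0 of λ ()
      w< : κ 4 x i < 2 ^ W
      w< = subst (_< 2 ^ W) (sym w≡) (lift< (word<Z D i))
      bits≤ : applyOp W and (κ 4 x i) (κ 4 x i ∸ 1) ≤ κ 4 x i
      bits≤ = subst (λ w → applyOp W and w (w ∸ 1) ≤ w) (sym w≡) (proj₁ (lowest-wordAt D i l≢0))
      low≡ : lowest (κ 4 x i) ≡ bitAt j
      low≡ = trans (cong lowest w≡) (trans (proj₂ (lowest-wordAt D i l≢0)) (cong (λ l → 2 ^ (B ∸ l)) l≡))
      bit<Z : bitAt j < Z
      bit<Z = subst (bitAt j <_) (sym Z≡2^B) (^-monoʳ-< 2 ≤-refl (∸-monoʳ-< {B} {suc (j % B)} {0} (s≤s z≤n) (m%n<n j B)))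
      value<Z : leafAt D i < Z
      value<Z = ≤k⇒<Z (leafAt≤k bounded i)
      sum≡ : i * B + κ 6 x (lowest (κ 4 x i)) ≡ leafAt D i
      sum≡ = begin
        i * B + κ 6 x (lowest (κ 4 x i))  ≡⟨ cong (λ a → i * B + κ 6 x a) low≡ ⟩
        i * B + κ 6 x (bitAt j)           ≡⟨ cong (i * B +_) (table Dj) ⟩
        i * B + suc (j % B)               ≡⟨ +-suc (i * B) (j % B) ⟩
        suc (i * B + j % B)               ≡⟨ cong (λ a → suc (a * B + j % B)) i≡ ⟩
        suc (j / B * B + j % B)           ≡⟨ cong suc (sym (position j)) ⟩
        suc j                             ≡⟨ sym leaf≡ ⟩
        leafAt D i                        ∎ where open ≡-Reasoning

module Classes {W Z B Q k : ℕ} (sizes : Sizes W Z B Q k) where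
  open Sizes sizes
  open Programs W Z 8≤2^W 8ZZ≤2^W
  open Machine sizes
  open Vertex sizes

  toggleTime : ℕ
  toggleTime = cost refresh + walkTime ⌊log₂ 2 * Q ⌋

  Toggled : Cells → ℕ → (ℕ → Bool) → (ℕ → ℕ → List ℕ) → AState → Set
  Toggled κ x D regs σ = ∃[ p ] ∃[ w ] ∃[ κ′ ] (σ ≡ ⟪ regs p w ∣ κ′ ⟫ × HoldsTree κ′ x D
    × (∀ {t x′ a} → ¬ (5 ≡ t × x ≡ x′) → κ′ t x′ a ≡ κ t x′ a))

  toggle-rule : ∀ {j u v c y z x i b p w κ D} → x < Z → i < Q → Unfinished κ x D i →
    [ ⟪ file j u v c y z x i b p w ∣ κ ⟫ ] toggle [ toggleTime , Toggled κ x D (file j u v c y z x i b) ]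
  toggle-rule {j} {u} {v} {c} {y} {z} {x} {i} {b} {p} {w} {κ} {D} x< i< h =
    seq-rule {p = refresh} {walk} (refresh-rule {w = w} x< i< h) λ where
      _ (_ , w′ , refl , refl) → weaken {p = walk} ≤-refl (finish w′)
        (walk-rule x< ⌊log₂ 2 * Q ⌋ (⌊log₂⌋-mono-≤ (<⇒≤ (Q+i<2Q i<))) (≤-trans 1≤Q (m≤m+n Q i)) (Q+i<2Q i<) small₁ nodes₁)
    where
    open Unfinished h
    l = leafAt D i
    κ₁ = upd κ 5 x (Q + i) l
    row : ∀ q → κ₁ 5 x q ≡ (κ 5 x [ Q + i ↦ l ]) q
    row = upd-row κ 5 x (Q + i) l
    at : κ₁ 5 x (Q + i) ≡ l
    at = trans (row (Q + i)) (↦-same (κ 5 x) (Q + i) l)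
    off : ∀ {q} → Q + i ≢ q → κ₁ 5 x q ≡ κ 5 x q
    off {q} ≢q = trans (row q) (↦-other (κ 5 x) l ≢q)
    small₁ : ∀ q → κ₁ 5 x q ≤ k
    small₁ q with Q + i ℕ.≟ q
    ... | yes refl = subst (_≤ k) (sym at) (leafAt≤k bounded i)
    ... | no ≢q    = subst (_≤ k) (sym (off ≢q)) (small q)
    nodes₁ : ∀ q → 1 ≤ q → q < Q → q ≢ (Q + i) / 2 → κ₁ 5 x q ≡ κ₁ 5 x (2 * q) ⊔ κ₁ 5 x (2 * q + 1)
    nodes₁ q 1≤q q< q≢ = trans (off (λ { refl → <⇒≱ q< (m≤m+n Q i) })) (trans (tournament q 1≤q q<) (sym (cong₂ _⊔_
      (off (λ p≡ → q≢ (sym (half≡ (inj₁ p≡))))) (off (λ p≡ → q≢ (sym (half≡ (inj₂ p≡))))))))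
    finish : ∀ w′ σ → ∃[ p′ ] ∃[ κ′ ] (σ ≡ ⟪ file j u v c y z x i b p′ w′ ∣ κ′ ⟫ × Walked κ₁ κ′ x) →
      Toggled κ x D (file j u v c y z x i b) σ
    finish _ _ (p′ , κ′ , refl , walked) = p′ , _ , κ′ , refl , record
      { bounded = bounded
      ; words≡  = λ i′ → trans (elsewhere≡ (λ ())) (words≡ i′)
      ; table   = λ Dj → trans (elsewhere≡ (λ ())) (table Dj)
      ; leaves  = λ {i′} i′< → trans (leaves≡ (m≤m+n Q i′)) (leaf i′ i′<)
      ; tournament = Walked.tournament walked
      ; small   = Walked.small walked
      } , λ ne → trans (elsewhere≡ ne) (upd-other κ {5} {x} {Q + i} l λ (t≡ , x≡ , _) → ne (t≡ , x≡))
      where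
      open Walked walked using (leaves≡; elsewhere≡)
      leaf : ∀ i′ → i′ < Q → κ₁ 5 x (Q + i′) ≡ leafAt D i′
      leaf i′ i′< with i′ ℕ.≟ i
      ... | yes refl = at
      ... | no i′≢i  = trans (off (λ p≡ → i′≢i (sym (+-cancelˡ-≡ Q _ _ p≡)))) (leaves i′< i′≢i)

  record Holds (κ : Cells) (x : ℕ) (S : ℕ → Set) : Set where
    field
      D        : ℕ → Bool
      xs       : List ℕ
      tree     : HoldsTree κ x D
      chain    : Chain (κ 1 x) (κ 2 x) 0 xs
      sorted   : AllPairs ℕ._>_ xs
      positive : ¬ 0 ∈ˡ xs
      flagged  : ∀ {j} → D j ≡ true → κ 7 x (suc j) ≢ 0
      listed   : ∀ {c} → c ∈ˡ xs → κ 7 x c ≡ 0 × c ≤ k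
      members  : ∀ j → S j ⇔ (D j ≡ true ⊎ suc j ∈ˡ xs)

  record Local (κ κ′ : Cells) (x : ℕ) : Set where
    field
      output≡     : ∀ x′ c → κ′ 0 x′ c ≡ κ 0 x′ c
      neighbours≡ : ∀ x′ c → κ′ 3 x′ c ≡ κ 3 x′ c
      other≡      : ∀ t {x′} c → x ≢ x′ → κ′ t x′ c ≡ κ t x′ c

  holds-cong : ∀ {κ κ′ x S} → (∀ t c → t ≢ 0 → t ≢ 3 → κ′ t x c ≡ κ t x c) → Holds κ x S → Holds κ′ x S
  holds-cong {κ} {κ′} {x} κ≡ h = record
    { D = D ; xs = xs
    ; tree = record
      { bounded    = bounded
      ; words≡     = λ i → trans (κ≡ 4 i (λ ()) (λ ())) (words≡ i)
      ; table      = λ Dj → trans (κ≡ 6 _ (λ ()) (λ ())) (table Dj)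
      ; leaves     = λ i< → trans (row₅ _) (leaves i<)
      ; tournament = λ p 1≤p p< → trans (row₅ p) (trans (tournament p 1≤p p<) (sym (cong₂ _⊔_ (row₅ _) (row₅ _))))
      ; small      = λ p → subst (_≤ k) (sym (row₅ p)) (small p)
      }
    ; chain = chain-cong (λ _ → κ≡ 1 _ (λ ()) (λ ())) (λ _ → κ≡ 2 _ (λ ()) (λ ())) chain
    ; sorted = sorted ; positive = positive
    ; flagged = λ Dj 0≡ → flagged Dj (trans (sym (κ≡ 7 _ (λ ()) (λ ()))) 0≡)
    ; listed = λ c∈ → map₁ (trans (κ≡ 7 _ (λ ()) (λ ()))) (listed c∈)
    ; members = members
    }
    where
    open Holds h
    open HoldsTree tree
    row₅ : ∀ p → κ′ 5 x p ≡ κ 5 x p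
    row₅ p = κ≡ 5 p (λ ()) (λ ())

  module _ {κ x S} (h : Holds κ x S) where
    open Holds h

    top : ℕ
    top = κ 1 x 0 ⊔ κ 5 x 1

    head-cases : κ 1 x 0 ≡ 0 ⊎ κ 1 x 0 ∈ˡ xs
    head-cases with next∈ chain (here refl)
    ... | here p  = inj₁ p
    ... | there p = inj₂ p

    ≤head : ∀ {c} → c ∈ˡ xs → c ≤ κ 1 x 0
    ≤head c∈ with xs | chain | sorted
    ≤head (here refl) | c ∷ _ | cons refl _ _ | _     = ≤-refl
    ≤head (there c∈)  | c ∷ _ | cons refl _ _ | > ∷ _ = <⇒≤ (All.lookup > c∈)

    ∈S : ∀ {c} → c ≢ 0 → c ∈ˡ xs → ∃[ j ] (c ≡ suc j × S j)
    ∈S {zero}  c≢0 _  = contradiction refl c≢0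
    ∈S {suc j} _   c∈ = j , refl , from (members j) (inj₂ c∈)

    top-attained : top ≡ 0 ⊎ ∃[ j ] (top ≡ suc j × S j)
    top-attained with ⊔-sel (κ 1 x 0) (κ 5 x 1)
    ... | inj₂ p≡ with tree-root (HoldsTree.bounded tree) tree
    ...   | inj₁ 0≡             = inj₁ (trans p≡ 0≡)
    ...   | inj₂ (j , j≡ , Dj) = inj₂ (j , trans p≡ j≡ , from (members j) (inj₁ Dj))
    top-attained | inj₁ p≡ with head-cases
    ... | inj₁ 0≡ = inj₁ (trans p≡ 0≡)
    ... | inj₂ c∈ = let j , c≡ , Sj = ∈S (λ c≡0 → positive (subst (_∈ˡ xs) c≡0 c∈)) c∈
                    in inj₂ (j , trans p≡ c≡ , Sj)

    ≤top : ∀ {j} → S j → suc j ≤ top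
    ≤top {j} Sj with to (members j) Sj
    ... | inj₁ Dj = ≤-trans (≤tree-root (HoldsTree.bounded tree) tree Dj) (m≤n⊔m (κ 1 x 0) _)
    ... | inj₂ j∈ = ≤-trans (≤head j∈) (m≤m⊔n _ (κ 5 x 1))

    head≤k : κ 1 x 0 ≤ k
    head≤k = [ (λ 0≡ → subst (_≤ k) (sym 0≡) z≤n) , (λ c∈ → proj₂ (listed c∈)) ]′ head-cases

    top≤k : top ≤ k
    top≤k = ⊔-lub head≤k (HoldsTree.small tree 1)

    members-bounded : ∀ {j} → S j → j < k
    members-bounded Sj = ≤-trans (≤top Sj) top≤k

applyOp-div : ∀ W x y .{{_ : NonZero y}} → applyOp W div x y ≡ x / y
applyOp-div W x (suc y) = refl

applyOp-mod : ∀ W x y .{{_ : NonZero y}} → applyOp W mod x y ≡ x % y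
applyOp-mod W x (suc y) = refl

module ClassUpdates {W Z B Q k : ℕ} (sizes : Sizes W Z B Q k) where
  open Sizes sizes
  open Programs W Z 8≤2^W 8ZZ≤2^W
  open Machine sizes
  open Vertex sizes
  open Classes sizes

  bitAt<Z : ∀ j → bitAt j < Z
  bitAt<Z j = subst (bitAt j <_) (sym Z≡2^B) (^-monoʳ-< 2 ≤-refl (∸-monoʳ-< {B} {suc (j % B)} {0} (s≤s z≤n) (m%n<n j B)))

  bitAt-injective : ∀ {j m} → bitAt j ≡ bitAt m → j % B ≡ m % B
  bitAt-injective {j} {m} p≡ = suc-injective (∸-cancelˡ-≡ (m%n<n j B) (m%n<n m B) (2^-injective p≡))

  digit+1 : ∀ j → applyOp W mod j B + 1 ≡ suc (j % B)
  digit+1 j = trans (+-comm _ 1) (cong suc (applyOp-mod W j B))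

  B<Z : B < Z
  B<Z = ≤-trans (≤-trans (≤-reflexive (+-comm 1 B)) (+-monoʳ-≤ B (s≤s z≤n))) B+3≤Z

  digit+1<Z : ∀ j → applyOp W mod j B + 1 < Z
  digit+1<Z j = ≤-<-trans (≤-trans (≤-reflexive (digit+1 j)) (m%n<n j B)) B<Z

  shifted : ∀ j → applyOp W shl 1 (B ∸ (applyOp W mod j B + 1)) ≡ bitAt j
  shifted j = trans (cong (λ d → truncate W (1 * 2 ^ (B ∸ d))) (digit+1 j))
    (trans (cong (truncate W) (*-identityˡ (bitAt j))) (truncate-small (lift< (bitAt<Z j))))

  digit-fits : ∀ j → applyOp W mod j B + 1 ≤ B × B < 2 ^ W
  digit-fits j = ≤-trans (≤-reflexive (digit+1 j)) (m%n<n j B) , lift< B<Z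

  module _ {j} (j<k : j < k) where

    index : applyOp W div j B ≡ j / B
    index = applyOp-div W j B

    index<Z : applyOp W div j B < Z
    index<Z = subst (_< Z) (sym index) (i<Z (word<Q j<k))

  Changed : Cells → ℕ → (ℕ → Set) → (ℕ → ℕ → ℕ → ℕ → ℕ → ℕ → List ℕ) → AState → Set
  Changed κ x S regs σ = ∃[ y ] ∃[ z ] ∃[ i ] ∃[ b ] ∃[ p ] ∃[ w ] ∃[ κ′ ]
    (σ ≡ ⟪ regs y z i b p w ∣ κ′ ⟫ × Holds κ′ x S × Local κ κ′ x)

  insertClass-rule : ∀ {j u v y z x i b p w κ S} → x < Z → j < k → Holds κ x S → ¬ S j →
    [ ⟪ file j u v (suc j) y z x i b p w ∣ κ ⟫ ] insertClass
      [ 1000 + toggleTime , Changed κ x (λ m → S m ⊎ m ≡ j) (λ y z i b p w → file j u v (suc j) y z x i b p w) ]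
  insertClass-rule {j} {u} {v} {y} {z} {x} {i₀} {b₀} {p} {w} {κ} {S} x< j<k h ¬Sj =
    weaken {p = insertClass} (+-monoˡ-≤ toggleTime (≤ᵇ⇒≤ (cost before) 1000 _)) (λ _ q → q)
      (seq-rule {p = before} {toggle}
        (wp-sound before {Q = prepared}
          ( _ , (refl , _)
          , ((_ , ((_ , (_ , lift< (digit+1<Z j))) , digit-fits j)) , _) , (refl , _)
          , (_ , (_ , x<) , (_ , b<Z)) , (_ , lift< (digit+1<Z j))
          , (_ , (_ , x<) , (_ , ≤k⇒<Z j<k)) , _
          , (_ , (_ , x<) , (_ , index<Z j<k)) , (((_ , (_ , x<) , (_ , index<Z j<k)) , _) , sum<)
          , _ , _ , _ , refl , index j<k , shifted j , digit+1 j ))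
        λ { _ (i , b , d , refl , refl , refl , refl) →
          weaken {p = toggle} ≤-refl finish (toggle-rule {i = j / B} {D = D′} x< (word<Q j<k) unfinished) })
    where
    open Holds h
    open HoldsTree tree
    D′ = assign D j true
    before = locate ⍮
      write 6 (r 6) (r 8) (op add (op mod (r 0) (r 10)) (# 1)) ⍮
      write 7 (r 6) (r 3) (# 1) ⍮
      write 4 (r 6) (r 7) (op add (cell 4 (r 6) (r 7)) (r 8))
    new : ℕ → ℕ → ℕ → Cells
    new i b d = upd (upd (upd κ 6 x b d) 7 x (suc j) 1) 4 x i (κ 4 x i + b)
    prepared : AState → Set
    prepared σ = ∃[ i ] ∃[ b ] ∃[ d ] (σ ≡ ⟪ file j u v (suc j) y z x i b p w ∣ new i b d ⟫
      × i ≡ j / B × b ≡ bitAt j × d ≡ suc (j % B))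
    κ₁ = new (j / B) (bitAt j) (suc (j % B))
    κ₆ = upd κ 6 x (bitAt j) (suc (j % B))
    κ₇ = upd κ₆ 7 x (suc j) 1
    Dj≡false : D j ≡ false
    Dj≡false with D j in p≡
    ... | false = refl
    ... | true  = contradiction (from (members j) (inj₁ p≡)) ¬Sj
    agree : ∀ m → m ≢ j → D m ≡ D′ m
    agree m m≢j = sym (assign-other D true (m≢j ∘ sym))
    D′-cases : ∀ {m} → D′ m ≡ true → m ≡ j ⊎ (m ≢ j × D m ≡ true)
    D′-cases {m} D′m with m ℕ.≟ j
    ... | yes m≡j = inj₁ m≡j
    ... | no m≢j  = inj₂ (m≢j , trans (agree m m≢j) D′m)
    b<Z : applyOp W shl 1 (B ∸ (applyOp W mod j B + 1)) < Z
    b<Z = subst (_< Z) (sym (shifted j)) (bitAt<Z j)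
    sum< : κ 4 x (applyOp W div j B) + applyOp W shl 1 (B ∸ (applyOp W mod j B + 1)) < 2 ^ W
    sum< = sum<2^W (subst (_< Z) (sym (words≡ _)) (word<Z D (applyOp W div j B))) b<Z
    unfinished : Unfinished κ₁ x D′ (j / B)
    unfinished = record
      { bounded    = λ D′m → case D′-cases D′m of λ { (inj₁ refl) → j<k ; (inj₂ (_ , Dm)) → bounded Dm }
      ; words≡     = words′
      ; table      = λ D′m → table′ (D′-cases D′m)
      ; leaves     = λ i′< i′≢ → trans (leaves i′<) (leafAt-other agree i′≢)
      ; tournament = tournament
      ; small      = small
      }
      where
      words′ : ∀ i → κ₁ 4 x i ≡ wordAt D′ i
      words′ i with j / B ℕ.≟ i
      ... | yes refl = trans (upd-row κ 4 x (j / B) _ (j / B)) (trans (↦-same (κ 4 x) (j / B) _)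
                         (trans (cong (_+ bitAt j) (words≡ (j / B))) (sym (wordAt-set agree Dj≡false (assign-same D j true)))))
      ... | no ≢i    = trans (upd-row κ 4 x (j / B) _ i) (trans (↦-other (κ 4 x) _ ≢i)
                         (trans (words≡ i) (wordAt-other agree (≢i ∘ sym))))
      table′ : ∀ {m} → m ≡ j ⊎ (m ≢ j × D m ≡ true) → κ₁ 6 x (bitAt m) ≡ suc (m % B)
      table′ (inj₁ refl) = trans (upd-row κ 6 x (bitAt j) _ _) (↦-same (κ 6 x) (bitAt j) _)
      table′ {m} (inj₂ (_ , Dm)) with bitAt j ℕ.≟ bitAt m
      ... | yes p≡ = trans (upd-row κ 6 x (bitAt j) _ _) (trans (cong (κ 6 x [ bitAt j ↦ suc (j % B) ]) (sym p≡))
                       (trans (↦-same (κ 6 x) (bitAt j) _) (cong suc (bitAt-injective p≡))))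
      ... | no ≢b  = trans (upd-row κ 6 x (bitAt j) _ _) (trans (↦-other (κ 6 x) _ ≢b) (table Dm))
    finish : ∀ σ → Toggled κ₁ x D′ (file j u v (suc j) y z x (j / B) (bitAt j)) σ →
      Changed κ x (λ m → S m ⊎ m ≡ j) (λ y z i b p w → file j u v (suc j) y z x i b p w) σ
    finish _ (p , w , κ′ , refl , tree′ , same) = y , z , _ , _ , p , w , κ′ , refl , record
      { D = D′ ; xs = xs ; tree = tree′
      ; chain    = chain-cong (λ _ → same (λ ())) (λ _ → same (λ ())) chain
      ; sorted   = sorted
      ; positive = positive
      ; flagged  = λ D′m → flagged′ (D′-cases D′m)
      ; listed   = λ {c} c∈ → trans (flag c) (trans (↦-other (κ 7 x) {suc j} {c} 1 λ { refl → ¬Sj (from (members j) (inj₂ c∈)) })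
                                 (proj₁ (listed c∈))) , proj₂ (listed c∈)
      ; members  = λ m → mk⇔
          [ (λ Sm → case to (members m) Sm of λ
               { (inj₁ Dm) → inj₁ (trans (sym (agree m λ { refl → ¬Sj Sm })) Dm) ; (inj₂ m∈) → inj₂ m∈ })
          , (λ { refl → inj₁ (assign-same D j true) }) ]′
          [ (λ D′m → case D′-cases D′m of λ { (inj₁ m≡j) → inj₂ m≡j ; (inj₂ (_ , Dm)) → inj₁ (from (members m) (inj₁ Dm)) })
          , (λ m∈ → inj₁ (from (members m) (inj₂ m∈))) ]′
      } , record
      { output≡     = λ x′ c → same (λ ())
      ; neighbours≡ = λ x′ c → same (λ ())
      ; other≡      = λ t c x≢ → trans (same (x≢ ∘ proj₂)) (trans (upd-other-row κ₇ {4} {x} {j / B} {t} _ x≢)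
                        (trans (upd-other-row κ₆ {7} {x} {suc j} {t} _ x≢) (upd-other-row κ {6} {x} {bitAt j} {t} _ x≢)))
      }
      where
      flag : ∀ c → κ′ 7 x c ≡ (κ 7 x [ suc j ↦ 1 ]) c
      flag c = trans (same (λ ())) (upd-row κ 7 x (suc j) 1 c)
      flagged′ : ∀ {m} → m ≡ j ⊎ (m ≢ j × D m ≡ true) → κ′ 7 x (suc m) ≢ 0
      flagged′ (inj₁ refl) 0≡ = case trans (sym (↦-same (κ 7 x) (suc j) 1)) (trans (sym (flag (suc j))) 0≡) of λ ()
      flagged′ {m} (inj₂ (m≢j , Dm)) 0≡ =
        flagged Dm (trans (sym (↦-other (κ 7 x) {suc j} 1 (λ p≡ → m≢j (sym (suc-injective p≡))))) (trans (sym (flag (suc m))) 0≡))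

module ClassRemoval {W Z B Q k : ℕ} (sizes : Sizes W Z B Q k) where
  open Sizes sizes
  open Programs W Z 8≤2^W 8ZZ≤2^W
  open Machine sizes
  open Vertex sizes
  open Classes sizes
  open ClassUpdates sizes

  module _ {κ x S} (h : Holds κ x S) where
    open Holds h

    0∷xs-unique : Unique (0 ∷ xs)
    0∷xs-unique = All.tabulate (λ c∈ 0≡c → positive (subst (_∈ˡ xs) (sym 0≡c) c∈)) ∷ distinct sorted
      where
      distinct : ∀ {ys} → AllPairs ℕ._>_ ys → Unique ys
      distinct []         = []
      distinct (>s ∷ ys>) = All.map (λ y> y≡ → <⇒≢ y> (sym y≡)) >s ∷ distinct ys>

    link<Z : ∀ {c} → c ∈ˡ 0 ∷ xs → c < Z
    link<Z (here refl) = 0<Z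
    link<Z (there c∈)  = ≤k⇒<Z (proj₂ (listed c∈))

  deleteClass-rule : ∀ {j u v y z x i b p w κ S} → x < Z → Holds κ x S → S j →
    [ ⟪ file j u v (suc j) y z x i b p w ∣ κ ⟫ ] deleteClass
      [ 1000 + toggleTime , Changed κ x (λ m → S m × m ≢ j) (λ y z i b p w → file j u v (suc j) y z x i b p w) ]
  deleteClass-rule {j} {u} {v} {y} {z} {x} {i₀} {b₀} {p₀} {w₀} {κ} {S} x< h Sj =
    weaken {p = deleteClass} time (λ _ q → q)
      (branch-rule {e = cell 7 (r 6) (r 3)} {before ⍮ toggle} {unlink} {t₁ = cost before + toggleTime}
        (_ , (_ , x<) , (_ , ≤k⇒<Z j<k)) inTree inList)
    where
    open Holds h
    open HoldsTree tree
    j<k : j < k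
    j<k = members-bounded h Sj
    D′ = assign D j false
    before = locate ⍮ write 4 (r 6) (r 7) (op sub (cell 4 (r 6) (r 7)) (r 8))
    Post = Changed κ x (λ m → S m × m ≢ j) (λ y z i b p w → file j u v (suc j) y z x i b p w)
    time : suc (sizeᵉ (cell 7 (r 6) (r 3)) + (cost before + toggleTime + cost unlink)) ≤ 1000 + toggleTime
    time = ≤-trans (≤-reflexive (shuffle (suc (sizeᵉ (cell 7 (r 6) (r 3)))) (cost before) toggleTime (cost unlink)))
      (+-monoˡ-≤ toggleTime (≤ᵇ⇒≤ (suc (sizeᵉ (cell 7 (r 6) (r 3))) + (cost before + cost unlink)) 1000 _))
      where
      shuffle : ∀ a b c d → a + (b + c + d) ≡ a + (b + d) + c
      shuffle = solve 4 (λ a b c d → a :+ (b :+ c :+ d) := a :+ (b :+ d) :+ c) refl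
        where open +-*-Solver
    agree : ∀ m → m ≢ j → D′ m ≡ D m
    agree m m≢j = assign-other D false (m≢j ∘ sym)
    D′-true : ∀ {m} → D′ m ≡ true → m ≢ j × D m ≡ true
    D′-true {m} D′m = m≢j , trans (sym (agree m m≢j)) D′m
      where
      m≢j : m ≢ j
      m≢j refl = case trans (sym D′m) (assign-same D j false) of λ ()

    inTree : κ 7 x (suc j) ≢ 0 → _
    inTree flag≢0 = seq-rule {p = before} {toggle}
      (wp-sound before {Q = prepared}
        ( _ , (refl , _)
        , ((_ , ((_ , (_ , lift< (digit+1<Z j))) , digit-fits j)) , _) , (refl , _)
        , (_ , (_ , x<) , (_ , index<Z j<k)) , (((_ , (_ , x<) , (_ , index<Z j<k)) , _) , fits)
        , _ , _ , refl , index j<k , shifted j ))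
      λ { _ (i , b , refl , refl , refl) →
        weaken {p = toggle} ≤-refl finish (toggle-rule {i = j / B} {D = D′} x< (word<Q j<k) unfinished) }
      where
      new : ℕ → ℕ → Cells
      new i b = upd κ 4 x i (κ 4 x i ∸ b)
      prepared : AState → Set
      prepared σ = ∃[ i ] ∃[ b ] (σ ≡ ⟪ file j u v (suc j) y z x i b p₀ w₀ ∣ new i b ⟫ × i ≡ j / B × b ≡ bitAt j)
      κ₁ = new (j / B) (bitAt j)
      Dj : D j ≡ true
      Dj with to (members j) Sj
      ... | inj₁ Dj = Dj
      ... | inj₂ j∈ = contradiction (proj₁ (listed j∈)) flag≢0
      split : κ 4 x (j / B) ≡ wordAt D′ (j / B) + bitAt j
      split = trans (words≡ (j / B)) (wordAt-set agree (assign-same D j false) Dj)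
      fits : applyOp W shl 1 (B ∸ (applyOp W mod j B + 1)) ≤ κ 4 x (applyOp W div j B) × κ 4 x (applyOp W div j B) < 2 ^ W
      fits = subst₂ _≤_ (sym (shifted j)) (trans (sym split) (cong (κ 4 x) (sym (index j<k)))) (m≤n+m (bitAt j) _)
           , lift< (subst (_< Z) (sym (words≡ _)) (word<Z D (applyOp W div j B)))
      unfinished : Unfinished κ₁ x D′ (j / B)
      unfinished = record
        { bounded    = bounded ∘ proj₂ ∘ D′-true
        ; words≡     = words′
        ; table      = table ∘ proj₂ ∘ D′-true
        ; leaves     = λ i′< i′≢ → trans (leaves i′<) (sym (leafAt-other agree i′≢))
        ; tournament = tournament
        ; small      = small
        }
        where
        words′ : ∀ i → κ₁ 4 x i ≡ wordAt D′ i
        words′ i with j / B ℕ.≟ i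
        ... | yes refl = trans (upd-row κ 4 x (j / B) _ (j / B)) (trans (↦-same (κ 4 x) (j / B) _)
                           (trans (cong (_∸ bitAt j) split) (m+n∸n≡m _ (bitAt j))))
        ... | no ≢i    = trans (upd-row κ 4 x (j / B) _ i) (trans (↦-other (κ 4 x) _ ≢i)
                           (trans (words≡ i) (sym (wordAt-other agree (≢i ∘ sym)))))
      finish : ∀ σ → Toggled κ₁ x D′ (file j u v (suc j) y z x (j / B) (bitAt j)) σ → Post σ
      finish _ (p , w , κ′ , refl , tree′ , same) = y , z , _ , _ , p , w , κ′ , refl , record
        { D = D′ ; xs = xs ; tree = tree′
        ; chain    = chain-cong (λ _ → same (λ ())) (λ _ → same (λ ())) chain
        ; sorted   = sorted
        ; positive = positive
        ; flagged  = λ D′m 0≡ → flagged (proj₂ (D′-true D′m)) (trans (sym (same (λ ()))) 0≡)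
        ; listed   = λ c∈ → map₁ (trans (same (λ ()))) (listed c∈)
        ; members  = λ m → mk⇔
            (λ (Sm , m≢j) → case to (members m) Sm of λ
               { (inj₁ Dm) → inj₁ (trans (agree m m≢j) Dm) ; (inj₂ m∈) → inj₂ m∈ })
            [ (λ D′m → from (members m) (inj₁ (proj₂ (D′-true D′m))) , proj₁ (D′-true D′m))
            , (λ m∈ → from (members m) (inj₂ m∈) , λ { refl → flag≢0 (proj₁ (listed m∈)) }) ]′
        } , record
        { output≡     = λ x′ c → same (λ ())
        ; neighbours≡ = λ x′ c → same (λ ())
        ; other≡      = λ t c x≢ → trans (same (x≢ ∘ proj₂)) (upd-other-row κ {4} {x} {j / B} {t} _ x≢)
        }

    inList : κ 7 x (suc j) ≡ 0 → _
    inList flag≡0 = wp-sound unlink {Q = Post}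
      ( (_ , (_ , x<) , (_ , ≤k⇒<Z j<k)) , (refl , _)
      , (_ , (_ , x<) , (_ , ≤k⇒<Z j<k)) , (refl , _)
      , (_ , (_ , x<) , (_ , link<Z h (prev∈ chain c∈))) , _
      , (_ , (_ , x<) , (_ , link<Z h (next∈ chain (there c∈)))) , _
      , _ , _ , _ , _ , _ , _ , κ′ , refl , record
        { D = D ; xs = remove c xs
        ; tree     = record { bounded = bounded ; words≡ = words≡ ; table = table ; leaves = leaves
                            ; tournament = tournament ; small = small }
        ; chain    = chain-cong (λ _ → upd-row κ 1 x prev next _) (λ _ → upd-row κ 2 x next prev _)
                       (chain-remove chain unique positive c∈)
        ; sorted   = remove-AllPairs sorted
        ; positive = positive ∘ remove-⊆ xs
        ; flagged  = flagged
        ; listed   = listed ∘ remove-⊆ xs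
        ; members  = λ m → mk⇔
            (λ (Sm , m≢j) → case to (members m) Sm of λ
               { (inj₁ Dm) → inj₁ Dm ; (inj₂ m∈) → inj₂ (∈-remove (m≢j ∘ suc-injective) m∈) })
            [ (λ Dm → from (members m) (inj₁ Dm) , λ { refl → flagged Dm flag≡0 })
            , (λ m∈ → from (members m) (inj₂ (remove-⊆ xs m∈)) , λ { refl → ∉-remove (tail-unique unique) m∈ }) ]′
        } , record
        { output≡     = λ _ _ → refl
        ; neighbours≡ = λ _ _ → refl
        ; other≡      = λ t a x≢ → trans (upd-other-row (upd κ 1 x prev next) {2} {x} {next} {t} _ x≢)
                                     (upd-other-row κ {1} {x} {prev} {t} _ x≢)
        } )
      where
      c = suc j
      prev = κ 2 x c
      next = κ 1 x c
      κ′ = upd (upd κ 1 x prev next) 2 x next prev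
      unique = 0∷xs-unique h
      tail-unique : ∀ {ys} → Unique (0 ∷ ys) → Unique ys
      tail-unique (_ ∷ u) = u
      c∈ : c ∈ˡ xs
      c∈ with to (members j) Sj
      ... | inj₁ Dj = contradiction flag≡0 (flagged Dj)
      ... | inj₂ c∈ = c∈

  append-rule : ∀ {a j u v y z x i b p w κ S} → x < Z → j < k → Holds κ x S → (∀ {m} → S m → j < m) → κ 7 x (suc j) ≡ 0 →
    [ ⟪ file a u v (suc j) y z x i b p w ∣ κ ⟫ ] append
      [ cost append , (λ σ → ∃[ i ] ∃[ κ′ ] (σ ≡ ⟪ file a u v (suc j) y z x i b p w ∣ κ′ ⟫
                        × Holds κ′ x (λ m → S m ⊎ m ≡ j) × Local κ κ′ x × (∀ x′ a → κ′ 7 x′ a ≡ κ 7 x′ a))) ]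
  append-rule {a₀} {j} {u} {v} {y} {z} {x} {i₀} {b₀} {p₀} {w₀} {κ} {S} x< j<k h j<S flag≡0 =
    wp-sound append
      ( (_ , (_ , x<) , (_ , 0<Z)) , (refl , _)
      , (_ , (_ , x<) , (_ , link<Z h (last∈ chain))) , _
      , (_ , (_ , x<) , (_ , c<Z)) , _
      , (_ , (_ , x<) , (_ , c<Z)) , _
      , (_ , (_ , x<) , (_ , 0<Z)) , _
      , _ , κ′ , refl , record
        { D = D ; xs = xs ++ c ∷ []
        ; tree     = record { bounded = bounded ; words≡ = words≡ ; table = table ; leaves = leaves
                            ; tournament = tournament ; small = small }
        ; chain    = chain-cong (λ _ → row 1 last c c 0 _) (λ _ → row 2 c last 0 c _)
                       (chain-append chain (0∷xs-unique h) positive c∉ (λ ()))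
        ; sorted   = AllPairsₚ.++⁺ sorted ([] ∷ []) (All.tabulate (λ a∈ → c<xs a∈ ∷ []))
        ; positive = λ 0∈ → case Anyₚ.++⁻ xs 0∈ of λ { (inj₁ 0∈) → positive 0∈ ; (inj₂ (here ())) }
        ; flagged  = flagged
        ; listed   = λ a∈ → case Anyₚ.++⁻ xs a∈ of λ { (inj₁ a∈) → listed a∈ ; (inj₂ (here refl)) → flag≡0 , j<k }
        ; members  = λ m → mk⇔
            [ (λ Sm → case to (members m) Sm of λ { (inj₁ Dm) → inj₁ Dm ; (inj₂ m∈) → inj₂ (Anyₚ.++⁺ˡ m∈) })
            , (λ { refl → inj₂ (Anyₚ.++⁺ʳ xs (here refl)) }) ]′
            [ (λ Dm → inj₁ (from (members m) (inj₁ Dm)))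
            , (λ m∈ → case Anyₚ.++⁻ xs m∈ of λ
                { (inj₁ m∈) → inj₁ (from (members m) (inj₂ m∈)) ; (inj₂ (here m≡)) → inj₂ (suc-injective m≡) }) ]′
        } , record
        { output≡     = λ _ _ → refl
        ; neighbours≡ = λ _ _ → refl
        ; other≡      = λ t a x≢ → trans (upd-other-row κ₃ {2} {x} {0} {t} _ x≢) (trans (upd-other-row κ₂ {2} {x} {c} {t} _ x≢)
                          (trans (upd-other-row κ₁ {1} {x} {c} {t} _ x≢) (upd-other-row κ {1} {x} {last} {t} _ x≢)))
        } , λ _ _ → refl )
    where
    open Holds h
    open HoldsTree tree
    c = suc j
    last = κ 2 x 0
    κ₁ = upd κ 1 x last c
    κ₂ = upd κ₁ 1 x c 0
    κ₃ = upd κ₂ 2 x c last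
    κ′ = upd κ₃ 2 x 0 c
    c<Z : c < Z
    c<Z = ≤k⇒<Z j<k
    c<xs : ∀ {a} → a ∈ˡ xs → c < a
    c<xs {zero}  a∈ = contradiction a∈ positive
    c<xs {suc m} a∈ = s≤s (j<S (from (members m) (inj₂ a∈)))
    c∉ : ¬ c ∈ˡ 0 ∷ xs
    c∉ (there c∈) = <⇒≢ (c<xs c∈) refl
    row : ∀ t a y b z q → upd (upd κ t x a y) t x b z t x q ≡ (κ t x [ a ↦ y ] [ b ↦ z ]) q
    row t a y b z q = trans (upd-row (upd κ t x a y) t x b z q) (cong (λ e → if b ≡ᵇ q then z else e) (upd-row κ t x a y q))

-- The programs

topOf : Ex → Ex
topOf x = max (cell 1 x (# 0)) (cell 5 x (# 1))

mate : Ex → Ex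
mate x = cell 0 (# 0) x

setMate : Ex → Ex → Co
setMate x y = write 0 (# 0) x y

match : Ex → Ex → Co
match x y = setMate x (op add y (# 1)) ⍮ setMate y (op add x (# 1))

unmatch rematchProgram insertProgram deleteProgram : Co

unmatch =
  branch (op lt (topOf (r 6)) (r 3))
    (branch (mate (r 6))
      (setMate (op sub (mate (r 6)) (# 1)) (# 0) ⍮ setMate (r 6) (# 0))
      nop)
    nop

insertProgram =
  3 ≔ᵣ op add (r 0) (# 1) ⍮
  (6 ≔ᵣ r 1 ⍮ unmatch) ⍮
  (6 ≔ᵣ r 2 ⍮ unmatch) ⍮
  branch (op lt (topOf (r 1)) (r 3)) (branch (op lt (topOf (r 2)) (r 3)) (match (r 1) (r 2)) nop) nop ⍮
  (write 3 (r 1) (r 3) (r 2) ⍮ write 3 (r 2) (r 3) (r 1) ⍮ 6 ≔ᵣ r 1) ⍮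
  insertClass ⍮
  6 ≔ᵣ r 2 ⍮
  insertClass

rematchProgram =
  4 ≔ᵣ topOf (r 6) ⍮
  branch (r 4)
    (5 ≔ᵣ cell 3 (r 6) (r 4) ⍮ branch (op eq (topOf (r 5)) (r 4)) (match (r 6) (r 5)) nop)
    nop

deleteProgram =
  3 ≔ᵣ op add (r 0) (# 1) ⍮
  branch (op eq (mate (r 1)) (op add (r 2) (# 1))) (setMate (r 1) (# 0) ⍮ setMate (r 2) (# 0)) nop ⍮
  6 ≔ᵣ r 1 ⍮
  deleteClass ⍮
  6 ≔ᵣ r 2 ⍮
  deleteClass ⍮
  (6 ≔ᵣ r 1 ⍮ rematchProgram) ⍮
  (6 ≔ᵣ r 2 ⍮ rematchProgram)

module Display {n m : ℕ} (G : Graph n m) {k : ℕ} where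
  open Graph G
  open Preservation G {k}

  record Shows (o : ℕ → ℕ) (S : Subset m) : Set where
    field
      unmatched : ∀ u → (∀ e → e ∈ S → ¬ u ∈ₑ e) → o (toℕ u) ≡ 0
      matched   : ∀ u e → e ∈ S → u ∈ₑ e → o (toℕ u) ≡ suc (toℕ (opposite e u))

  shows-cong : ∀ {o o′ S S′} → (∀ a → o′ a ≡ o a) → (∀ {e} → e ∈ S ⇔ e ∈ S′) → Shows o S → Shows o′ S′
  shows-cong o≡ S⇔ shows = record
    { unmatched = λ u none → trans (o≡ _) (unmatched u (λ e e∈ → none e (to S⇔ e∈)))
    ; matched   = λ u e e∈ u∈ → trans (o≡ _) (matched u e (from S⇔ e∈) u∈)
    } where open Shows shows

  shows-remove : ∀ {o o′ S f} → IsMatching S → f ∈ S → Shows o S →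
    (∀ x → x ∈ₑ f → o′ (toℕ x) ≡ 0) → (∀ x → ¬ x ∈ₑ f → o′ (toℕ x) ≡ o (toℕ x)) → Shows o′ (S - f)
  shows-remove {S = S} {f} matching f∈ shows cleared same = record
    { unmatched = λ u none → case u ∈ₑ? f of λ
        { (yes u∈) → cleared u u∈
        ; (no u∉) → trans (same u u∉) (unmatched u λ e e∈ u∈ → none e (from ∈-remove⇔ (e∈ , λ { refl → u∉ u∈ })) u∈) }
    ; matched = λ u e e∈ u∈ → let e∈S , e≢f = to (∈-remove⇔ {p = S}) e∈ in
        trans (same u λ u∈f → e≢f (matching e∈S f∈ (u , u∈ , u∈f))) (matched u e e∈S u∈)
    } where open Shows shows

  shows-add : ∀ {o o′ S f} → IsMatching (S ∪ ⁅ f ⁆) → Shows o S →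
    (∀ x → x ∈ₑ f → o′ (toℕ x) ≡ suc (toℕ (opposite f x))) → (∀ x → ¬ x ∈ₑ f → o′ (toℕ x) ≡ o (toℕ x)) → Shows o′ (S ∪ ⁅ f ⁆)
  shows-add {S = S} {f} matching shows set same = record
    { unmatched = λ u none → case u ∈ₑ? f of λ
        { (yes u∈) → contradiction u∈ (none f (from (∈-add⇔ {p = S}) (inj₂ refl)))
        ; (no u∉) → trans (same u u∉) (unmatched u λ e e∈ → none e (from ∈-add⇔ (inj₁ e∈))) }
    ; matched = λ u e e∈ u∈ → case u ∈ₑ? f of λ
        { (yes u∈f) → trans (set u u∈f) (cong (λ g → suc (toℕ (opposite g u)))
            (matching (from (∈-add⇔ {p = S}) (inj₂ refl)) e∈ (u , u∈f , u∈)))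
        ; (no u∉f) → trans (same u u∉f) (matched u e (case to (∈-add⇔ {p = S}) e∈ of λ
            { (inj₁ e∈) → e∈ ; (inj₂ refl) → contradiction u∈ u∉f }) u∈) }
    } where open Shows shows

  opposite-first : ∀ e → opposite e (proj₁ (ends e)) ≡ proj₂ (ends e)
  opposite-first e with proj₁ (ends e) Fin.≟ proj₁ (ends e)
  ... | yes _ = refl
  ... | no ≢  = contradiction refl ≢

  opposite-second : ∀ e → opposite e (proj₂ (ends e)) ≡ proj₁ (ends e)
  opposite-second e with proj₂ (ends e) Fin.≟ proj₁ (ends e)
  ... | yes p≡ = contradiction (sym p≡) (loopless e)
  ... | no _   = refl

  opposite≢ : ∀ {e u} → u ∈ₑ e → opposite e u ≢ u
  opposite≢ {e} (inj₁ refl) p≡ = loopless e (trans (sym p≡) (opposite-first e))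
  opposite≢ {e} (inj₂ refl) p≡ = loopless e (trans (sym (opposite-second e)) p≡)

  opposite-involutive : ∀ {e u} → u ∈ₑ e → opposite e (opposite e u) ≡ u
  opposite-involutive {e} (inj₁ refl) = trans (cong (opposite e) (opposite-first e)) (opposite-second e)
  opposite-involutive {e} (inj₂ refl) = trans (cong (opposite e) (opposite-second e)) (opposite-first e)

  same-ends : ∀ {e f u} → u ∈ₑ e → u ∈ₑ f → opposite e u ≡ opposite f u → e ≡ f
  same-ends {e} {f} {u} u∈e u∈f o≡ = simple e f (λ x → mk⇔
    (λ x∈ → case end-cases u∈e x∈ of λ { (inj₁ refl) → u∈f ; (inj₂ x≡) → subst (_∈ₑ f) (sym (trans x≡ o≡)) (opposite∈ u∈f) })
    (λ x∈ → case end-cases u∈f x∈ of λ { (inj₁ refl) → u∈e ; (inj₂ x≡) → subst (_∈ₑ e) (sym (trans x≡ (sym o≡))) (opposite∈ u∈e) }))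

  toℕ≢ : {a b : Fin n} → a ≢ b → toℕ a ≢ toℕ b
  toℕ≢ a≢b = a≢b ∘ Finₚ.toℕ-injective

  module _ {f a b} (a∈ : a ∈ₑ f) (b≡ : b ≡ opposite f a) (o : ℕ → ℕ) (y z : ℕ) where

    private o′ = o [ toℕ a ↦ y ] [ toℕ b ↦ z ]

    ends-written : ∀ {P : Fin n → Set} → P a → P b → ∀ x → x ∈ₑ f → P x
    ends-written {P} pa pb x x∈ = case end-cases a∈ x∈ of λ { (inj₁ refl) → pa ; (inj₂ x≡) → subst P (trans b≡ (sym x≡)) pb }

    write-first : o′ (toℕ a) ≡ y
    write-first = trans (↦-other (o [ toℕ a ↦ y ]) z (λ p≡ → opposite≢ a∈ (trans (sym b≡) (Finₚ.toℕ-injective p≡)))) (↦-same o (toℕ a) y)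

    write-second : o′ (toℕ b) ≡ z
    write-second = ↦-same (o [ toℕ a ↦ y ]) (toℕ b) z

    write-others : ∀ x → ¬ x ∈ₑ f → o′ (toℕ x) ≡ o (toℕ x)
    write-others x x∉ = trans (↦-other (o [ toℕ a ↦ y ]) z (λ p≡ → x∉ (subst (_∈ₑ f) (trans (sym b≡) (Finₚ.toℕ-injective p≡)) (opposite∈ a∈))))
      (↦-other o y (λ p≡ → x∉ (subst (_∈ₑ f) (Finₚ.toℕ-injective p≡) a∈)))

module Simulation {n m : ℕ} (G : Graph n m) {W Z B Q k : ℕ} (sizes : Sizes W Z B Q k) (n<Z : n < Z) where
  open Graph G
  open Algorithm G {k} using (unmatchBelow)
  open Combinatorics G {k}
  open Preservation G {k}
  open Display G {k}
  open Sizes sizes using (8≤2^W; 8ZZ≤2^W)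
  open Programs W Z 8≤2^W 8ZZ≤2^W
  open Machine sizes
  open Classes sizes
  open ClassUpdates sizes
  open ClassRemoval sizes

  ClassAt : Classes → Fin n → ℕ → Set
  ClassAt R u c = ∃[ i ] ∃[ e ] (toℕ i ≡ c × R i e × u ∈ₑ e)

  record Represents (R : Classes) (S : Subset m) (κ : Cells) : Set where
    field
      shows      : Shows (κ 0 0) S
      neighbours : ∀ {i e u} → R i e → u ∈ₑ e → κ 3 (toℕ u) (suc (toℕ i)) ≡ toℕ (opposite e u)
      holds      : ∀ u → Holds κ (toℕ u) (ClassAt R u)

  vertex<Z : ∀ (u : Fin n) → toℕ u < Z
  vertex<Z u = <-trans (Finₚ.toℕ<n u) n<Z

  class<Z : ∀ (i : Fin k) → suc (toℕ i) < Z
  class<Z i = ≤k⇒<Z (Finₚ.toℕ<n i)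

  holds-⇔ : ∀ {κ x S S′} → (∀ j → S′ j ⇔ S j) → Holds κ x S → Holds κ x S′
  holds-⇔ S⇔ h = record
    { D = D ; xs = xs ; tree = tree ; chain = chain ; sorted = sorted ; positive = positive
    ; flagged = flagged ; listed = listed
    ; members = λ j → mk⇔ (λ Sj → to (members j) (to (S⇔ j) Sj)) (λ d → from (S⇔ j) (from (members j) d)) }
    where open Holds h

  class-topmost : ∀ {R κ u i g} → Legal R → (h : Holds κ (toℕ u) (ClassAt R u)) → R i g → u ∈ₑ g →
    top h ≡ suc (toℕ i) ⇔ Topmost R u g
  class-topmost {R} {κ} {u} {i} {g} legal h Rg u∈g = mk⇔
    (λ top≡ f u∈f _ (i₁ , j , Rg′ , Rf , i₁<j) → <⇒≱ (subst (_<ᶠ j) (unique Rg′ Rg) i₁<j)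
      (≤-pred (subst (suc (toℕ j) ≤_) top≡ (≤top h (j , f , refl , Rf , u∈f)))))
    (λ topmost → ≤-antisym (upper topmost (top-attained h)) (≤top h (i , g , refl , Rg , u∈g)))
    where
    open Legal legal
    upper : Topmost R u g → top h ≡ 0 ⊎ ∃[ j ] (top h ≡ suc j × ClassAt R u j) → top h ≤ suc (toℕ i)
    upper _ (inj₁ top≡0) = subst (_≤ _) (sym top≡0) z≤n
    upper topmost (inj₂ (_ , top≡ , i′ , f , refl , Rf , u∈f)) =
      subst (_≤ _) (sym top≡) (s≤s (≮⇒≥ (λ i<i′ → topmost f u∈f (i′ , Rf) (i , i′ , Rg , Rf , i<i′))))

  new-topmost : ∀ {R R′ κ u j e} → Legal R′ → Adds R R′ j e → (h : Holds κ (toℕ u) (ClassAt R u)) → u ∈ₑ e →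
    top h < suc (toℕ j) ⇔ Topmost R′ u e
  new-topmost {R} {R′} {κ} {u} {j} {e} legal adds h u∈e = mk⇔ ⇒ (λ topmost → ⇐ topmost (top-attained h))
    where
    open Legal legal
    open Adds adds
    ⇒ : top h < suc (toℕ j) → Topmost R′ u e
    ⇒ top< f u∈f _ (i , i′ , R′e , R′f , i<i′) with to ⇔R R′f
    ... | inj₁ Rf = <⇒≱ (≤-trans (subst (_<ᶠ i′) (unique R′e added) i<i′) (<⇒≤ (≤top h (i′ , f , refl , Rf , u∈f)))) (≤-pred top<)
    ... | inj₂ (refl , refl) = <⇒≢ i<i′ (cong toℕ (unique R′e R′f))
    ⇐ : Topmost R′ u e → top h ≡ 0 ⊎ ∃[ c ] (top h ≡ suc c × ClassAt R u c) → top h < suc (toℕ j)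
    ⇐ _ (inj₁ top≡0) = subst (_< _) (sym top≡0) (s≤s z≤n)
    ⇐ topmost (inj₂ (_ , top≡ , i , f , refl , Rf , u∈f)) with Finₚ.<-cmp i j
    ... | tri< i<j _ _  = subst (_< _) (sym top≡) (s≤s i<j)
    ... | tri≈ _ refl _ = contradiction (i , subst (R i) (matching (old Rf) added (u , u∈f , u∈e)) Rf) new
    ... | tri> _ _ j<i  = contradiction (j , i , added , old Rf , j<i) (topmost f u∈f (i , old Rf))

  TopOk : Cells → ℕ → Set
  TopOk κ x = ((⊤ × (⊤ × x < Z) × (⊤ × 0 < Z)) × κ 1 x 0 < Z) × ((⊤ × (⊤ × x < Z) × (⊤ × 1 < Z)) × κ 5 x 1 < Z)

  top-ok : ∀ {κ x S} → x < Z → Holds κ x S → TopOk κ x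
  top-ok x< h = ((_ , (_ , x<) , (_ , 0<Z)) , ≤k⇒<Z (head≤k h)) , ((_ , (_ , x<) , (_ , 1<Z)) , ≤k⇒<Z (HoldsTree.small (Holds.tree h) 1))
    where open Vertex sizes

  bit≢0⇒ : ∀ {b} → bit W b ≢ 0 → b ≡ true
  bit≢0⇒ {true}  _  = refl
  bit≢0⇒ {false} ≢0 = contradiction refl ≢0

  bit≡0⇒ : ∀ {b} → bit W b ≡ 0 → b ≡ false
  bit≡0⇒ {false} _ = refl

  lt≢0⇒ : ∀ {a b} → bit W (a <ᵇ b) ≢ 0 → a < b
  lt≢0⇒ {a} {b} h = <ᵇ⇒< a b (subst T (sym (bit≢0⇒ h)) tt)

  lt≡0⇒ : ∀ {a b} → bit W (a <ᵇ b) ≡ 0 → ¬ a < b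
  lt≡0⇒ {a} {b} h a<b = subst T (bit≡0⇒ h) (<⇒<ᵇ a<b)

  eq≢0⇒ : ∀ {a b} → bit W (a ≡ᵇ b) ≢ 0 → a ≡ b
  eq≢0⇒ {a} {b} h = ≡ᵇ⇒≡ a b (subst T (sym (bit≢0⇒ h)) tt)

  eq≡0⇒ : ∀ {a b} → bit W (a ≡ᵇ b) ≡ 0 → a ≢ b
  eq≡0⇒ {a} {b} h a≡b = subst T (bit≡0⇒ h) (≡⇒≡ᵇ a b a≡b)

  SameTables : Cells → Cells → Set
  SameTables κ κ′ = ∀ t a c → t ≢ 0 → κ′ t a c ≡ κ t a c

  sameTables : ∀ κ a b y z → SameTables κ (upd (upd κ 0 0 a y) 0 0 b z)
  sameTables _ _ _ _ _ zero    a c 0≢0 = contradiction refl 0≢0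
  sameTables _ _ _ _ _ (suc t) a c _   = refl

  mate-cases : ∀ {o S} → Shows o S → ∀ u → (o (toℕ u) ≡ 0 × (∀ e → e ∈ S → ¬ u ∈ₑ e))
    ⊎ ∃[ e ] (e ∈ S × u ∈ₑ e × o (toℕ u) ≡ suc (toℕ (opposite e u)))
  mate-cases {S = S} shows u with Finₚ.any? (λ e → (e Subₚ.∈? S) ×-dec (u ∈ₑ? e))
  ... | yes (e , e∈ , u∈) = inj₂ (e , e∈ , u∈ , Shows.matched shows u e e∈ u∈)
  ... | no none = inj₁ (Shows.unmatched shows u none′ , none′)
    where
    none′ : ∀ e → e ∈ S → ¬ u ∈ₑ e
    none′ e e∈ u∈ = none (e , e∈ , u∈)

  mate<Z : ∀ {o S} → Shows o S → ∀ u → o (toℕ u) < Z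
  mate<Z shows u with mate-cases shows u
  ... | inj₁ (o≡ , _) = subst (_< Z) (sym o≡) 0<Z
  ... | inj₂ (e , _ , _ , o≡) = subst (_< Z) (sym o≡) (≤-<-trans (Finₚ.toℕ<n (opposite e u)) n<Z)

  unmatch-rule : ∀ {R M′ S κ j x j′ u v y z i b p w} → Legal R → (∀ {f} → f ∈ S → Dominant R f) →
    (∀ {f i} → f ∈ S → f ∈ M′ i ⇔ R i f) → (∀ x → Holds κ (toℕ x) (ClassAt R x)) → Shows (κ 0 0) S →
    [ ⟪ file j′ u v (suc (toℕ j)) y z (toℕ x) i b p w ∣ κ ⟫ ] unmatch
      [ cost unmatch , (λ σ → ∃[ κ′ ] (σ ≡ ⟪ file j′ u v (suc (toℕ j)) y z (toℕ x) i b p w ∣ κ′ ⟫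
                         × SameTables κ κ′ × Shows (κ′ 0 0) (unmatchBelow M′ j x S))) ]
  unmatch-rule {R} {M′} {S} {κ} {j} {x} {j′} {u} {v} {y} {z} {i} {b} {p} {w} legal dom classes holds shows =
    wp-sound unmatch {Q = Post}
      ( ((top-ok x< h , _) , _)
      , (λ lower → (_ , (_ , 0<Z) , (_ , x<))
        , (λ matched → clear (lt≢0⇒ lower) matched (mate-cases shows x))
        , (λ unmatched → unchanged λ { (f , f∈ , (x∈f , _)) → case trans (sym unmatched) (Shows.matched shows x f f∈ x∈f) of λ () }))
      , (λ higher → unchanged λ { (f , f∈ , x∈f , i , f∈i , i<j) → lt≡0⇒ higher (subst (_< suc (toℕ j))
            (sym (from (class-topmost legal h (to (classes f∈) f∈i) x∈f) (proj₂ (dom f∈) x x∈f))) (s≤s i<j)) }) )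
    where
    x< = vertex<Z x
    h = holds x
    Post : AState → Set
    Post σ = ∃[ κ′ ] (σ ≡ ⟪ file j′ u v (suc (toℕ j)) y z (toℕ x) i b p w ∣ κ′ ⟫
                         × SameTables κ κ′ × Shows (κ′ 0 0) (unmatchBelow M′ j x S))
    matching : IsMatching S
    matching e∈ f∈ = dominant-matching legal (dom e∈) (dom f∈)
    unchanged : ¬ (∃[ f ] (f ∈ S × LowerAt M′ j x f)) → Post ⟪ file j′ u v (suc (toℕ j)) y z (toℕ x) i b p w ∣ κ ⟫
    unchanged none with unmatchBelow-cases M′ j x S
    ... | inj₁ (f , f∈ , low , _) = contradiction (f , f∈ , low) none
    ... | inj₂ (_ , p≡) = κ , refl , (λ _ _ _ _ → refl) , subst (Shows (κ 0 0)) (sym p≡) shows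
    clear : top h < suc (toℕ j) → κ 0 0 (toℕ x) ≢ 0 →
      (κ 0 0 (toℕ x) ≡ 0 × (∀ e → e ∈ S → ¬ x ∈ₑ e)) ⊎ ∃[ e ] (e ∈ S × x ∈ₑ e × κ 0 0 (toℕ x) ≡ suc (toℕ (opposite e x))) →
      wp (setMate (op sub (mate (r 6)) (# 1)) (# 0) ⍮ setMate (r 6) (# 0)) Post
        ⟪ file j′ u v (suc (toℕ j)) y z (toℕ x) i b p w ∣ κ ⟫
    clear _ ≢0 (inj₁ (≡0 , _)) = contradiction ≡0 ≢0
    clear top< ≢0 (inj₂ (f , f∈ , x∈f , o≡)) =
      (_ , (_ , 0<Z) , (((_ , (_ , 0<Z) , (_ , x<)) , _) , (n≢0⇒n>0 ≢0 , lift< (mate<Z shows x))) , subst (_< Z) (sym pred≡) (vertex<Z (opposite f x)))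
      , _ , (_ , (_ , 0<Z) , (_ , x<)) , _
      , upd (upd κ 0 0 (κ 0 0 (toℕ x) ∸ 1) 0) 0 0 (toℕ x) 0 , refl , sameTables κ (κ 0 0 (toℕ x) ∸ 1) (toℕ x) 0 0 , removed (unmatchBelow-cases M′ j x S)
      where
      pred≡ : κ 0 0 (toℕ x) ∸ 1 ≡ toℕ (opposite f x)
      pred≡ = cong (_∸ 1) o≡
      o′ = κ 0 0 [ κ 0 0 (toℕ x) ∸ 1 ↦ 0 ] [ toℕ x ↦ 0 ]
      low : LowerAt M′ j x f
      low = let i , Rf = proj₁ (dom f∈) in
        x∈f , i , from (classes f∈) Rf , ≤-trans (≤top h (i , f , refl , Rf , x∈f)) (≤-pred top<)
      o′≡ : ∀ a → o′ a ≡ (κ 0 0 [ toℕ (opposite f x) ↦ 0 ] [ toℕ x ↦ 0 ]) a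
      o′≡ a = cong (λ d → (κ 0 0 [ d ↦ 0 ] [ toℕ x ↦ 0 ]) a) pred≡
      removed : (∃[ g ] (g ∈ S × LowerAt M′ j x g × unmatchBelow M′ j x S ≡ S - g)) ⊎
                ((∀ g → g ∈ S → ¬ LowerAt M′ j x g) × unmatchBelow M′ j x S ≡ S) → Shows o′ (unmatchBelow M′ j x S)
      removed (inj₂ (none , _)) = contradiction low (none f f∈)
      removed (inj₁ (g , g∈ , (x∈g , _) , p≡)) with refl ← matching f∈ g∈ (x , x∈f , x∈g) =
        subst (Shows o′) (sym p≡) (shows-cong o′≡ (mk⇔ id id) (shows-remove matching f∈ shows
          (ends-written (opposite∈ x∈f) (sym (opposite-involutive x∈f)) (κ 0 0) 0 0
            (write-first (opposite∈ x∈f) (sym (opposite-involutive x∈f)) (κ 0 0) 0 0)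
            (write-second (opposite∈ x∈f) (sym (opposite-involutive x∈f)) (κ 0 0) 0 0))
          (write-others (opposite∈ x∈f) (sym (opposite-involutive x∈f)) (κ 0 0) 0 0)))

-- abstract, because unfolding the numerals makes conversion checking explode
abstract
  baseTime bigConstant : ℕ
  baseTime    = 5000
  bigConstant = 10000

  ≤baseTime : ∀ {x} → x ≤ 5000 → x ≤ baseTime
  ≤baseTime = id

  ≤bigConstant : ∀ {x} → x ≤ 10000 → x ≤ bigConstant
  ≤bigConstant = id

  baseTime+≤bigConstant : ∀ {x} → x ≤ 5000 → baseTime + x ≤ bigConstant
  baseTime+≤bigConstant = +-monoʳ-≤ 5000

module Insertion {n m : ℕ} (G : Graph n m) {W Z B Q k : ℕ} (sizes : Sizes W Z B Q k) (n<Z : n < Z) where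
  open Graph G
  open Algorithm G {k} using (unmatchBelow; Highest; highest?; addN; insertStep)
  open Combinatorics G {k}
  open Preservation G {k}
  open Display G {k}
  open Sizes sizes using (8≤2^W; 8ZZ≤2^W)
  open Programs W Z 8≤2^W 8ZZ≤2^W
  open Machine sizes
  open Classes sizes
  open ClassUpdates sizes
  open Simulation G sizes n<Z

  InState : Classes → Subset m → AState → Set
  InState R S σ = ∃[ j ] ∃[ u ] ∃[ v ] ∃[ c ] ∃[ y ] ∃[ z ] ∃[ x ] ∃[ i ] ∃[ b ] ∃[ p ] ∃[ w ] ∃[ κ ]
    (σ ≡ ⟪ file j u v c y z x i b p w ∣ κ ⟫ × Represents R S κ)

  updateBound : ℕ
  updateBound = baseTime + 2 * toggleTime

  collect : ∀ a b c d e f g T → a + (b + (c + (d + (e + ((f + T) + (g + (f + T))))))) ≡ a + b + c + d + e + f + g + f + 2 * T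
  collect = solve 8 (λ a b c d e f g T → a :+ (b :+ (c :+ (d :+ (e :+ ((f :+ T) :+ (g :+ (f :+ T)))))))
                       := a :+ b :+ c :+ d :+ e :+ f :+ g :+ f :+ con 2 :* T) refl
    where open +-*-Solver


  module _ {R R′ : Classes} {j : Fin k} {e : Fin m} (adds : Adds R R′ j e) (legal′ : Legal R′) where
    open Adds adds
    open Legal legal′

    classAt-end : ∀ {x} → x ∈ₑ e → ∀ c → ClassAt R′ x c ⇔ (ClassAt R x c ⊎ c ≡ toℕ j)
    classAt-end x∈e c = mk⇔
      (λ (i , f , i≡ , R′f , x∈f) → case to ⇔R R′f of λ { (inj₁ Rf) → inj₁ (i , f , i≡ , Rf , x∈f) ; (inj₂ (refl , refl)) → inj₂ (sym i≡) })
      [ (λ (i , f , i≡ , Rf , x∈f) → i , f , i≡ , old Rf , x∈f) , (λ { refl → j , e , refl , added , x∈e }) ]′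

    classAt-other : ∀ {x} → ¬ x ∈ₑ e → ∀ c → ClassAt R′ x c ⇔ ClassAt R x c
    classAt-other x∉e c = mk⇔
      (λ (i , f , i≡ , R′f , x∈f) → case to ⇔R R′f of λ { (inj₁ Rf) → i , f , i≡ , Rf , x∈f ; (inj₂ (_ , refl)) → contradiction x∈f x∉e })
      (λ (i , f , i≡ , Rf , x∈f) → i , f , i≡ , old Rf , x∈f)

    classAt-new : ∀ {x} → x ∈ₑ e → ¬ ClassAt R x (toℕ j)
    classAt-new {x} x∈e (i , f , i≡ , Rf , x∈f) with refl ← Finₚ.toℕ-injective i≡
      = new (j , subst (R j) (matching (old Rf) added (x , x∈f , x∈e)) Rf)

    neighbours-added : ∀ {κ} → (∀ {i f x} → R i f → x ∈ₑ f → κ 3 (toℕ x) (suc (toℕ i)) ≡ toℕ (opposite f x)) →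
      let u = proj₁ (ends e) ; v = proj₂ (ends e) ; κ₁ = upd κ 3 (toℕ u) (suc (toℕ j)) (toℕ v) in
      ∀ {i f x} → R′ i f → x ∈ₑ f → upd κ₁ 3 (toℕ v) (suc (toℕ j)) (toℕ u) 3 (toℕ x) (suc (toℕ i)) ≡ toℕ (opposite f x)
    neighbours-added {κ} nb {i} {f} {x} R′f x∈f = cases (to ⇔R R′f)
      where
      a = toℕ (proj₁ (ends e))
      b = toℕ (proj₂ (ends e))
      c = suc (toℕ j)
      κ₁ = upd κ 3 a c b
      cases : R i f ⊎ (i ≡ j × f ≡ e) → upd κ₁ 3 b c a 3 (toℕ x) (suc (toℕ i)) ≡ toℕ (opposite f x)
      cases (inj₁ Rf) = trans (upd-other κ₁ {3} {b} {c} {3} {toℕ x} a (clash (second∈ e)))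
        (trans (upd-other κ {3} {a} {c} {3} {toℕ x} b (clash (first∈ e))) (nb Rf x∈f))
        where
        clash : ∀ {y} → y ∈ₑ e → ¬ (3 ≡ 3 × toℕ y ≡ toℕ x × c ≡ suc (toℕ i))
        clash y∈e (_ , y≡x , j≡i) with refl ← Finₚ.toℕ-injective y≡x =
          classAt-new y∈e (i , f , sym (suc-injective j≡i) , Rf , x∈f)
      cases (inj₂ (refl , refl)) = case x∈f of λ
        { (inj₁ refl) → trans (upd-other κ₁ {3} {b} {c} {3} {a} {c} a (λ (_ , v≡u , _) → loopless e (sym (Finₚ.toℕ-injective v≡u))))
                          (trans (upd-same κ 3 a c b) (cong toℕ (sym (opposite-first e))))
        ; (inj₂ refl) → trans (upd-same κ₁ 3 b c a) (cong toℕ (sym (opposite-second e))) }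

    holds-added : ∀ {κ κ₁ κ₂} → (∀ x → Holds κ (toℕ x) (ClassAt R x)) →
      let u = proj₁ (ends e) ; v = proj₂ (ends e) in
      Holds κ₁ (toℕ u) (λ c → ClassAt R u c ⊎ c ≡ toℕ j) → Local κ κ₁ (toℕ u) →
      Holds κ₂ (toℕ v) (λ c → ClassAt R v c ⊎ c ≡ toℕ j) → Local κ₁ κ₂ (toℕ v) →
      ∀ x → Holds κ₂ (toℕ x) (ClassAt R′ x)
    holds-added h hu lu hv lv x with x Fin.≟ proj₂ (ends e) | x Fin.≟ proj₁ (ends e)
    ... | yes refl | _ = holds-⇔ (classAt-end (second∈ e)) hv
    ... | no x≢v | yes refl = holds-cong (λ t c _ _ → Local.other≡ lv t c (toℕ≢ (x≢v ∘ sym))) (holds-⇔ (classAt-end (first∈ e)) hu)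
    ... | no x≢v | no x≢u = holds-cong (λ t c _ _ → trans (Local.other≡ lv t c (toℕ≢ (x≢v ∘ sym))) (Local.other≡ lu t c (toℕ≢ (x≢u ∘ sym))))
      (holds-⇔ (classAt-other [ x≢u , x≢v ]′) (h x))

  insert-rule : ∀ {M M′ A j e c y z x i b p w κ} → Legal (edgesOf M) → Legal (edgesOf M′) → Adds (edgesOf M) (edgesOf M′) j e →
    Invariant (edgesOf M) A → Represents (edgesOf M) (AlgState.out A) κ →
    [ ⟪ file (toℕ j) (toℕ (proj₁ (ends e))) (toℕ (proj₂ (ends e))) c y z x i b p w ∣ κ ⟫ ] insertProgram
      [ updateBound , InState (edgesOf M′) (AlgState.out (insertStep M′ j e A)) ]
  insert-rule {M} {M′} {A@(⟨ N , out ⟩)} {j} {e} {c₀} {y} {z} {x₀} {i} {b} {p} {w} {κ} legal legal′ adds inv rep =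
    weaken {p = insertProgram} time (λ _ q → q)
      (seq-rule {p = p₁} {p₂₋} (wp-sound p₁ {Q = At κ c₀ x₀ c} (((_ , _) , sum<2^W (<-trans (n<1+n _) (class<Z j)) 1<Z) , (refl , _) , cong (λ c → ⟪ file′ c x₀ ∣ κ ⟫) (+-comm (toℕ j) 1)))
      λ { _ refl → seq-rule {p = p₂} {p₃₋}
        (seq-rule {p = 6 ≔ᵣ r 1} {unmatch} {Q = _≡ ⟪ file′ c (toℕ u) ∣ κ ⟫} (wp-sound (6 ≔ᵣ r 1) (_ , (refl , _) , refl)) λ { _ refl →
          unmatch-rule {M′ = M′} {j = j} {u} {toℕ j} legal dom (λ f∈ → old-class (dom f∈)) (Represents.holds rep) (Represents.shows rep) })
      λ { _ (κ₁ , refl , same₁ , shows₁) → seq-rule {p = p₃} {p₄₋}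
        (seq-rule {p = 6 ≔ᵣ r 2} {unmatch} {Q = _≡ ⟪ file′ c (toℕ v) ∣ κ₁ ⟫} (wp-sound (6 ≔ᵣ r 2) (_ , (refl , _) , refl)) λ { _ refl →
          unmatch-rule {M′ = M′} {j = j} {v} {toℕ j} legal dom₁ (λ f∈ → old-class (dom₁ f∈))
            (λ x → holds-cong (λ t c t≢0 _ → same₁ t _ c t≢0) (Represents.holds rep x)) shows₁ })
      λ { _ (κ₂ , refl , same₂ , shows₂) → rest κ₂ (λ t a c t≢0 → trans (same₂ t a c t≢0) (same₁ t a c t≢0)) shows₂ } } })
    where
    open Invariant inv
    open Adds adds
    u = proj₁ (ends e)
    v = proj₂ (ends e)
    c = suc (toℕ j)
    out₁ = unmatchBelow M′ j u out
    out₂ = unmatchBelow M′ j v out₁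
    out₃ = AlgState.out (insertStep M′ j e A)
    inv′ = insert-invariant {M} {M′} legal legal′ adds inv
    p₇₋ = 6 ≔ᵣ r 2 ⍮ insertClass
    p₆₋ = insertClass ⍮ p₇₋
    p₅ = write 3 (r 1) (r 3) (r 2) ⍮ write 3 (r 2) (r 3) (r 1) ⍮ 6 ≔ᵣ r 1
    p₅₋ = p₅ ⍮ p₆₋
    p₄ = branch (op lt (topOf (r 1)) (r 3)) (branch (op lt (topOf (r 2)) (r 3)) (match (r 1) (r 2)) nop) nop
    p₄₋ = p₄ ⍮ p₅₋
    p₃ = 6 ≔ᵣ r 2 ⍮ unmatch
    p₃₋ = p₃ ⍮ p₄₋
    p₂ = 6 ≔ᵣ r 1 ⍮ unmatch
    p₂₋ = p₂ ⍮ p₃₋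
    p₁ = 3 ≔ᵣ op add (r 0) (# 1)
    time : cost p₁ + (cost p₂ + (cost p₃ + (cost p₄ + (cost p₅ + ((1000 + toggleTime) + (cost (6 ≔ᵣ r 2) + (1000 + toggleTime))))))) ≤ updateBound
    time = ≤-trans (≤-reflexive (collect (cost p₁) (cost p₂) (cost p₃) (cost p₄) (cost p₅) 1000 (cost (6 ≔ᵣ r 2)) toggleTime))
      (+-monoˡ-≤ (2 * toggleTime) (≤baseTime (≤ᵇ⇒≤ (cost p₁ + cost p₂ + cost p₃ + cost p₄ + cost p₅ + 1000 + cost (6 ≔ᵣ r 2) + 1000) 5000 _)))
    file′ : ℕ → ℕ → List ℕ
    file′ c x = file (toℕ j) (toℕ u) (toℕ v) c y z x i b p w
    At : Cells → ℕ → ℕ → ℕ → AState → Set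
    At κ _ x c σ = σ ≡ ⟪ file′ c x ∣ κ ⟫
    dom : ∀ {f} → f ∈ out → Dominant (edgesOf M) f
    dom = to out⇔
    dom₁ : ∀ {f} → f ∈ out₁ → Dominant (edgesOf M) f
    dom₁ f∈ = dom (proj₁ (to (∈-unmatchBelow M′ (output-matching legal inv)) f∈))
    old-class : ∀ {f i} → Dominant (edgesOf M) f → f ∈ M′ i ⇔ edgesOf M i f
    old-class (pf , _) = mk⇔
      (λ f∈ → case to ⇔R f∈ of λ { (inj₁ Rf) → Rf ; (inj₂ (_ , refl)) → contradiction pf new }) old
    rest : ∀ κ₂ → SameTables κ κ₂ → Shows (κ₂ 0 0) out₂ →
      [ ⟪ file′ c (toℕ v) ∣ κ₂ ⟫ ] p₄₋ [ cost p₄ + (cost p₅ + ((1000 + toggleTime) + (cost (6 ≔ᵣ r 2) + (1000 + toggleTime)))) , InState (edgesOf M′) out₃ ]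
    rest κ₂ same₂ shows₂ = seq-rule {p = p₄} {p₅₋} (wp-sound p₄ {Q = Matched}
        ( ((top-ok u< (h₂ u) , _) , _)
        , (λ lowerᵤ → ((top-ok v< (h₂ v) , _) , _)
          , (λ lowerᵥ → (_ , (_ , 0<Z) , (_ , u<)) , ((_ , _) , sum<2^W v< 1<Z)
              , (_ , (_ , 0<Z) , (_ , v<)) , ((_ , _) , sum<2^W u< 1<Z)
              , κ₃ , refl , sameTables κ₂ (toℕ u) (toℕ v) (toℕ v + 1) (toℕ u + 1) , added-shows (lt≢0⇒ lowerᵤ) (lt≢0⇒ lowerᵥ))
          , (λ higher → keep (λ (_ , hv) → lt≡0⇒ higher (from (new-topmost legal′ adds (h₂ v) (second∈ e)) (top-of hv)))))
        , (λ higher → keep (λ (hu , _) → lt≡0⇒ higher (from (new-topmost legal′ adds (h₂ u) (first∈ e)) (top-of hu)))) ))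
      λ { _ (κ₃ , refl , same₃ , shows₃) → tables κ₃ (λ t a c t≢0 → trans (same₃ t a c t≢0) (same₂ t a c t≢0)) shows₃ }
      where
      u< = vertex<Z u
      v< = vertex<Z v
      h₂ : ∀ x → Holds κ₂ (toℕ x) (ClassAt (edgesOf M) x)
      h₂ x = holds-cong (λ t c t≢0 _ → same₂ t _ c t≢0) (Represents.holds rep x)
      κ₃ = upd (upd κ₂ 0 0 (toℕ u) (toℕ v + 1)) 0 0 (toℕ v) (toℕ u + 1)
      Matched : AState → Set
      Matched σ = ∃[ κ₃ ] (σ ≡ ⟪ file′ c (toℕ v) ∣ κ₃ ⟫ × SameTables κ₂ κ₃ × Shows (κ₃ 0 0) out₃)
      N′⇔ : ∀ {x f} → f ∈ addN e N x ⇔ (x ∈ₑ f × Present (edgesOf M′) f)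
      N′⇔ = addN-ok {N} N⇔
      top-of : ∀ {x} → Highest M′ (addN e N x) e → Topmost (edgesOf M′) x e
      top-of {x} hx = proj₂ (proj₂ (to (highest⇔ {M′} {addN e N x} N′⇔) hx))
      of-top : ∀ {x} → x ∈ₑ e → Topmost (edgesOf M′) x e → Highest M′ (addN e N x) e
      of-top {x} x∈e top = from (highest⇔ {M′} {addN e N x} N′⇔) (x∈e , (j , added) , top)
      e? = highest? M′ (addN e N u) e ×-dec highest? M′ (addN e N v) e
      keep : ¬ (Highest M′ (addN e N u) e × Highest M′ (addN e N v) e) → Matched ⟪ file′ c (toℕ v) ∣ κ₂ ⟫
      keep ¬h with if-cases e? (out₂ ∪ ⁅ e ⁆) out₂
      ... | inj₁ (h , _)  = contradiction h ¬h
      ... | inj₂ (_ , p≡) = κ₂ , refl , (λ _ _ _ _ → refl) , subst (Shows (κ₂ 0 0)) (sym p≡) shows₂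
      added-shows : top (h₂ u) < c → top (h₂ v) < c → Shows (κ₃ 0 0) out₃
      added-shows lowᵤ lowᵥ with if-cases e? (out₂ ∪ ⁅ e ⁆) out₂
      ... | inj₂ (¬h , _) = contradiction ( of-top (first∈ e) (to (new-topmost legal′ adds (h₂ u) (first∈ e)) lowᵤ)
                                          , of-top (second∈ e) (to (new-topmost legal′ adds (h₂ v) (second∈ e)) lowᵥ)) ¬h
      ... | inj₁ (_ , p≡) = subst (Shows (κ₃ 0 0)) (sym p≡) (shows-add
        (subst IsMatching p≡ (output-matching legal′ inv′)) shows₂
        (ends-written (first∈ e) (sym (opposite-first e)) (κ₂ 0 0) (toℕ v + 1) (toℕ u + 1)
          (trans (write-first (first∈ e) (sym (opposite-first e)) (κ₂ 0 0) (toℕ v + 1) (toℕ u + 1))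
                 (trans (+-comm (toℕ v) 1) (cong (suc ∘ toℕ) (sym (opposite-first e)))))
          (trans (write-second (first∈ e) (sym (opposite-first e)) (κ₂ 0 0) (toℕ v + 1) (toℕ u + 1))
                 (trans (+-comm (toℕ u) 1) (cong (suc ∘ toℕ) (sym (opposite-second e))))))
        (write-others (first∈ e) (sym (opposite-first e)) (κ₂ 0 0) (toℕ v + 1) (toℕ u + 1)))
      tables : ∀ κ₃ → SameTables κ κ₃ → Shows (κ₃ 0 0) out₃ →
        [ ⟪ file′ c (toℕ v) ∣ κ₃ ⟫ ] p₅₋ [ cost p₅ + ((1000 + toggleTime) + (cost (6 ≔ᵣ r 2) + (1000 + toggleTime))) , InState (edgesOf M′) out₃ ]
      tables κ₃ same₃ shows₃ = seq-rule {p = p₅} {p₆₋}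
        (wp-sound p₅ {Q = _≡ ⟪ file′ c (toℕ u) ∣ κ₄ ⟫}
          ((_ , (_ , u<) , (_ , class<Z j)) , _ , (_ , (_ , v<) , (_ , class<Z j)) , _ , _ , (refl , _) , refl))
        λ { _ refl → seq-rule {p = insertClass} {p₇₋}
          (insertClass-rule u< (Finₚ.toℕ<n j) (h₄ u) (classAt-new adds legal′ (first∈ e)))
        λ { _ (y₅ , z₅ , i₅ , b₅ , p₅ , w₅ , κ₅ , refl , hu , lu) → seq-rule {p = 6 ≔ᵣ r 2} {insertClass}
          {Q = _≡ ⟪ file (toℕ j) (toℕ u) (toℕ v) c y₅ z₅ (toℕ v) i₅ b₅ p₅ w₅ ∣ κ₅ ⟫}
          (wp-sound (6 ≔ᵣ r 2) (_ , (refl , _) , refl))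
        λ { _ refl → weaken {p = insertClass} ≤-refl (finish κ₅ hu lu)
          (insertClass-rule v< (Finₚ.toℕ<n j) (holds-cong (λ t c _ _ → Local.other≡ lu t c (toℕ≢ (loopless e))) (h₄ v))
            (classAt-new adds legal′ (second∈ e))) } } }
        where
        κ₄ = upd (upd κ₃ 3 (toℕ u) c (toℕ v)) 3 (toℕ v) c (toℕ u)
        h₄ : ∀ x → Holds κ₄ (toℕ x) (ClassAt (edgesOf M) x)
        h₄ x = holds-cong same₄ (Represents.holds rep x)
          where
          same₄ : ∀ t a → t ≢ 0 → t ≢ 3 → κ₄ t (toℕ x) a ≡ κ t (toℕ x) a
          same₄ t a t≢0 t≢3 = trans (upd-other (upd κ₃ 3 (toℕ u) c (toℕ v)) {3} {toℕ v} {c} _ (λ (3≡t , _) → t≢3 (sym 3≡t)))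
            (trans (upd-other κ₃ {3} {toℕ u} {c} _ (λ (3≡t , _) → t≢3 (sym 3≡t))) (same₃ t (toℕ x) a t≢0))
        finish : ∀ κ₅ → Holds κ₅ (toℕ u) (λ c → ClassAt (edgesOf M) u c ⊎ c ≡ toℕ j) → Local κ₄ κ₅ (toℕ u) → ∀ σ →
          Changed κ₅ (toℕ v) (λ c → ClassAt (edgesOf M) v c ⊎ c ≡ toℕ j) (λ y z i b p w → file (toℕ j) (toℕ u) (toℕ v) c y z (toℕ v) i b p w) σ →
          InState (edgesOf M′) out₃ σ
        finish κ₅ hu lu _ (_ , _ , _ , _ , _ , _ , κ₆ , refl , hv , lv) =
          _ , _ , _ , _ , _ , _ , _ , _ , _ , _ , _ , κ₆ , refl , record
          { shows = shows-cong (λ a → trans (Local.output≡ lv 0 a) (Local.output≡ lu 0 a)) (mk⇔ id id) shows₃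
          ; neighbours = λ {_} {_} {x} R′f x∈f → trans (trans (Local.neighbours≡ lv (toℕ x) _) (Local.neighbours≡ lu (toℕ x) _))
              (neighbours-added adds legal′ {κ₃} (λ Rf x∈f → trans (same₃ 3 _ _ (λ ())) (Represents.neighbours rep Rf x∈f)) R′f x∈f)
          ; holds = holds-added adds legal′ h₄ hu lu hv lv
          }

module Deletion {n m : ℕ} (G : Graph n m) {W Z B Q k : ℕ} (sizes : Sizes W Z B Q k) (n<Z : n < Z) where
  open Graph G
  open Algorithm G {k} using (rematch; Highest; removeN; deleteStep)
  open Combinatorics G {k}
  open Preservation G {k}
  open Display G {k}
  open Sizes sizes using (8≤2^W; 8ZZ≤2^W)
  open Programs W Z 8≤2^W 8ZZ≤2^W
  open Machine sizes
  open Classes sizes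
  open ClassUpdates sizes
  open ClassRemoval sizes
  open Simulation G sizes n<Z
  open Insertion G sizes n<Z

  Rematched : (ℕ → ℕ → List ℕ) → Cells → Subset m → AState → Set
  Rematched regs′ κ S σ = ∃[ y ] ∃[ z ] ∃[ κ′ ] (σ ≡ ⟪ regs′ y z ∣ κ′ ⟫ × SameTables κ κ′ × Shows (κ′ 0 0) S)

  rematch-rule : ∀ {M N S κ x j u v c y z i b p w} → Legal (edgesOf M) → (∀ {x f} → f ∈ N x ⇔ (x ∈ₑ f × Present (edgesOf M) f)) →
    (∀ {f} → f ∈ S → Dominant (edgesOf M) f) →
    (∀ {i f x} → edgesOf M i f → x ∈ₑ f → κ 3 (toℕ x) (suc (toℕ i)) ≡ toℕ (opposite f x)) →
    (∀ x → Holds κ (toℕ x) (ClassAt (edgesOf M) x)) → Shows (κ 0 0) S →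
    [ ⟪ file j u v c y z (toℕ x) i b p w ∣ κ ⟫ ] rematchProgram
      [ cost rematchProgram , Rematched (λ y z → file j u v c y z (toℕ x) i b p w) κ (rematch M N x S) ]
  rematch-rule {M} {N} {S} {κ} {x} {j} {u} {v} {c} {y} {z} {i} {b} {p} {w} legal N⇔ dom nb holds shows =
    wp-sound rematchProgram {Q = Post} (top-ok x< h , (refl , _) , _ , cases (top-attained h))
    where
    x< = vertex<Z x
    h = holds x
    regs′ : ℕ → ℕ → List ℕ
    regs′ y z = file j u v c y z (toℕ x) i b p w
    Post = Rematched regs′ κ (rematch M N x S)
    inner = branch (op eq (topOf (r 5)) (r 4)) (match (r 6) (r 5)) nop
    highest : ∀ {x g} → x ∈ₑ g → Present (edgesOf M) g → Topmost (edgesOf M) x g → Highest M (N x) g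
    highest {x} x∈g pg topmost = from (highest⇔ {M} {N x} N⇔) (x∈g , pg , topmost)
    of-highest : ∀ {x g} → Highest M (N x) g → x ∈ₑ g × Present (edgesOf M) g × Topmost (edgesOf M) x g
    of-highest {x} = to (highest⇔ {M} {N x} N⇔)
    unchanged : ∀ y z → rematch M N x S ≡ S → Post ⟪ regs′ y z ∣ κ ⟫
    unchanged y z p≡ = y , z , κ , refl , (λ _ _ _ _ → refl) , subst (Shows (κ 0 0)) (sym p≡) shows
    cases : top h ≡ 0 ⊎ ∃[ c ] (top h ≡ suc c × ClassAt (edgesOf M) x c) →
      (top h ≢ 0 → wp (5 ≔ᵣ cell 3 (r 6) (r 4) ⍮ inner) Post ⟪ regs′ (top h) z ∣ κ ⟫) ×
      (top h ≡ 0 → Post ⟪ regs′ (top h) z ∣ κ ⟫)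
    cases (inj₁ top≡0) = (λ top≢0 → contradiction top≡0 top≢0) , λ _ → unchanged (top h) z (none (rematch-cases M N x S))
      where
      none : (∃[ f ] (Highest M (N x) f × _)) ⊎ ((∀ f → ¬ Highest M (N x) f) × rematch M N x S ≡ S) → rematch M N x S ≡ S
      none (inj₂ (_ , p≡)) = p≡
      none (inj₁ (f , hf , _)) = let x∈f , (i , Rf) , _ = of-highest hf in
        contradiction (subst (suc (toℕ i) ≤_) top≡0 (≤top h (i , f , refl , Rf , x∈f))) λ ()
    cases (inj₂ (_ , top≡ , i₁ , g , refl , Rg , x∈g)) = (λ _ →
        (_ , (_ , x<) , (_ , top<)) , (refl , _) , subst (λ a → wp inner Post ⟪ regs′ (top h) a ∣ κ ⟫) (sym a≡)
          (((top-ok y< (holds o) , _) , _) , (λ same → matched (trans (eq≢0⇒ same) top≡))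
                                           , (λ differ → unmatched (λ o≡ → eq≡0⇒ differ (trans o≡ (sym top≡))))))
      , λ top≡0 → case trans (sym top≡) top≡0 of λ ()
      where
      o = opposite g x
      y< = vertex<Z o
      o∈g = opposite∈ x∈g
      top< : top h < Z
      top< = subst (_< Z) (sym top≡) (class<Z i₁)
      a≡ : κ 3 (toℕ x) (top h) ≡ toℕ o
      a≡ = trans (cong (κ 3 (toℕ x)) top≡) (nb Rg x∈g)
      topmost-g : Topmost (edgesOf M) x g
      topmost-g = to (class-topmost legal h Rg x∈g) top≡
      g-only : ∀ {f} → Highest M (N x) f → f ≡ g
      g-only hf = let x∈f , pf , topmost = of-highest hf in topmost-unique legal x∈f x∈g pf (i₁ , Rg) topmost topmost-g
      unmatched : top (holds o) ≢ suc (toℕ i₁) → Post ⟪ regs′ (top h) (toℕ o) ∣ κ ⟫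
      unmatched o≢ with rematch-cases M N x S
      ... | inj₂ (_ , p≡) = unchanged (top h) (toℕ o) p≡
      ... | inj₁ (f , hf , rest) with refl ← g-only hf | rest
      ...   | inj₂ (_ , p≡) = unchanged (top h) (toℕ o) p≡
      ...   | inj₁ (ho , _) = contradiction (from (class-topmost legal (holds o) Rg o∈g) (proj₂ (proj₂ (of-highest ho)))) o≢
      matched : top (holds o) ≡ suc (toℕ i₁) → wp (match (r 6) (r 5)) Post ⟪ regs′ (top h) (toℕ o) ∣ κ ⟫
      matched o≡ = (_ , (_ , 0<Z) , (_ , x<)) , ((_ , _) , sum<2^W y< 1<Z)
                 , (_ , (_ , 0<Z) , (_ , y<)) , ((_ , _) , sum<2^W x< 1<Z)
                 , top h , toℕ o , κ′ , refl , sameTables κ (toℕ x) (toℕ o) (toℕ o + 1) (toℕ x + 1) , added (rematch-cases M N x S)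
        where
        κ′ = upd (upd κ 0 0 (toℕ x) (toℕ o + 1)) 0 0 (toℕ o) (toℕ x + 1)
        topmost-o : Topmost (edgesOf M) o g
        topmost-o = to (class-topmost legal (holds o) Rg o∈g) o≡
        dominant-g : Dominant (edgesOf M) g
        dominant-g = (i₁ , Rg) , λ a a∈g → case end-cases x∈g a∈g of λ { (inj₁ refl) → topmost-g ; (inj₂ refl) → topmost-o }
        matching : IsMatching (S ∪ ⁅ g ⁆)
        matching e∈ f∈ = dominant-matching legal (dominant (to (∈-add⇔ {p = S}) e∈)) (dominant (to (∈-add⇔ {p = S}) f∈))
          where
          dominant : ∀ {f} → f ∈ S ⊎ f ≡ g → Dominant (edgesOf M) f
          dominant (inj₁ f∈) = dom f∈
          dominant (inj₂ refl) = dominant-g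
        added : (∃[ f ] (Highest M (N x) f ×
          ((Highest M (N (opposite f x)) f × rematch M N x S ≡ S ∪ ⁅ f ⁆) ⊎ (¬ Highest M (N (opposite f x)) f × rematch M N x S ≡ S)))) ⊎
          ((∀ f → ¬ Highest M (N x) f) × rematch M N x S ≡ S) → Shows (κ′ 0 0) (rematch M N x S)
        added (inj₂ (none , _)) = contradiction (highest x∈g (i₁ , Rg) topmost-g) (none g)
        added (inj₁ (f , hf , rest)) with refl ← g-only hf | rest
        ... | inj₂ (¬ho , _) = contradiction (highest o∈g (i₁ , Rg) topmost-o) ¬ho
        ... | inj₁ (_ , p≡) = subst (Shows (κ′ 0 0)) (sym p≡) (shows-add matching shows
          (ends-written x∈g refl (κ 0 0) (toℕ o + 1) (toℕ x + 1)
            (trans (write-first x∈g refl (κ 0 0) (toℕ o + 1) (toℕ x + 1)) (+-comm (toℕ o) 1))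
            (trans (write-second x∈g refl (κ 0 0) (toℕ o + 1) (toℕ x + 1))
              (trans (+-comm (toℕ x) 1) (cong (suc ∘ toℕ) (sym (opposite-involutive x∈g))))))
          (write-others x∈g refl (κ 0 0) (toℕ o + 1) (toℕ x + 1)))

  module _ {R R′ : Classes} {j : Fin k} {e : Fin m} (adds : Adds R R′ j e) (legal′ : Legal R′) where

    classAt-removed : ∀ {x} → x ∈ₑ e → ∀ c → ClassAt R x c ⇔ (ClassAt R′ x c × c ≢ toℕ j)
    classAt-removed x∈e c = mk⇔
      (λ at → from (classAt-end adds legal′ x∈e c) (inj₁ at) , λ { refl → classAt-new adds legal′ x∈e at })
      (λ (at , c≢) → case to (classAt-end adds legal′ x∈e c) at of λ { (inj₁ at) → at ; (inj₂ c≡) → contradiction c≡ c≢ })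

    holds-removed : ∀ {κ κ₁ κ₂} → (∀ x → Holds κ (toℕ x) (ClassAt R′ x)) →
      let u = proj₁ (ends e) ; v = proj₂ (ends e) in
      Holds κ₁ (toℕ u) (λ c → ClassAt R′ u c × c ≢ toℕ j) → Local κ κ₁ (toℕ u) →
      Holds κ₂ (toℕ v) (λ c → ClassAt R′ v c × c ≢ toℕ j) → Local κ₁ κ₂ (toℕ v) →
      ∀ x → Holds κ₂ (toℕ x) (ClassAt R x)
    holds-removed h hu lu hv lv x with x Fin.≟ proj₂ (ends e) | x Fin.≟ proj₁ (ends e)
    ... | yes refl | _ = holds-⇔ (classAt-removed (second∈ e)) hv
    ... | no x≢v | yes refl = holds-cong (λ t c _ _ → Local.other≡ lv t c (toℕ≢ (x≢v ∘ sym))) (holds-⇔ (classAt-removed (first∈ e)) hu)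
    ... | no x≢v | no x≢u = holds-cong (λ t c _ _ → trans (Local.other≡ lv t c (toℕ≢ (x≢v ∘ sym))) (Local.other≡ lu t c (toℕ≢ (x≢u ∘ sym))))
      (holds-⇔ (λ c → mk⇔ (to (flipped c)) (from (flipped c))) (h x))
      where
      flipped : ∀ c → ClassAt R x c ⇔ ClassAt R′ x c
      flipped c = let e⇔ = classAt-other adds legal′ [ x≢u , x≢v ]′ c in mk⇔ (from e⇔) (to e⇔)

  collect′ : ∀ a b c f g d e T → a + (b + (c + ((f + T) + (g + ((f + T) + (d + e)))))) ≡ a + b + c + f + g + f + d + e + 2 * T
  collect′ = solve 8 (λ a b c f g d e T → a :+ (b :+ (c :+ ((f :+ T) :+ (g :+ ((f :+ T) :+ (d :+ e))))))
                       := a :+ b :+ c :+ f :+ g :+ f :+ d :+ e :+ con 2 :* T) refl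
    where open +-*-Solver

  delete-rule : ∀ {M M′ A j e c y z x i b p w κ} → Legal (edgesOf M) → Legal (edgesOf M′) → Adds (edgesOf M′) (edgesOf M) j e →
    Invariant (edgesOf M) A → Represents (edgesOf M) (AlgState.out A) κ →
    [ ⟪ file (toℕ j) (toℕ (proj₁ (ends e))) (toℕ (proj₂ (ends e))) c y z x i b p w ∣ κ ⟫ ] deleteProgram
      [ updateBound , InState (edgesOf M′) (AlgState.out (deleteStep M′ e A)) ]
  delete-rule {M} {M′} {A@(⟨ N , out ⟩)} {j} {e} {c₀} {y} {z} {x₀} {i} {b} {p} {w} {κ} legal legal′ adds inv rep =
    weaken {p = deleteProgram} time (λ _ q → q)
      (seq-rule {p = p₁} {p₂₋} (wp-sound p₁ {Q = _≡ ⟪ file′ c x₀ ∣ κ ⟫}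
        (((_ , _) , sum<2^W (<-trans (n<1+n _) (class<Z j)) 1<Z) , (refl , _) , cong (λ c → ⟪ file′ c x₀ ∣ κ ⟫) (+-comm (toℕ j) 1)))
      λ { _ refl → seq-rule {p = p₂} {p₃₋} (wp-sound p₂ {Q = Cleared}
        ( (((_ , (_ , 0<Z) , (_ , u<)) , ((_ , _) , sum<2^W v< 1<Z)) , _)
        , (λ same → (_ , (_ , 0<Z) , (_ , u<)) , _ , (_ , (_ , 0<Z) , (_ , v<)) , _
            , κ₁ , refl , sameTables κ (toℕ u) (toℕ v) 0 0 , cleared (trans (eq≢0⇒ same) (+-comm (toℕ v) 1)))
        , (λ differ → κ , refl , (λ _ _ _ _ → refl) , kept (λ o≡ → eq≡0⇒ differ (trans o≡ (+-comm 1 (toℕ v))))) ))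
      λ { _ (κ₁ , refl , same₁ , shows₁) → rest κ₁ same₁ shows₁ } })
    where
    open Invariant inv
    open Adds adds
    u = proj₁ (ends e)
    v = proj₂ (ends e)
    u< = vertex<Z u
    v< = vertex<Z v
    c = suc (toℕ j)
    N′ = removeN e N
    out₁ = rematch M′ N′ u (out - e)
    out₂ = AlgState.out (deleteStep M′ e A)
    inv′ = delete-invariant {M} {M′} legal legal′ adds inv
    file′ : ℕ → ℕ → List ℕ
    file′ c x = file (toℕ j) (toℕ u) (toℕ v) c y z x i b p w
    p₈ = 6 ≔ᵣ r 2 ⍮ rematchProgram
    p₇ = 6 ≔ᵣ r 1 ⍮ rematchProgram
    p₇₋ = p₇ ⍮ p₈
    p₆₋ = deleteClass ⍮ p₇₋
    p₅₋ = 6 ≔ᵣ r 2 ⍮ p₆₋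
    p₄₋ = deleteClass ⍮ p₅₋
    p₃₋ = 6 ≔ᵣ r 1 ⍮ p₄₋
    p₂ = branch (op eq (mate (r 1)) (op add (r 2) (# 1))) (setMate (r 1) (# 0) ⍮ setMate (r 2) (# 0)) nop
    p₂₋ = p₂ ⍮ p₃₋
    p₁ = 3 ≔ᵣ op add (r 0) (# 1)
    time : cost p₁ + (cost p₂ + (cost (6 ≔ᵣ r 1) + ((1000 + toggleTime) + (cost (6 ≔ᵣ r 2) + ((1000 + toggleTime) + (cost p₇ + cost p₈)))))) ≤ updateBound
    time = ≤-trans (≤-reflexive (collect′ (cost p₁) (cost p₂) (cost (6 ≔ᵣ r 1)) 1000 (cost (6 ≔ᵣ r 2)) (cost p₇) (cost p₈) toggleTime))
      (+-monoˡ-≤ (2 * toggleTime) (≤baseTime (≤ᵇ⇒≤ (cost p₁ + cost p₂ + cost (6 ≔ᵣ r 1) + 1000 + cost (6 ≔ᵣ r 2) + 1000 + cost p₇ + cost p₈) 5000 _)))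
    κ₁ = upd (upd κ 0 0 (toℕ u) 0) 0 0 (toℕ v) 0
    Cleared : AState → Set
    Cleared σ = ∃[ κ₁ ] (σ ≡ ⟪ file′ c x₀ ∣ κ₁ ⟫ × SameTables κ κ₁ × Shows (κ₁ 0 0) (out - e))
    shows = Represents.shows rep
    u-mate : ∀ {f} → f ∈ out → u ∈ₑ f → κ 0 0 (toℕ u) ≡ suc (toℕ v) → f ≡ e
    u-mate {f} f∈ u∈f o≡ = same-ends u∈f (first∈ e) (Finₚ.toℕ-injective (suc-injective
      (trans (sym (Shows.matched shows u f f∈ u∈f)) (trans o≡ (cong (suc ∘ toℕ) (sym (opposite-first e)))))))
    cleared : κ 0 0 (toℕ u) ≡ suc (toℕ v) → Shows (κ₁ 0 0) (out - e)
    cleared o≡ with mate-cases shows u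
    ... | inj₁ (o≡0 , _) = case trans (sym o≡) o≡0 of λ ()
    ... | inj₂ (f , f∈ , u∈f , _) with refl ← u-mate f∈ u∈f o≡ =
      shows-remove (output-matching legal inv) f∈ shows
        (ends-written (first∈ e) (sym (opposite-first e)) (κ 0 0) 0 0
          (write-first (first∈ e) (sym (opposite-first e)) (κ 0 0) 0 0) (write-second (first∈ e) (sym (opposite-first e)) (κ 0 0) 0 0))
        (write-others (first∈ e) (sym (opposite-first e)) (κ 0 0) 0 0)
    kept : κ 0 0 (toℕ u) ≢ suc (toℕ v) → Shows (κ 0 0) (out - e)
    kept o≢ = shows-cong (λ _ → refl) (mk⇔
      (λ f∈ → from ∈-remove⇔ (f∈ , λ { refl → o≢ (trans (Shows.matched shows u e f∈ (first∈ e)) (cong (suc ∘ toℕ) (opposite-first e))) }))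
      (λ f∈ → proj₁ (to (∈-remove⇔ {p = out}) f∈))) shows
    rest : ∀ κ₁ → SameTables κ κ₁ → Shows (κ₁ 0 0) (out - e) →
      [ ⟪ file′ c x₀ ∣ κ₁ ⟫ ] p₃₋ [ cost (6 ≔ᵣ r 1) + ((1000 + toggleTime) + (cost (6 ≔ᵣ r 2) + ((1000 + toggleTime) + (cost p₇ + cost p₈)))) , InState (edgesOf M′) out₂ ]
    rest κ₁ same₁ shows₁ = seq-rule {p = 6 ≔ᵣ r 1} {p₄₋} {Q = _≡ ⟪ file′ c (toℕ u) ∣ κ₁ ⟫} (wp-sound (6 ≔ᵣ r 1) (_ , (refl , _) , refl))
      λ { _ refl → seq-rule {p = deleteClass} {p₅₋} (deleteClass-rule u< (h₁ u) (j , e , refl , added , first∈ e))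
      λ { _ (y₂ , z₂ , i₂ , b₂ , p₂ , w₂ , κ₂ , refl , hu , lu) → seq-rule {p = 6 ≔ᵣ r 2} {p₆₋}
        {Q = _≡ ⟪ file (toℕ j) (toℕ u) (toℕ v) c y₂ z₂ (toℕ v) i₂ b₂ p₂ w₂ ∣ κ₂ ⟫} (wp-sound (6 ≔ᵣ r 2) (_ , (refl , _) , refl))
      λ { _ refl → seq-rule {p = deleteClass} {p₇₋} (deleteClass-rule v<
          (holds-cong (λ t c _ _ → Local.other≡ lu t c (toℕ≢ (loopless e))) (h₁ v)) (j , e , refl , added , second∈ e))
      λ { _ (y₃ , z₃ , i₃ , b₃ , p₃ , w₃ , κ₃ , refl , hv , lv) → rematches {y₃} {z₃} {i₃} {b₃} {p₃} {w₃} κ₃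
          (holds-removed adds legal h₁ hu lu hv lv)
          (λ {_} {_} {x} R′f x∈f → trans (trans (Local.neighbours≡ lv (toℕ x) _) (Local.neighbours≡ lu (toℕ x) _))
            (trans (same₁ 3 _ _ (λ ())) (Represents.neighbours rep (old R′f) x∈f)))
          (shows-cong (λ a → trans (Local.output≡ lv 0 a) (Local.output≡ lu 0 a)) (mk⇔ id id) shows₁) } } } }
      where
      h₁ : ∀ x → Holds κ₁ (toℕ x) (ClassAt (edgesOf M) x)
      h₁ x = holds-cong (λ t c t≢0 _ → same₁ t _ c t≢0) (Represents.holds rep x)
      N′⇔ : ∀ {x f} → f ∈ N′ x ⇔ (x ∈ₑ f × Present (edgesOf M′) f)
      N′⇔ = Invariant.N⇔ inv′
      dom : ∀ {f} → f ∈ out - e → Dominant (edgesOf M′) f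
      dom f∈ with to (∈-remove⇔ {p = out}) f∈
      ... | f∈out , f≢e with to Present⇔ (proj₁ (to out⇔ f∈out))
      ...   | inj₁ pf = shrink-dominant pf (to out⇔ f∈out)
      ...   | inj₂ f≡e = contradiction f≡e f≢e
      dom₁ : ∀ {f} → f ∈ out₁ → Dominant (edgesOf M′) f
      dom₁ {f} f∈ = case to (∈-rematch {M′} {N′} legal′ N′⇔ f) f∈ of λ { (inj₁ f∈) → dom f∈ ; (inj₂ (_ , d)) → d }
      rematches : ∀ {y z i b p w} κ₃ → (∀ x → Holds κ₃ (toℕ x) (ClassAt (edgesOf M′) x)) →
        (∀ {i f x} → edgesOf M′ i f → x ∈ₑ f → κ₃ 3 (toℕ x) (suc (toℕ i)) ≡ toℕ (opposite f x)) → Shows (κ₃ 0 0) (out - e) →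
        [ ⟪ file (toℕ j) (toℕ u) (toℕ v) c y z (toℕ v) i b p w ∣ κ₃ ⟫ ] p₇₋ [ cost p₇ + cost p₈ , InState (edgesOf M′) out₂ ]
      rematches {y} {z} {i} {b} {p} {w} κ₃ h₃ nb₃ shows₃ = seq-rule {p = p₇} {p₈}
        (seq-rule {p = 6 ≔ᵣ r 1} {rematchProgram} {Q = _≡ ⟪ file (toℕ j) (toℕ u) (toℕ v) c y z (toℕ u) i b p w ∣ κ₃ ⟫}
          (wp-sound (6 ≔ᵣ r 1) (_ , (refl , _) , refl)) λ { _ refl → rematch-rule {M′} {N′} legal′ N′⇔ dom nb₃ h₃ shows₃ })
        λ { _ (y₄ , z₄ , κ₄ , refl , same₄ , shows₄) →
        seq-rule {p = 6 ≔ᵣ r 2} {rematchProgram} {Q = _≡ ⟪ file (toℕ j) (toℕ u) (toℕ v) c y₄ z₄ (toℕ v) i b p w ∣ κ₄ ⟫}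
          (wp-sound (6 ≔ᵣ r 2) (_ , (refl , _) , refl)) λ { _ refl → weaken {p = rematchProgram} ≤-refl
            (λ { _ (_ , _ , κ₅ , refl , same₅ , shows₅) → _ , _ , _ , _ , _ , _ , _ , _ , _ , _ , _ , κ₅ , refl , record
              { shows = shows₅
              ; neighbours = λ R′f x∈f → trans (trans (same₅ 3 _ _ (λ ())) (same₄ 3 _ _ (λ ()))) (nb₃ R′f x∈f)
              ; holds = λ x → holds-cong (λ t c t≢0 _ → trans (same₅ t _ c t≢0) (same₄ t _ c t≢0)) (h₃ x) } })
            (rematch-rule {M′} {N′} legal′ N′⇔ dom₁ (λ R′f x∈f → trans (same₄ 3 _ _ (λ ())) (nb₃ R′f x∈f))
              (λ x → holds-cong (λ t c t≢0 _ → same₄ t _ c t≢0) (h₃ x)) shows₄) } }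

initBody initLoop : Co

initBody =
  (3 ≔ᵣ op add (cell 0 (# 0) (r 4)) (# 1) ⍮
   1 ≔ᵣ cell 0 (# 0) (op add (# 1) (r 4)) ⍮
   2 ≔ᵣ cell 0 (# 0) (op add (# 2) (r 4))) ⍮
  branch (topOf (r 1)) nop (branch (topOf (r 2)) nop (match (r 1) (r 2))) ⍮
  (write 3 (r 1) (r 3) (r 2) ⍮ write 3 (r 2) (r 3) (r 1) ⍮ 6 ≔ᵣ r 1) ⍮
  append ⍮
  6 ≔ᵣ r 2 ⍮
  append ⍮
  (4 ≔ᵣ op add (# 3) (r 4) ⍮ 8 ≔ᵣ op sub (r 8) (# 1))

initLoop = loop (r 8) initBody

module Initialization {n m : ℕ} (G : Graph n m) {W Z B Q k : ℕ} (sizes : Sizes W Z B Q k) (n<Z : n < Z) where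
  open Graph G
  open Algorithm G {k} using (initStep)
  open Combinatorics G {k}
  open Preservation G {k}
  open Display G {k}
  open Sizes sizes using (8≤2^W; 8ZZ≤2^W)
  open Programs W Z 8≤2^W 8ZZ≤2^W
  open Machine sizes
  open Classes sizes
  open ClassUpdates sizes
  open ClassRemoval sizes
  open Simulation G sizes n<Z
  open Insertion G sizes n<Z

  record Loading (xs : List (Fin k × Fin m)) (R : Classes) (S : Subset m) (κ : Cells) (ptr : ℕ) : Set where
    field
      represents : Represents R S κ
      unflagged  : ∀ x c → κ 7 x c ≡ 0
      input      : ∀ q → κ 0 0 (q + ptr) ≡ words (concatMap (triple G) xs) q
      beyond     : n ≤ ptr
      room       : ptr + 3 * length xs < Z

  LoadState : List (Fin k × Fin m) → Classes → Subset m → AState → Set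
  LoadState xs R S σ = ∃[ a ] ∃[ u ] ∃[ v ] ∃[ c ] ∃[ ptr ] ∃[ z ] ∃[ x ] ∃[ i ] ∃[ p ] ∃[ w ] ∃[ κ ]
    (σ ≡ ⟪ file a u v c ptr z x i (length xs) p w ∣ κ ⟫ × Loading xs R S κ ptr)

  bodyTime : ℕ
  bodyTime = 2000

  body-rule : ∀ {j e xs R R′ A a u₀ v₀ c₀ ptr z x₀ i p w κ} → Adds R R′ j e → Legal R′ → (∀ {i f} → R i f → j Fin.≤ i) →
    Invariant R A → Loading ((j , e) ∷ xs) R (AlgState.out A) κ ptr →
    [ ⟪ file a u₀ v₀ c₀ ptr z x₀ i (suc (length xs)) p w ∣ κ ⟫ ] initBody
      [ bodyTime , LoadState xs R′ (AlgState.out (initStep A (j , e))) ]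
  body-rule {j} {e} {xs} {R} {R′} {A@(⟨ N , out ⟩)} {a} {u₀} {v₀} {c₀} {ptr} {z} {x₀} {i} {p} {w} {κ} adds legal′ j≤ inv loading =
    weaken {p = initBody} (≤ᵇ⇒≤ (cost initBody) bodyTime _) (λ _ q → q)
      (seq-rule {p = p₁} {p₂₋} (wp-sound p₁ {Q = _≡ ⟪ file′ ∣ κ ⟫}
        ( ((((_ , (_ , 0<Z) , (_ , <Z 0 z≤n)) , _) , subst (λ d → d + 1 < 2 ^ W) (sym (input 0)) (sum<2^W (<-trans (n<1+n _) (class<Z j)) 1<Z)) , (refl , _)
          , ((_ , (_ , 0<Z) , ((_ , lift< (<Z 1 (s≤s z≤n))) , <Z 1 (s≤s z≤n))) , (refl , _)
            , (_ , (_ , 0<Z) , ((_ , lift< (<Z 2 (s≤s (s≤s z≤n)))) , <Z 2 (s≤s (s≤s z≤n)))) , (refl , _)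
            , loaded))))
      λ { _ refl → seq-rule {p = p₂} {p₃₋} (wp-sound p₂ {Q = Matched}
        ( top-ok u< hu₀
        , (λ ≢0 → keep (λ (empty , _) → ≢0 (empty⇒ u empty)))
        , λ ≡0 → top-ok v< hv₀
          , (λ ≢0 → keep (λ (_ , empty) → ≢0 (empty⇒ v empty)))
          , λ ≡0′ → (_ , (_ , 0<Z) , (_ , u<)) , ((_ , _) , sum<2^W v< 1<Z)
              , (_ , (_ , 0<Z) , (_ , v<)) , ((_ , _) , sum<2^W u< 1<Z)
              , κ₁ , refl , sameTables κ (toℕ u) (toℕ v) (toℕ v + 1) (toℕ u + 1) , far , added-shows (⇒empty u ≡0) (⇒empty v ≡0′) ))
      λ { _ (κ₂ , refl , same₂ , far₂ , shows₂) → tables κ₂ same₂ far₂ shows₂ } })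
    where
    open Loading loading
    open Adds adds
    open Invariant inv
    u = proj₁ (ends e)
    v = proj₂ (ends e)
    u< = vertex<Z u
    v< = vertex<Z v
    c = suc (toℕ j)
    out′ = AlgState.out (initStep A (j , e))
    inv′ = initStep-invariant legal′ adds j≤ inv
    p₇ = 4 ≔ᵣ op add (# 3) (r 4) ⍮ 8 ≔ᵣ op sub (r 8) (# 1)
    p₆₋ = append ⍮ p₇
    p₅₋ = 6 ≔ᵣ r 2 ⍮ p₆₋
    p₄₋ = append ⍮ p₅₋
    p₃ = write 3 (r 1) (r 3) (r 2) ⍮ write 3 (r 2) (r 3) (r 1) ⍮ 6 ≔ᵣ r 1
    p₃₋ = p₃ ⍮ p₄₋
    p₂ = branch (topOf (r 1)) nop (branch (topOf (r 2)) nop (match (r 1) (r 2)))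
    p₂₋ = p₂ ⍮ p₃₋
    p₁ = 3 ≔ᵣ op add (cell 0 (# 0) (r 4)) (# 1) ⍮ 1 ≔ᵣ cell 0 (# 0) (op add (# 1) (r 4)) ⍮ 2 ≔ᵣ cell 0 (# 0) (op add (# 2) (r 4))
    length< : suc (length xs) < Z
    length< = ≤-<-trans (≤-trans (m≤n*m (suc (length xs)) 3) (m≤n+m (3 * suc (length xs)) ptr)) room
    file′ : List ℕ
    file′ = file a (toℕ u) (toℕ v) c ptr z x₀ i (suc (length xs)) p w
    3+ptr≤ : 3 + ptr + 3 * length xs < Z
    3+ptr≤ = subst (_< Z) (solve 2 (λ p l → p :+ con 3 :* (con 1 :+ l) := con 3 :+ p :+ con 3 :* l) refl ptr (length xs)) room
      where open +-*-Solver
    <Z : ∀ q → q ≤ 2 → q + ptr < Z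
    <Z q q≤2 = ≤-<-trans (≤-trans (+-monoˡ-≤ ptr (m≤n⇒m≤1+n q≤2)) (m≤m+n (3 + ptr) _)) 3+ptr≤
    loaded : ⟪ file a (κ 0 0 (1 + ptr)) (κ 0 0 (2 + ptr)) (κ 0 0 ptr + 1) ptr z x₀ i (suc (length xs)) p w ∣ κ ⟫ ≡ ⟪ file′ ∣ κ ⟫
    loaded rewrite input 0 | input 1 | input 2 | +-comm (toℕ j) 1 = refl
    h = Represents.holds represents
    hu₀ = h u
    hv₀ = h v
    empty⇒ : ∀ x → ¬ Sub.Nonempty (N x) → top (h x) ≡ 0
    empty⇒ x empty with top-attained (h x)
    ... | inj₁ top≡0 = top≡0
    ... | inj₂ (_ , _ , i , f , _ , Rf , x∈f) = contradiction (f , from N⇔ (x∈f , i , Rf)) empty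
    ⇒empty : ∀ x → top (h x) ≡ 0 → ¬ Sub.Nonempty (N x)
    ⇒empty x top≡0 (f , f∈) with to N⇔ f∈
    ... | x∈f , i , Rf = contradiction (subst (suc (toℕ i) ≤_) top≡0 (≤top (h x) (i , f , refl , Rf , x∈f))) λ ()
    κ₁ = upd (upd κ 0 0 (toℕ u) (toℕ v + 1)) 0 0 (toℕ v) (toℕ u + 1)
    Matched : AState → Set
    Matched σ = ∃[ κ₂ ] (σ ≡ ⟪ file′ ∣ κ₂ ⟫ × SameTables κ κ₂ × (∀ a → n ≤ a → κ₂ 0 0 a ≡ κ 0 0 a) × Shows (κ₂ 0 0) out′)
    far : ∀ a → n ≤ a → κ₁ 0 0 a ≡ κ 0 0 a
    far a n≤a = trans (↦-other (κ 0 0 [ toℕ u ↦ toℕ v + 1 ]) (toℕ u + 1) (<⇒≢ (<-≤-trans (Finₚ.toℕ<n v) n≤a)))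
      (↦-other (κ 0 0) (toℕ v + 1) (<⇒≢ (<-≤-trans (Finₚ.toℕ<n u) n≤a)))
    e? = ¬? (Subₚ.nonempty? (N u)) ×-dec ¬? (Subₚ.nonempty? (N v))
    keep : ¬ (¬ Sub.Nonempty (N u) × ¬ Sub.Nonempty (N v)) → Matched ⟪ file′ ∣ κ ⟫
    keep ¬empty with if-cases e? (out ∪ ⁅ e ⁆) out
    ... | inj₁ (empty , _) = contradiction empty ¬empty
    ... | inj₂ (_ , p≡) = κ , refl , (λ _ _ _ _ → refl) , (λ _ _ → refl) , subst (Shows (κ 0 0)) (sym p≡) (Represents.shows represents)
    added-shows : ¬ Sub.Nonempty (N u) → ¬ Sub.Nonempty (N v) → Shows (κ₁ 0 0) out′
    added-shows emptyᵤ emptyᵥ with if-cases e? (out ∪ ⁅ e ⁆) out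
    ... | inj₂ (¬empty , _) = contradiction (emptyᵤ , emptyᵥ) ¬empty
    ... | inj₁ (_ , p≡) = subst (Shows (κ₁ 0 0)) (sym p≡) (shows-add
      (subst IsMatching p≡ (output-matching legal′ inv′)) (Represents.shows represents)
      (ends-written (first∈ e) (sym (opposite-first e)) (κ 0 0) (toℕ v + 1) (toℕ u + 1)
        (trans (write-first (first∈ e) (sym (opposite-first e)) (κ 0 0) (toℕ v + 1) (toℕ u + 1))
               (trans (+-comm (toℕ v) 1) (cong (suc ∘ toℕ) (sym (opposite-first e)))))
        (trans (write-second (first∈ e) (sym (opposite-first e)) (κ 0 0) (toℕ v + 1) (toℕ u + 1))
               (trans (+-comm (toℕ u) 1) (cong (suc ∘ toℕ) (sym (opposite-second e))))))
      (write-others (first∈ e) (sym (opposite-first e)) (κ 0 0) (toℕ v + 1) (toℕ u + 1)))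
    tables : ∀ κ₂ → SameTables κ κ₂ → (∀ a → n ≤ a → κ₂ 0 0 a ≡ κ 0 0 a) → Shows (κ₂ 0 0) out′ →
      [ ⟪ file′ ∣ κ₂ ⟫ ] p₃₋ [ cost p₃₋ , LoadState xs R′ out′ ]
    tables κ₂ same₂ far₂ shows₂ = seq-rule {p = p₃} {p₄₋}
      (wp-sound p₃ {Q = _≡ ⟪ file a (toℕ u) (toℕ v) c ptr z (toℕ u) i (suc (length xs)) p w ∣ κ₃ ⟫}
        ((_ , (_ , u<) , (_ , class<Z j)) , _ , (_ , (_ , v<) , (_ , class<Z j)) , _ , _ , (refl , _) , refl))
      λ { _ refl → seq-rule {p = append} {p₅₋} (append-rule u< (Finₚ.toℕ<n j) (h₃ u) (above (first∈ e)) (unflagged₃ (toℕ u) c))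
      λ { _ (i₄ , κ₄ , refl , hu , lu , flags₄) →
        seq-rule {p = 6 ≔ᵣ r 2} {p₆₋} {Q = _≡ ⟪ file a (toℕ u) (toℕ v) c ptr z (toℕ v) i₄ (suc (length xs)) p w ∣ κ₄ ⟫}
          (wp-sound (6 ≔ᵣ r 2) (_ , (refl , _) , refl))
      λ { _ refl → seq-rule {p = append} {p₇} (append-rule v< (Finₚ.toℕ<n j)
          (holds-cong (λ t c _ _ → Local.other≡ lu t c (toℕ≢ (loopless e))) (h₃ v)) (above (second∈ e))
          (trans (flags₄ (toℕ v) c) (unflagged₃ (toℕ v) c)))
      λ { _ (i₅ , κ₅ , refl , hv , lv , flags₅) → wp-sound p₇ {Q = LoadState xs R′ out′}
          ( ((_ , _) , lift< (≤-<-trans (m≤m+n (3 + ptr) _) 3+ptr≤)) , (refl , _)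
          , ((_ , _) , (s≤s z≤n , lift< length<)) , (refl , _)
          , a , toℕ u , toℕ v , c , 3 + ptr , z , toℕ v , i₅ , p , w , κ₅ , refl , record
            { represents = record
              { shows = shows-cong (λ a → trans (Local.output≡ lv 0 a) (Local.output≡ lu 0 a)) (mk⇔ id id) shows₂
              ; neighbours = λ {_} {_} {x} R′f x∈f → trans (trans (Local.neighbours≡ lv (toℕ x) _) (Local.neighbours≡ lu (toℕ x) _))
                  (neighbours-added adds legal′ {κ₂} (λ Rf x∈f → trans (same₂ 3 _ _ (λ ())) (Represents.neighbours represents Rf x∈f)) R′f x∈f)
              ; holds = holds-added adds legal′ h₃ hu lu hv lv
              }
            ; unflagged = λ x c → trans (flags₅ x c) (trans (flags₄ x c) (unflagged₃ x c))
            ; input = λ q → trans (trans (Local.output≡ lv 0 _) (Local.output≡ lu 0 _))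
                (trans (far₂ _ (≤-trans beyond (≤-trans (m≤n+m ptr 3) (m≤n+m (3 + ptr) q)))) (trans (cong (κ 0 0) (shift q)) (input (3 + q))))
            ; beyond = ≤-trans beyond (m≤n+m ptr 3)
            ; room = 3+ptr≤
            } ) } } } }
      where
      shift : ∀ q → q + (3 + ptr) ≡ 3 + q + ptr
      shift q = solve 2 (λ q p → q :+ (con 3 :+ p) := con 3 :+ q :+ p) refl q ptr
        where open +-*-Solver
      κ₃ = upd (upd κ₂ 3 (toℕ u) c (toℕ v)) 3 (toℕ v) c (toℕ u)
      h₃ : ∀ x → Holds κ₃ (toℕ x) (ClassAt R x)
      h₃ x = holds-cong same₃ (h x)
        where
        same₃ : ∀ t a → t ≢ 0 → t ≢ 3 → κ₃ t (toℕ x) a ≡ κ t (toℕ x) a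
        same₃ t a t≢0 t≢3 = trans (upd-other (upd κ₂ 3 (toℕ u) c (toℕ v)) {3} {toℕ v} {c} _ (λ (3≡t , _) → t≢3 (sym 3≡t)))
          (trans (upd-other κ₂ {3} {toℕ u} {c} _ (λ (3≡t , _) → t≢3 (sym 3≡t))) (same₂ t (toℕ x) a t≢0))
      unflagged₃ : ∀ x c → κ₃ 7 x c ≡ 0
      unflagged₃ x c = trans (same₂ 7 x c (λ ())) (unflagged x c)
      above : ∀ {x} → x ∈ₑ e → ∀ {q} → ClassAt R x q → toℕ j < q
      above x∈e at@(i , f , refl , Rf , _) = ≤∧≢⇒< (j≤ Rf) (λ j≡i → classAt-new adds legal′ x∈e (subst (ClassAt R _) (sym j≡i) at))

  loopTime : ℕ → ℕ
  loopTime l = l * suc (sizeᵉ (r 8) + bodyTime) + suc (sizeᵉ (r 8))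

  iterate : ∀ s b l → suc (s + (b + (l * suc (s + b) + suc s))) ≡ suc l * suc (s + b) + suc s
  iterate = solve 3 (λ s b l → con 1 :+ (s :+ (b :+ (l :* (con 1 :+ (s :+ b)) :+ (con 1 :+ s))))
                            := (con 1 :+ l) :* (con 1 :+ (s :+ b)) :+ (con 1 :+ s)) refl
    where open +-*-Solver

  record Pending (M : Matchings k m) (R : Classes) (xs : List (Fin k × Fin m)) : Set where
    field
      split      : ∀ {i f} → f ∈ M i ⇔ (R i f ⊎ (i , f) ∈ˡ xs)
      fresh      : ∀ {i f} → (i , f) ∈ˡ xs → ¬ R i f
      above      : ∀ {i f j e} → R i f → (j , e) ∈ˡ xs → j Fin.≤ i
      descending : AllPairs (λ p q → proj₁ p ≥ᶠ proj₁ q) xs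
      distinct   : Unique xs

  module _ {M : Matchings k m} (legal : Legal (edgesOf M)) where
    open Legal legal

    ⊆-legal : ∀ {R} → (∀ {i f} → R i f → f ∈ M i) → Legal R
    ⊆-legal R⊆ = record { matching = λ Re Rf → matching (R⊆ Re) (R⊆ Rf) ; unique = λ Re Re′ → unique (R⊆ Re) (R⊆ Re′) }

    module _ {R j e xs} (pending : Pending M R ((j , e) ∷ xs)) where
      open Pending pending

      Next : Classes
      Next i f = R i f ⊎ (i ≡ j × f ≡ e)

      next-adds : Adds R Next j e
      next-adds = record
        { ⇔R  = mk⇔ id id
        ; new = λ (i , Re) → fresh (here refl) (subst (λ i → R i e) (unique (from split (inj₁ Re)) (from split (inj₂ (here refl)))) Re) }

      next-legal : Legal Next
      next-legal = ⊆-legal λ { (inj₁ Rf) → from split (inj₁ Rf) ; (inj₂ (refl , refl)) → from split (inj₂ (here refl)) }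

      next-pending : Pending M Next xs
      next-pending with descending | distinct
      ... | ≥s ∷ desc | ≢s ∷ dist = record
        { split = mk⇔
            (λ f∈ → case to split f∈ of λ { (inj₁ Rf) → inj₁ (inj₁ Rf) ; (inj₂ (here refl)) → inj₁ (inj₂ (refl , refl)) ; (inj₂ (there f∈)) → inj₂ f∈ })
            (λ { (inj₁ (inj₁ Rf)) → from split (inj₁ Rf) ; (inj₁ (inj₂ (refl , refl))) → from split (inj₂ (here refl)) ; (inj₂ f∈) → from split (inj₂ (there f∈)) })
        ; fresh = λ f∈ → [ fresh (there f∈) , (λ { (refl , refl) → All.lookup ≢s f∈ refl }) ]′
        ; above = λ { (inj₁ Rf) e∈ → above Rf (there e∈) ; (inj₂ (refl , refl)) e∈ → All.lookup ≥s e∈ }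
        ; descending = desc ; distinct = dist }

    loaded-all : ∀ {R S κ ptr} → Pending M R [] → Loading [] R S κ ptr → Represents (edgesOf M) S κ
    loaded-all {R} pending loading = record
      { shows = shows
      ; neighbours = λ f∈ → neighbours (R⇐ f∈)
      ; holds = λ u → holds-⇔ (λ c → mk⇔ (λ (i , f , i≡ , f∈ , u∈) → i , f , i≡ , R⇐ f∈ , u∈)
          (λ (i , f , i≡ , Rf , u∈) → i , f , i≡ , from (Pending.split pending) (inj₁ Rf) , u∈)) (holds u) }
      where
      open Represents (Loading.represents loading)
      R⇐ : ∀ {i f} → f ∈ M i → R i f
      R⇐ f∈ = case to (Pending.split pending) f∈ of λ { (inj₁ Rf) → Rf ; (inj₂ ()) }

    invariant-all : ∀ {R A} → Pending M R [] → Invariant R A → Invariant (edgesOf M) A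
    invariant-all {R} pending inv = record
      { N⇔ = mk⇔ (λ e∈ → map₂ (map₂ R⇒) (to N⇔ e∈)) (λ (u∈ , pe) → from N⇔ (u∈ , map₂ R⇐ pe))
      ; out⇔ = mk⇔ (λ e∈ → let pe , t = to out⇔ e∈ in map₂ R⇒ pe , λ u u∈ f u∈f pf (i , j , ei , fj , i<j) →
                             t u u∈ f u∈f (map₂ R⇐ pf) (i , j , R⇐ ei , R⇐ fj , i<j))
                   (λ (pe , t) → from out⇔ (map₂ R⇐ pe , λ u u∈ f u∈f pf (i , j , ei , fj , i<j) →
                             t u u∈ f u∈f (map₂ R⇒ pf) (i , j , R⇒ ei , R⇒ fj , i<j))) }
      where
      open Invariant inv
      R⇒ : ∀ {i f} → R i f → f ∈ M i
      R⇒ Rf = from (Pending.split pending) (inj₁ Rf)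
      R⇐ : ∀ {i f} → f ∈ M i → R i f
      R⇐ f∈ = case to (Pending.split pending) f∈ of λ { (inj₁ Rf) → Rf ; (inj₂ ()) }

    fold-invariant : ∀ xs {R A} → Pending M R xs → Invariant R A → Invariant (edgesOf M) (foldl initStep A xs)
    fold-invariant []             pending inv = invariant-all pending inv
    fold-invariant ((j , e) ∷ xs) pending inv = fold-invariant xs (next-pending pending)
      (initStep-invariant (next-legal pending) (next-adds pending) (λ Rf → Pending.above pending Rf (here refl)) inv)

    load-rule : ∀ xs {R A a u v c ptr z x i p w κ} → Pending M R xs → Invariant R A → Loading xs R (AlgState.out A) κ ptr →
      [ ⟪ file a u v c ptr z x i (length xs) p w ∣ κ ⟫ ] initLoop
        [ loopTime (length xs) , InState (edgesOf M) (AlgState.out (foldl initStep A xs)) ]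
    load-rule [] {κ = κ} pending inv loading = loop-stop {e = r 8} {initBody} _ refl
      (_ , _ , _ , _ , _ , _ , _ , _ , _ , _ , _ , κ , refl , loaded-all pending loading)
    load-rule ((j , e) ∷ xs) {R} {A} pending inv loading =
      weaken {p = initLoop} (≤-reflexive (iterate (sizeᵉ (r 8)) bodyTime (length xs))) (λ _ q → q)
        (loop-step {e = r 8} {initBody} _ (λ ())
          (body-rule (next-adds pending) (next-legal pending) (λ Rf → Pending.above pending Rf (here refl)) inv loading)
          λ { _ (_ , _ , _ , _ , _ , _ , _ , _ , _ , _ , _ , refl , loading′) →
            load-rule xs (next-pending pending)
              (initStep-invariant (next-legal pending) (next-adds pending) (λ Rf → Pending.above pending Rf (here refl)) inv) loading′ })

-- Sizes

suc≤2^ : ∀ q → suc q ≤ 2 ^ q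
suc≤2^ zero    = ≤-refl
suc≤2^ (suc q) = begin
  suc (suc q)    ≤⟨ s≤s (m≤n+m (suc q) q) ⟩
  suc (q + suc q) ≡⟨⟩
  suc q + suc q  ≡⟨ cong (suc q +_) (sym (+-identityʳ (suc q))) ⟩
  2 * suc q      ≤⟨ *-monoʳ-≤ 2 (suc≤2^ q) ⟩
  2 ^ suc q      ∎ where open ≤-Reasoning

log₂-suc≤ : ∀ q → ⌊log₂ suc q ⌋ ≤ q
log₂-suc≤ q = ≤-trans (⌊log₂⌋-mono-≤ (suc≤2^ q)) (≤-reflexive (⌊log₂[2^n]⌋≡n q))

log₂-suc≤suc : ∀ q → ⌊log₂ suc q ⌋ ≤ suc ⌊log₂ q ⌋
log₂-suc≤suc zero = z≤n
log₂-suc≤suc q@(suc q′) = ≤-trans (⌊log₂⌋-mono-≤ {suc q} {2 * q} (s≤s (≤-trans (≤-reflexive (+-comm 1 q′)) (+-monoʳ-≤ q′ (s≤s z≤n)))))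
  (≤-reflexive (⌊log₂[2*b]⌋≡1+⌊log₂b⌋ q))

<2^-log₂ : ∀ q → q < 2 ^ suc ⌊log₂ q ⌋
<2^-log₂ q = bound ⌊log₂ q ⌋ q ≤-refl
  where
  bound : ∀ d q → ⌊log₂ q ⌋ ≤ d → q < 2 ^ suc d
  bound d       zero          _ = m^n>0 2 (suc d)
  bound d       (suc zero)    _ = *-monoʳ-≤ 2 (m^n>0 2 d)
  bound zero    q@(suc (suc _)) h = contradiction (≤-trans (log₂-half q (s≤s (s≤s z≤n))) h) λ ()
  bound (suc d) q@(suc (suc _)) h = ≤-trans step-up (*-monoʳ-≤ 2 (bound d (q / 2) (≤-pred (≤-trans (log₂-half q (s≤s (s≤s z≤n))) h))))
    where
    step-up : suc q ≤ 2 * suc (q / 2)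
    step-up = case child q of λ
      { (inj₁ p≡) → ≤-trans (≤-trans (≤-reflexive (cong suc p≡)) (n≤1+n _)) (≤-reflexive (sym (*-suc 2 (q / 2))))
      ; (inj₂ p≡) → ≤-reflexive (trans (cong suc (trans p≡ (+-comm _ 1))) (sym (*-suc 2 (q / 2)))) }

module _ {n m : ℕ} (G : Graph n m) where
  open Graph G

  edges≤n² : m ≤ n * n
  edges≤n² = Finₚ.injective⇒≤ {f = λ e → Fin.combine (proj₁ (ends e)) (proj₂ (ends e))} λ {e} {f} p≡ →
    let p₁ , p₂ = Finₚ.combine-injective (proj₁ (ends e)) (proj₂ (ends e)) (proj₁ (ends f)) (proj₂ (ends f)) p≡ in
    simple e f λ u → mk⇔ (λ { (inj₁ u≡) → inj₁ (trans u≡ p₁) ; (inj₂ u≡) → inj₂ (trans u≡ p₂) })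
                         (λ { (inj₁ u≡) → inj₁ (trans u≡ (sym p₁)) ; (inj₂ u≡) → inj₂ (trans u≡ (sym p₂)) })

lookup-injective : ∀ {A : Set} {xs : List A} → Unique xs → ∀ i j → List.lookup xs i ≡ List.lookup xs j → i ≡ j
lookup-injective (x∉ ∷ uniq) zero    zero    _  = refl
lookup-injective (x∉ ∷ uniq) zero    (suc j) p≡ = contradiction p≡ (All.lookup x∉ (∈-lookup j))
lookup-injective (x∉ ∷ uniq) (suc i) zero    p≡ = contradiction (sym p≡) (All.lookup x∉ (∈-lookup i))
lookup-injective (x∉ ∷ uniq) (suc i) (suc j) p≡ = cong suc (lookup-injective uniq i j p≡)

enumeration-length : ∀ {k m} {M : Matchings k m} {L} → (∀ {i j e} → e ∈ M i → e ∈ M j → i ≡ j) → Enumerates M L → length L ≤ m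
enumeration-length {L = L} uniq enumerates = Finₚ.injective⇒≤ {f = λ i → proj₂ (List.lookup L i)} λ {i} {j} p≡ →
  lookup-injective unique i j (cong₂ _,_ (uniq (at i) (subst (_∈ _) (sym p≡) (at j))) p≡)
  where
  open Enumerates enumerates
  at : ∀ i → _
  at i = to (complete _ _) (∈-lookup i)

words-++ : ∀ q xs a → words (replicate q 0 ++ xs) (a + q) ≡ words xs a
words-++ zero    xs a rewrite +-identityʳ a = refl
words-++ (suc q) xs a rewrite +-suc a q = words-++ q xs a

words-zeros : ∀ q xs {a} → a < q → words (replicate q 0 ++ xs) a ≡ 0
words-zeros (suc q) xs {zero}  _        = refl
words-zeros (suc q) xs {suc a} (s≤s a<) = words-zeros q xs a<

words-beyond : ∀ xs {a} → length xs ≤ a → words xs a ≡ 0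
words-beyond []       _        = refl
words-beyond (x ∷ xs) (s≤s a≥) = words-beyond xs a≥

prologue : Cmd
prologue =
  10 ≔ bin div (reg 0) (lit 8) ⨟
  11 ≔ bin shl (lit 1) (reg 10) ⨟
  12 ≔ bin add (bin div (reg 2) (reg 10)) (lit 1) ⨟
  4 ≔ reg 1 ⨟
  8 ≔ reg 3

implementation : Implementation
implementation = record
  { initCode   = prologue ⨟ compile initLoop
  ; insertCode = compile insertProgram
  ; deleteCode = compile deleteProgram
  }

double-leaves : ∀ {q k z} → q ≤ k → 2 * k + 4 ≤ z → 2 * (q + 1) + 2 ≤ z
double-leaves {q} {k} {z} q≤k k≤z = begin
  2 * (q + 1) + 2  ≡⟨ solve 1 (λ q → con 2 :* (q :+ con 1) :+ con 2 := con 2 :* q :+ con 4) refl q ⟩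
  2 * q + 4        ≤⟨ +-monoˡ-≤ 4 (*-monoʳ-≤ 2 q≤k) ⟩
  2 * k + 4        ≤⟨ k≤z ⟩
  z                ∎
  where
  open ≤-Reasoning
  open +-*-Solver

+3≤2^ : ∀ b → 3 ≤ b → b + 3 ≤ 2 ^ b
+3≤2^ (suc (suc zero)) (s≤s (s≤s ()))
+3≤2^ (suc (suc (suc b))) _ = begin
  3 + b + 3      ≡⟨ solve 1 (λ b → con 3 :+ b :+ con 3 := con 6 :+ b) refl b ⟩
  6 + b          ≤⟨ +-mono-≤ {6} {8} {b} {8 * b} (≤ᵇ⇒≤ 6 8 _) (m≤n*m b 8) ⟩
  8 + 8 * b      ≡⟨ sym (*-suc 8 b) ⟩
  8 * suc b      ≤⟨ *-monoʳ-≤ 8 (suc≤2^ b) ⟩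
  2 ^ 3 * 2 ^ b  ≡⟨ sym (^-distribˡ-+-* 2 3 b) ⟩
  2 ^ (3 + b)    ∎
  where
  open ≤-Reasoning
  open +-*-Solver

word-index : ∀ {j k} b .{{_ : NonZero b}} → j < k → j / b < k / b + 1
word-index {j} {k} b j<k = ≤-trans (s≤s (/-monoˡ-≤ b (<⇒≤ j<k))) (≤-reflexive (+-comm 1 (k / b)))

eighth : ∀ {l W} → 64 * l ≤ W → 8 * l ≤ W / 8
eighth {l} {W} h = subst (_≤ W / 8) (trans (cong (_/ 8) (trans (*-assoc 8 8 l) (*-comm 8 (8 * l)))) (m*n/n≡m (8 * l) 8)) (/-monoˡ-≤ 8 h)

-- B is W / 8, since addresses take up to 2 B + 3 bits
module Layout {n k W B : ℕ} (8λ≤B : 8 * suc ⌊log₂ (n ⊔ k) ⌋ ≤ B) (W/8≡B : W / 8 ≡ B) where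
  λ′ Z Q P : ℕ
  λ′ = suc ⌊log₂ (n ⊔ k) ⌋
  Z = 2 ^ B
  P = 2 ^ λ′

  8≤B : 8 ≤ B
  8≤B = ≤-trans (m≤m*n 8 λ′) 8λ≤B

  instance
    B≢0′ : NonZero B
    B≢0′ = ℕ.>-nonZero (≤-trans (s≤s z≤n) 8≤B)

  Q = k / B + 1

  8B≤W : 8 * B ≤ W
  8B≤W = ≤-trans (≤-reflexive (trans (*-comm 8 B) (cong (_* 8) (sym W/8≡B)))) (m/n*n≤m W 8)

  B≤W : B ≤ W
  B≤W = ≤-trans (m≤n*m B 8) 8B≤W

  B<W : B < W
  B<W = <-≤-trans (subst (B <_) (*-comm B 8) (m<m*n B 8 (s≤s (s≤s z≤n)))) 8B≤W

  8PP≤Z : 8 * (P * P) ≤ Z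
  8PP≤Z = ≤-trans (≤-reflexive (trans (cong (8 *_) (sym (^-distribˡ-+-* 2 λ′ λ′))) (sym (^-distribˡ-+-* 2 3 (λ′ + λ′)))))
    (^-monoʳ-≤ 2 (≤-trans (few λ′ (s≤s z≤n)) 8λ≤B))
    where
    few : ∀ l → 1 ≤ l → 3 + (l + l) ≤ 8 * l
    few l 1≤l = ≤-trans (+-monoˡ-≤ (l + l) (≤-trans (*-monoʳ-≤ 3 1≤l) (m≤m+n (3 * l) (3 * l))))
      (≤-reflexive (solve 1 (λ l → con 3 :* l :+ con 3 :* l :+ (l :+ l) := con 8 :* l) refl l))
      where open +-*-Solver

  small<P : n ⊔ k < P
  small<P = <2^-log₂ (n ⊔ k)

  n<P : n < P
  n<P = ≤-<-trans (m≤m⊔n n k) small<P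

  k<P : k < P
  k<P = ≤-<-trans (m≤n⊔m n k) small<P

  P≤PP : P ≤ P * P
  P≤PP = m≤m*n P P {{m^n≢0 2 λ′}}

  4P≤Z : 4 * P ≤ Z
  4P≤Z = ≤-trans (*-mono-≤ {4} {8} (s≤s (s≤s (s≤s (s≤s z≤n)))) P≤PP) 8PP≤Z

  2≤P : 2 ≤ P
  2≤P = *-monoʳ-≤ 2 (m^n>0 2 ⌊log₂ (n ⊔ k) ⌋)

  n<Z : n < Z
  n<Z = <-≤-trans n<P (≤-trans (m≤n*m P 4) 4P≤Z)

  2k+4≤Z : 2 * k + 4 ≤ Z
  2k+4≤Z = ≤-trans (+-mono-≤ (*-monoʳ-≤ 2 (<⇒≤ k<P)) (*-monoʳ-≤ 2 2≤P)) (≤-trans (≤-reflexive (sym (*-distribʳ-+ P 2 2))) 4P≤Z)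

  input-fits : ∀ {l} → l ≤ n * n → n + 3 * l < Z
  input-fits {l} l≤ = begin-strict
    n + 3 * l                    ≤⟨ +-mono-≤ (≤-trans (<⇒≤ n<P) P≤PP) (*-monoʳ-≤ 3 (≤-trans l≤ (*-mono-≤ (<⇒≤ n<P) (<⇒≤ n<P)))) ⟩
    P * P + 3 * (P * P)          ≡⟨⟩
    4 * (P * P)                  <⟨ *-monoˡ-< (P * P) {{ℕ.>-nonZero (≤-trans (<⇒≤ 2≤P) P≤PP)}} {4} {8} (≤ᵇ⇒≤ 5 8 _) ⟩
    8 * (P * P)                  ≤⟨ 8PP≤Z ⟩
    Z                            ∎ where open ≤-Reasoning

  8≤2^W : 8 ≤ 2 ^ W
  8≤2^W = ^-monoʳ-≤ 2 {3} {W} (≤-trans (≤-trans (≤ᵇ⇒≤ 3 8 _) 8≤B) B≤W)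

  8ZZ≤2^W : 8 * (Z * Z) ≤ 2 ^ W
  8ZZ≤2^W = begin
    8 * (Z * Z)         ≡⟨ cong (8 *_) (sym (^-distribˡ-+-* 2 B B)) ⟩
    2 ^ 3 * 2 ^ (B + B) ≡⟨ sym (^-distribˡ-+-* 2 3 (B + B)) ⟩
    2 ^ (3 + (B + B))   ≤⟨ ^-monoʳ-≤ 2 {3 + (B + B)} {W} (≤-trans (few B 8≤B) 8B≤W) ⟩
    2 ^ W               ∎
    where
    open ≤-Reasoning
    few : ∀ b → 8 ≤ b → 3 + (b + b) ≤ 8 * b
    few b 8≤b = ≤-trans (+-monoˡ-≤ (b + b) (≤-trans (≤ᵇ⇒≤ 3 8 _) (≤-trans 8≤b (m≤m+n b (5 * b)))))
      (≤-reflexive (solve 1 (λ b → b :+ con 5 :* b :+ (b :+ b) := con 8 :* b) refl b))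
      where open +-*-Solver

  1≤Q : 1 ≤ Q
  1≤Q = m≤n+m 1 (k / B)

  2Q+2≤Z : 2 * Q + 2 ≤ Z
  2Q+2≤Z = double-leaves (m/n≤m k B) 2k+4≤Z

  k+3≤Z : k + 3 ≤ Z
  k+3≤Z = ≤-trans (+-mono-≤ {k} {2 * k} {3} {4} (m≤n*m k 2) (n≤1+n 3)) 2k+4≤Z

  B+3≤Z : B + 3 ≤ Z
  B+3≤Z = +3≤2^ B (≤-trans (≤ᵇ⇒≤ 3 8 _) 8≤B)

  word<Q : ∀ {j} → j < k → j / B < Q
  word<Q = word-index B

  sizes : Sizes W Z B Q k
  sizes = record
    { 8≤2^W   = 8≤2^W
    ; 8ZZ≤2^W = 8ZZ≤2^W
    ; Z≡2^B   = refl
    ; B≢0     = B≢0′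
    ; B≤W     = B≤W
    ; 1≤Q     = 1≤Q
    ; 2Q+2≤Z  = 2Q+2≤Z
    ; k+3≤Z   = k+3≤Z
    ; B+3≤Z   = B+3≤Z
    ; word<Q  = word<Q
    }

  depth-bound : ⌊log₂ 2 * Q ⌋ ≤ 2 * updateTime n k
  depth-bound = begin
    ⌊log₂ 2 * Q ⌋                    ≡⟨ ⌊log₂[2*b]⌋≡1+⌊log₂b⌋ Q {{ℕ.>-nonZero (m≤n+m 1 (k / B))}} ⟩
    1 + ⌊log₂ Q ⌋                    ≤⟨ +-mono-≤ {1} {updateTime n k} (⊓-glb (s≤s z≤n) (s≤s z≤n)) (⊓-glb by-log by-word) ⟩
    updateTime n k + updateTime n k  ≡⟨ cong (updateTime n k +_) (sym (+-identityʳ _)) ⟩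
    2 * updateTime n k               ∎
    where
    open ≤-Reasoning
    by-log : ⌊log₂ Q ⌋ ≤ suc ⌊log₂ k ⌋
    by-log = ≤-trans (⌊log₂⌋-mono-≤ (≤-trans (+-monoˡ-≤ 1 (m/n≤m k B)) (≤-reflexive (+-comm k 1)))) (log₂-suc≤suc k)
    by-word : ⌊log₂ Q ⌋ ≤ suc (k / suc ⌊log₂ n ⌋)
    by-word = ≤-trans (≤-trans (≤-reflexive (cong ⌊log₂_⌋ (+-comm (k / B) 1))) (log₂-suc≤ (k / B)))
      (m≤n⇒m≤1+n (/-monoʳ-≤ k (≤-trans (s≤s (⌊log₂⌋-mono-≤ (m≤m⊔n n k))) (≤-trans (m≤n*m λ′ 8) 8λ≤B))))

amortized-update : ∀ p q a b {t d C} → 1 ≤ t → d ≤ 2 * t → p + 2 * (q + (2 * a + b)) ≤ C → p + 2 * (q + (d * a + b)) ≤ C * t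
amortized-update p q a b {t@(suc t′)} {d} {C} _ d≤ ≤C = begin
  p + 2 * (q + (d * a + b))        ≤⟨ +-monoʳ-≤ p (*-monoʳ-≤ 2 (+-monoʳ-≤ q (+-monoˡ-≤ b (*-monoˡ-≤ a d≤)))) ⟩
  p + 2 * (q + (2 * t * a + b))    ≤⟨ m≤m+n _ ((p + 2 * q + 2 * b) * t′) ⟩
  p + 2 * (q + (2 * t * a + b)) + (p + 2 * q + 2 * b) * t′
    ≡⟨ solve 5 (λ p q a b t′ → p :+ con 2 :* (q :+ (con 2 :* (con 1 :+ t′) :* a :+ b)) :+ (p :+ con 2 :* q :+ con 2 :* b) :* t′
                 := (p :+ con 2 :* (q :+ (con 2 :* a :+ b))) :* (con 1 :+ t′)) refl p q a b t′ ⟩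
  (p + 2 * (q + (2 * a + b))) * t  ≤⟨ *-monoˡ-≤ t ≤C ⟩
  C * t                            ∎
  where
  open ≤-Reasoning
  open +-*-Solver

amortized-init : ∀ p a b {l m C} → l ≤ m → p + a + b ≤ C → p + (l * a + b) ≤ C * (1 + m)
amortized-init p a b {l} {m} {C} l≤m ≤C = begin
  p + (l * a + b)                        ≤⟨ +-monoʳ-≤ p (+-monoˡ-≤ b (*-monoˡ-≤ a l≤m)) ⟩
  p + (m * a + b)                        ≤⟨ m≤m+n _ (a + p * m + b * m) ⟩
  p + (m * a + b) + (a + p * m + b * m)  ≡⟨ solve 4 (λ p a b m → p :+ (m :* a :+ b) :+ (a :+ p :* m :+ b :* m) := (p :+ a :+ b) :* (con 1 :+ m)) refl p a b m ⟩
  (p + a + b) * (1 + m)                  ≤⟨ *-monoˡ-≤ (1 + m) ≤C ⟩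
  C * (1 + m)                            ∎
  where
  open ≤-Reasoning
  open +-*-Solver

module Correctness {c ℓ₁ ℓ₂} {F : OrderedField c ℓ₁ ℓ₂} {n m k W B : ℕ} (8λ≤B : 8 * suc ⌊log₂ (n ⊔ k) ⌋ ≤ B) (W/8≡B : W / 8 ≡ B)
  (WG : WeightedGraph F n m) {lo hi : Fin k → OrderedField.Carrier F} {δ : OrderedField.Carrier F} (spread : IsSpread F δ lo hi) where
  open WeightedGraph WG using (graph)
  open Graph graph
  open Layout {n} {k} {W} {B} 8λ≤B W/8≡B
  open Algorithm graph {k}
  open Combinatorics graph {k}
  open Preservation graph {k}
  open Display graph {k}
  open Programs W Z 8≤2^W 8ZZ≤2^W
  open Machine sizes using (file; 1<Z; sum<2^W; lift<)
  open Vertex sizes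
  open Classes sizes
  open Simulation graph sizes n<Z
  open Insertion graph sizes n<Z
  open Deletion graph sizes n<Z
  open Initialization graph sizes n<Z
  open CensusWeight F {k = k} WG

  legal : ∀ {M} → Admissible F WG lo hi M → Legal (edgesOf M)
  legal admissible = record { matching = Admissible.matchings admissible _ ; unique = disjoint⇒unique spread admissible }

  insert-adds : ∀ {M j e} → e ∉ M j → Legal (edgesOf (change (insert j e) M)) → Adds (edgesOf M) (edgesOf (change (insert j e) M)) j e
  insert-adds {M} {j} {e} e∉ legal′ = record { ⇔R = ⇔R ; new = λ (i , e∈) →
      e∉ (subst (λ i → e ∈ M i) (Legal.unique legal′ (from ⇔R (inj₁ e∈)) (from ⇔R (inj₂ (refl , refl)))) e∈) }
    where
    ⇔R : ∀ {i f} → f ∈ change (insert j e) M i ⇔ (f ∈ M i ⊎ (i ≡ j × f ≡ e))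
    ⇔R {i} {f} with i Fin.≟ j
    ... | yes refl rewrite VFₚ.updateAt-updates i {_∪ ⁅ e ⁆} M = mk⇔
      (λ f∈ → case to (∈-add⇔ {p = M i}) f∈ of λ { (inj₁ f∈) → inj₁ f∈ ; (inj₂ f≡) → inj₂ (refl , f≡) })
      (λ { (inj₁ f∈) → from ∈-add⇔ (inj₁ f∈) ; (inj₂ (_ , f≡)) → from (∈-add⇔ {p = M i}) (inj₂ f≡) })
    ... | no i≢j rewrite VFₚ.updateAt-minimal i j {_∪ ⁅ e ⁆} M i≢j =
      mk⇔ inj₁ (λ { (inj₁ f∈) → f∈ ; (inj₂ (i≡j , _)) → contradiction i≡j i≢j })

  delete-adds : ∀ {M j e} → e ∈ M j → Legal (edgesOf M) → Adds (edgesOf (change (delete j e) M)) (edgesOf M) j e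
  delete-adds {M} {j} {e} e∈ legal = record { ⇔R = ⇔R ; new = λ (i , e∈′) →
      let e∈i , ≢ = to removed e∈′ in ≢ (Legal.unique legal e∈i e∈ , refl) }
    where
    removed : ∀ {i f} → f ∈ change (delete j e) M i ⇔ (f ∈ M i × ¬ (i ≡ j × f ≡ e))
    removed {i} {f} with i Fin.≟ j
    ... | yes refl rewrite VFₚ.updateAt-updates i {_- e} M = mk⇔
      (λ f∈ → let f∈M , f≢ = to (∈-remove⇔ {p = M i}) f∈ in f∈M , f≢ ∘ proj₂)
      (λ (f∈ , ≢) → from ∈-remove⇔ (f∈ , λ f≡ → ≢ (refl , f≡)))
    ... | no i≢j rewrite VFₚ.updateAt-minimal i j {_- e} M i≢j = mk⇔ (λ f∈ → f∈ , i≢j ∘ proj₁) proj₁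
    ⇔R : ∀ {i f} → f ∈ M i ⇔ (f ∈ change (delete j e) M i ⊎ (i ≡ j × f ≡ e))
    ⇔R {i} {f} = mk⇔
      (λ f∈ → case (i Fin.≟ j) ×-dec (f Fin.≟ e) of λ { (yes p≡) → inj₂ p≡ ; (no ≢) → inj₁ (from removed (f∈ , ≢)) })
      (λ { (inj₁ f∈) → proj₁ (to removed f∈) ; (inj₂ (refl , refl)) → e∈ })

  empty-tables : ∀ {κ x} → (∀ t a → κ (suc t) x a ≡ 0) → Holds κ x (λ _ → ⊥)
  empty-tables {κ} {x} zeros = record
    { D = λ _ → false ; xs = []
    ; tree = record
      { bounded = λ ()
      ; words≡  = λ i → trans (zeros 3 i) (sym (label≡0⇒word≡0 (λ _ → false) B (no-label B)))
      ; table   = λ ()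
      ; leaves  = λ {i} _ → trans (zeros 4 _) (sym (cong (λ a → if a ≡ᵇ 0 then 0 else i * B + a) (no-label B)))
      ; tournament = λ p _ _ → trans (zeros 4 p) (sym (cong₂ _⊔_ (zeros 4 (2 * p)) (zeros 4 (2 * p + 1))))
      ; small   = λ p → subst (_≤ k) (sym (zeros 4 p)) z≤n
      }
    ; chain = nil (zeros 0 0) (zeros 1 0)
    ; sorted = [] ; positive = λ () ; flagged = λ () ; listed = λ ()
    ; members = λ _ → mk⇔ (λ ()) (λ { (inj₁ ()) ; (inj₂ ()) })
    }
    where
    no-label : ∀ b → label (λ _ → false) b ≡ 0
    no-label zero    = refl
    no-label (suc b) = no-label b

  prologueTime : ℕ
  prologueTime = 100

  inputCells : List (Fin k × Fin m) → ℕ → ℕ → ℕ → ℕ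
  inputCells L zero    zero    a = words (replicate n 0 ++ concatMap (triple graph) L) a
  inputCells L zero    (suc _) a = 0
  inputCells L (suc _) _       a = 0

  length-triples : ∀ (L : List (Fin k × Fin m)) → length (concatMap (triple graph) L) ≡ 3 * length L
  length-triples []      = refl
  length-triples (x ∷ L) = trans (cong (3 +_) (length-triples L)) (sym (*-suc 3 (length L)))

  eight : truncate W 8 ≡ 8
  eight = truncate-small (<-≤-trans {8} {16} (≤ᵇ⇒≤ 9 16 _) (^-monoʳ-≤ 2 {4} {W} (≤-trans (≤-trans (≤ᵇ⇒≤ 4 8 _) 8≤B) B≤W)))

  one : truncate W 1 ≡ 1
  one = truncate-small (lift< 1<Z)

  B≡ : applyOp W div W (truncate W 8) ≡ B
  B≡ = trans (cong (applyOp W div W) eight) W/8≡B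

  Z<2^W : Z < 2 ^ W
  Z<2^W = ^-monoʳ-< 2 ≤-refl B<W

  shl-one : ∀ {x y} → x ≡ 1 → y ≡ B → applyOp W shl x y ≡ Z
  shl-one refl refl = trans (cong (truncate W) (*-identityˡ Z)) (truncate-small Z<2^W)

  Z≡ : applyOp W shl (truncate W 1) (applyOp W div W (truncate W 8)) ≡ Z
  Z≡ = shl-one one B≡

  Q≡ : applyOp W add (applyOp W div k (applyOp W div W (truncate W 8))) (truncate W 1) ≡ Q
  Q≡ = trans (cong₂ (applyOp W add) (trans (cong (applyOp W div k) B≡) (applyOp-div W k B)) one)
    (truncate-small (sum<2^W (≤-<-trans (m/n≤m k B) k<Z) 1<Z))
    where
    k<Z : k < Z
    k<Z = <-≤-trans k<P (≤-trans (m≤n*m P 4) 4P≤Z)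

  loadedRegs : List (Fin k × Fin m) → ℕ → ℕ
  loadedRegs L = words (W ∷ n ∷ k ∷ length L ∷ [])
    [ 10 ↦ applyOp W div W (truncate W 8) ]
    [ 11 ↦ applyOp W shl (truncate W 1) (applyOp W div W (truncate W 8)) ]
    [ 12 ↦ applyOp W add (applyOp W div k (applyOp W div W (truncate W 8))) (truncate W 1) ]
    [ 4 ↦ n ] [ 8 ↦ length L ]

  prologue-steps : ∀ L → ∃[ t ] (⟪_,_⟫⇓⟪_,_⟫ W prologue (initialStore graph W L)
    (store (loadedRegs L) (memory (initialStore graph W L))) t × t ≤ prologueTime)
  prologue-steps L = _ , ⇓seq ⇓assign (⇓seq ⇓assign (⇓seq ⇓assign (⇓seq ⇓assign ⇓assign))) , ≤ᵇ⇒≤ _ prologueTime _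

  loadedRegs≡ : ∀ L a → loadedRegs L a ≡ words (file W n k (length L) n 0 0 0 (length L) 0 0) a
  loadedRegs≡ L 0 = refl
  loadedRegs≡ L 1 = refl
  loadedRegs≡ L 2 = refl
  loadedRegs≡ L 3 = refl
  loadedRegs≡ L 4 = refl
  loadedRegs≡ L 5 = refl
  loadedRegs≡ L 6 = refl
  loadedRegs≡ L 7 = refl
  loadedRegs≡ L 8 = refl
  loadedRegs≡ L 9 = refl
  loadedRegs≡ L 10 = B≡
  loadedRegs≡ L 11 = Z≡
  loadedRegs≡ L 12 = Q≡
  loadedRegs≡ L 13 = refl
  loadedRegs≡ L (suc (suc (suc (suc (suc (suc (suc (suc (suc (suc (suc (suc (suc (suc a)))))))))))))) = refl

  prologue-rep : ∀ L → length L ≤ n * n →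
    Rep (store (loadedRegs L) (memory (initialStore graph W L))) ⟪ file W n k (length L) n 0 0 0 (length L) 0 0 ∣ inputCells L ⟫
  prologue-rep L L≤ = record { regs≡ = loadedRegs≡ L ; mem≡ = λ {t} {u} {a} → cells t u a ; Z≡ = refl }
    where
    listed = replicate n 0 ++ concatMap (triple graph) L
    used : length listed < Z
    used = subst (_< Z) (sym (trans (Listₚ.length-++ (replicate n 0)) (cong₂ _+_ (Listₚ.length-replicate n) (length-triples L)))) (input-fits L≤)
    cells : ∀ t u a → t < 8 → u < Z → a < Z → words listed (addr t u a) ≡ inputCells L t u a
    cells zero    zero    a _ _ _ = refl
    cells zero    (suc u) a _ _ _ = words-beyond listed (≤-trans (<⇒≤ used) (≤-trans (m≤m+n Z (u * Z)) (m≤m+n (suc u * Z) a)))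
    cells (suc t) u       a _ _ _ = words-beyond listed
      (≤-trans (<⇒≤ used) (≤-trans (m≤n*m Z (suc t * Z + u) {{ℕ.>-nonZero (≤-trans (m^n>0 2 B) (≤-trans (m≤m+n Z (t * Z)) (m≤m+n (suc t * Z) u)))}})
        (m≤m+n ((suc t * Z + u) * Z) a)))

  Sound : Matchings k m → AlgState n m → Store → Set
  Sound M A s = Invariant (edgesOf M) A × ∃[ σ ] (Rep s σ × InState (edgesOf M) (AlgState.out A) σ)

  init-sound : ∀ {M L} → Admissible F WG lo hi M → Enumerates M L →
    ∃[ s ] ∃[ t ] (⟪_,_⟫⇓⟪_,_⟫ W (Implementation.initCode implementation) (initialStore graph W L) s t
      × t ≤ prologueTime + loopTime (length L) × Sound M (initialize L) s)
  init-sound {M} {L} admissible enumerates =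
    let uniq = disjoint⇒unique spread admissible
        L≤ = ≤-trans (enumeration-length uniq enumerates) (edges≤n² graph)
        t₁ , run₁ , t₁≤ = prologue-steps L
        s₂ , t₂ , run₂ , t₂≤ , σ , R₂ , post = load-rule (legal admissible) L pending empty-invariant (loading L≤) _ (prologue-rep L L≤)
    in s₂ , t₁ + t₂ , ⇓seq run₁ run₂ , +-mono-≤ t₁≤ t₂≤
       , fold-invariant (legal admissible) L pending empty-invariant , σ , R₂ , post
    where
    open Enumerates enumerates
    ∅ᴿ : Classes
    ∅ᴿ _ _ = ⊥
    pending : Pending M ∅ᴿ L
    pending = record
      { split = mk⇔ (λ f∈ → inj₂ (from (complete _ _) f∈)) (λ { (inj₁ ()) ; (inj₂ f∈) → to (complete _ _) f∈ })
      ; fresh = λ _ () ; above = λ () ; descending = descending ; distinct = unique }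
    empty-invariant : Invariant ∅ᴿ ⟨ (λ _ → Sub.⊥) , Sub.⊥ ⟩
    empty-invariant = record
      { N⇔ = mk⇔ (λ e∈ → contradiction e∈ Subₚ.∉⊥) (λ { (_ , _ , ()) }) ; out⇔ = mk⇔ (λ e∈ → contradiction e∈ Subₚ.∉⊥) (λ { ((_ , ()) , _) }) }
    loading : length L ≤ n * n → Loading L ∅ᴿ Sub.⊥ (inputCells L) n
    loading L≤ = record
      { represents = record
        { shows = record
          { unmatched = λ u _ → words-zeros n _ (Finₚ.toℕ<n u)
          ; matched = λ u e e∈ → contradiction e∈ Subₚ.∉⊥ }
        ; neighbours = λ ()
        ; holds = λ u → holds-⇔ (λ _ → mk⇔ (λ { (_ , _ , _ , () , _) }) (λ ())) (empty-tables (λ _ _ → refl)) }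
      ; unflagged = λ _ _ → refl
      ; input = words-++ n _
      ; beyond = ≤-refl
      ; room = input-fits L≤ }

  with-arguments : ∀ {s j u v c y z x i b p w κ} (j′ : Fin k) (e : Fin m) → Rep s ⟪ file j u v c y z x i b p w ∣ κ ⟫ →
    Rep (withArguments graph j′ e s) ⟪ file (toℕ j′) (toℕ (proj₁ (ends e))) (toℕ (proj₂ (ends e))) c y z x i b p w ∣ κ ⟫
  with-arguments j′ e R = Rep-assign {a = 2} (Rep-assign {a = 1} (Rep-assign {a = 0} R refl refl _) refl refl _) refl refl _

  update-sound : ∀ {M A s} → Admissible F WG lo hi M → Sound M A s → ∀ x → Applicable M x → Admissible F WG lo hi (change x M) →
    ∃[ s′ ] ∃[ t ] (RunsUpdate graph implementation W x s s′ t × t ≤ updateBound × Sound (change x M) (perform x (change x M) A) s′)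
  update-sound {M} {A} {s} admissible (inv , _ , R , (_ , _ , _ , _ , _ , _ , _ , _ , _ , _ , _ , κ , refl , rep)) (insert j e) e∉ admissible′ =
    let adds = insert-adds {M} e∉ (legal admissible′)
        s′ , t , run , t≤ , σ , R′ , post = insert-rule {M} {change (insert j e) M} {A} (legal admissible) (legal admissible′) adds inv rep
          (withArguments graph j e s) (with-arguments j e R)
    in s′ , t , run , t≤ , insert-invariant {M} {change (insert j e) M} {A} (legal admissible) (legal admissible′) adds inv , σ , R′ , post
  update-sound {M} {A} {s} admissible (inv , _ , R , (_ , _ , _ , _ , _ , _ , _ , _ , _ , _ , _ , κ , refl , rep)) (delete j e) e∈ admissible′ =
    let adds = delete-adds {M} e∈ (legal admissible)
        s′ , t , run , t≤ , σ , R′ , post = delete-rule {M} {change (delete j e) M} {A} (legal admissible) (legal admissible′) adds inv rep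
          (withArguments graph j e s) (with-arguments j e R)
    in s′ , t , run , t≤ , delete-invariant {M} {change (delete j e) M} {A} (legal admissible) (legal admissible′) adds inv , σ , R′ , post

  runs-deterministic : ∀ (x : Update k m) {s s₁ s₂ t₁ t₂} → RunsUpdate graph implementation W x s s₁ t₁ → RunsUpdate graph implementation W x s s₂ t₂ → s₁ ≡ s₂
  runs-deterministic (insert _ _) = ⇓-deterministic
  runs-deterministic (delete _ _) = ⇓-deterministic

  run-sound : ∀ {M A s} → Run WG lo hi implementation W M A s → Admissible F WG lo hi M × Sound M A s
  run-sound (start admissible enumerates run) =
    let s , _ , run′ , _ , sound = init-sound admissible enumerates
    in admissible , subst (Sound _ _) (⇓-deterministic run′ run) sound
  run-sound (step run x applicable admissible′ update) =
    let admissible , sound = run-sound run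
        s′ , _ , update′ , _ , sound′ = update-sound admissible sound x applicable admissible′
    in admissible′ , subst (Sound _ _) (runs-deterministic x update′ update) sound′

  displays : ∀ {M A s} → Sound M A s → Displays graph s (AlgState.out A)
  displays {s = s} (_ , σ , R , (_ , _ , _ , _ , _ , _ , _ , _ , _ , _ , _ , κ , refl , rep)) = record
    { unmatched = λ u none → trans (output u) (Shows.unmatched (Represents.shows rep) u none)
    ; matched = λ u e e∈ u∈ → trans (output u) (Shows.matched (Represents.shows rep) u e e∈ u∈) }
    where
    output : ∀ u → memory s (toℕ u) ≡ κ 0 0 (toℕ u)
    output u = Rep.mem≡ R {0} {0} {toℕ u} (s≤s z≤n) (≤-trans (s≤s z≤n) 1<Z) (vertex<Z u)

  walkCost testCost : ℕ
  walkCost = suc (sizeᵉ (op lt (# 1) (r 9)) + cost walkBody)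
  testCost = suc (sizeᵉ (op lt (# 1) (r 9)))

  update-time : updateBound ≤ bigConstant * updateTime n k
  update-time = amortized-update baseTime (cost refresh) walkCost testCost {updateTime n k} {⌊log₂ 2 * Q ⌋} {bigConstant} (⊓-glb (s≤s z≤n) (s≤s z≤n)) depth-bound
    (baseTime+≤bigConstant (≤ᵇ⇒≤ (2 * (cost refresh + (2 * walkCost + testCost))) 5000 _))

  init-time : ∀ {M L} → Admissible F WG lo hi M → Enumerates M L → prologueTime + loopTime (length L) ≤ bigConstant * (1 + m)
  init-time {L = L} admissible enumerates = amortized-init prologueTime (suc (sizeᵉ (r 8) + bodyTime)) (suc (sizeᵉ (r 8))) {length L} {m} {bigConstant}
    (enumeration-length (disjoint⇒unique spread admissible) enumerates)
    (≤bigConstant (≤ᵇ⇒≤ (prologueTime + suc (sizeᵉ (r 8) + bodyTime) + suc (sizeᵉ (r 8))) 10000 _))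

theorem5p4 :
  ∀ {c ℓ₁ ℓ₂} →
  -- C is the constant of every O(·)
  Σ[ a ∈ ℕ ] Σ[ C ∈ ℕ ] Σ[ P ∈ Implementation ]
  ((F : OrderedField c ℓ₁ ℓ₂) → let module F = OrderedField F in
   -- word length Θ(log n) is allowed whenever k is polynomial in n, with a larger
   -- constant factor for a larger exponent
   ∀ (n m k W : ℕ) → a * suc ⌊log₂ (n ⊔ k) ⌋ ≤ W →
   (G : WeightedGraph F n m) → let open WeightedGraph G in
   (ε : F.Carrier) → F.0# F.< ε →
   (l r : Fin k → F.Carrier) → IsSpread F (ε F.⁻¹) l r →
     -- initialization time
     (∀ M L → Admissible F G l r M → Enumerates M L →
        ∃[ s ] ∃[ t ] (⟪_,_⟫⇓⟪_,_⟫ W (Implementation.initCode P) (initialStore graph W L) s t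
                       × t ≤ C * (1 + m)))
     ×
     (∀ M A s → Run G l r P W M A s →
        -- the machine outputs the matching of the algorithm
        Displays graph s (AlgState.out A)
        × LocallyGreedyCensus graph M (AlgState.out A)
        × (F.1# F.- C F.· ε) F.* F.sum (λ i → weight (M i)) F.≤ weight (AlgState.out A)
        × (∀ x → Applicable M x → Admissible F G l r (change x M) →
             -- update time
             (∃[ s′ ] ∃[ t ] (RunsUpdate graph P W x s s′ t × t ≤ C * updateTime n k))
             -- recourse
             × ∣ AlgState.out A △ AlgState.out (Algorithm.perform graph x (change x M) A) ∣ ≤ C)))
theorem5p4 = 64 , bigConstant , implementation , λ F n m k W wide G ε 0<ε l r spread →
  let module C = Correctness {F = F} {n} {m} {k} {W} {W / 8} (eighth {suc ⌊log₂ (n ⊔ k) ⌋} wide) refl G {l} {r} spread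
      module W = CensusWeight F {k = k} G
  in (λ M L admissible enumerates →
        let s , t , run , t≤ , _ = C.init-sound admissible enumerates
        in s , t , run , ≤-trans t≤ (C.init-time {M} {L} admissible enumerates))
   , λ M A s run →
        let admissible , sound = C.run-sound run
            invariant , _ = sound
            greedy = Combinatorics.census (WeightedGraph.graph G) (C.legal admissible) invariant
        in C.displays sound
         , greedy
         , W.census-weight bigConstant (≤bigConstant (≤ᵇ⇒≤ 4 10000 _)) 0<ε spread admissible greedy
         , λ x applicable admissible′ →
             let s′ , t , update , t≤ , _ = C.update-sound admissible sound x applicable admissible′
             in (s′ , t , update , ≤-trans t≤ C.update-time)
              , ≤-trans (Combinatorics.recourse (WeightedGraph.graph G) x (change x M) A) (≤bigConstant (≤ᵇ⇒≤ 3 10000 _))
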